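{- For every natural number $k$, the family of all graphs $G$ such that $G$ is $k$-creature-free and $G$ does not contain a $k$-skinny-ladder as an induced minor is strongly-quasi-tame.
   Context: All graphs are finite, simple and undirected. $N_G(X)$ denotes the open neighborhood of a vertex set $X$ (the vertices outside $X$ with a neighbor in $X$). Two disjoint vertex sets are anti-complete if there is no edge between them. Minimal separator: a non-empty set $S\subseteq V(G)$ such that $G-S$ has at least two distinct connected components $L,R$ with $N_G(L)=N_G(R)=S$. Strongly-quasi-tame: a family $\mathcal F$ of graphs is strongly-quasi-tame if there is a constant $c$ such that every $G\in\mathcal F$ (with at least one vertex) has at most $|V(G)|^{c\log(|V(G)|)}$ minimal separators. $k$-creature: a tuple $(A,B,\{x_1,\dots,x_k\},\{y_1,\dots,y_k\})$ of mutually disjoint vertex subsets of $V(G)$ (with the $x_i$ distinct and the $y_i$ distinct) such that (i) $G[A]$ and $G[B]$ are connected and $A$ is anti-complete with $B$; (ii) for every $i$, $x_iy_i\in E(G)$, $x_i$ has a neighbor in $A$ and no neighbor in $B$, and $y_i$ has a neighbor in $B$ and no neighbor in $A$; (iii) for $i\ne j$, $x_iy_j\notin E(G)$. (Edges among the $x_i$'s and among the $y_i$'s are unrestricted.) $G$ is $k$-creature-free if it contains no $k$-creature. $k$-skinny-ladder: the graph with vertex set $\{\ell_1,\dots,\ell_k\}\cup\{s_1,\dots,s_k\}\cup\{r_1,\dots,r_k\}$ whose edges are exactly $\ell_i\ell_{i+1}$ and $r_ir_{i+1}$ for $1\le i<k$, and $\ell_is_i$ and $s_ir_i$ for $1\le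 i\le k$. A graph $H$ is an induced minor of $G$ if $H$ can be obtained from $G$ by vertex deletions and edge contractions. -}

module Defs where

open import Level using (0ℓ)
open import Data.Fin.Base using (Fin; toℕ; punchIn; remQuot)
open import Data.Fin.Patterns using (0F; 1F; 2F)
open import Data.Fin.Properties using (_≟_)
open import Data.Fin.Subset using (Subset; _∈_; _∉_; _⊆_; _∩_; ∁; Nonempty; Empty)
open import Data.List.Base using (List; length)
open import Data.List.Relation.Unary.All using (All)
open import Data.List.Relation.Unary.Unique.Propositional using (Unique)
open import Data.Nat.Base using (ℕ; suc; _*_; _^_; _≤_; NonZero)
open import Data.Nat.Logarithm using (⌊log₂_⌋)
import Data.Nat.Properties as ℕ
open import Data.Product.Base using (∃; ∃₂; _×_; _,_)
open import Data.Sum.Base using (_⊎_; inj₁; inj₂)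
open import Function.Base using (_on_)
open import Function.Bundles using (_↔_; _⇔_; module Inverse)
open import Function.Definitions using (Injective)
open import Relation.Binary.Construct.Closure.ReflexiveTransitive using (Star)
open import Relation.Binary.Construct.Closure.Symmetric using (SymClosure; fwd; bwd; symmetric)
open import Relation.Binary.Core using (Rel)
open import Relation.Binary.Definitions using (Symmetric; Irreflexive; Decidable)
open import Relation.Binary.PropositionalEquality using (_≡_; _≢_; refl; sym)
open import Relation.Nullary.Decidable using (_×-dec_; _⊎-dec_; ¬?; map′; no)
open import Relation.Nullary.Negation using (¬_)
open import Relation.Unary using (Pred; _≐_)

record Graph (n : ℕ) : Set₁ where
  field
    _~_      : Rel (Fin n) 0ℓ
    ~-sym    : Symmetric _~_
    ~-irrefl : Irreflexive _≡_ _~_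
    _~?_     : Decidable _~_

private
  variable
    k m n : ℕ

module _ (G : Graph n) where
  open Graph G

  OpenNeighborhood : Subset n → Pred (Fin n) 0ℓ
  OpenNeighborhood X v = v ∉ X × ∃ λ u → u ∈ X × u ~ v

  HasNeighborIn : Fin n → Subset n → Set
  HasNeighborIn v X = ∃ λ u → u ∈ X × v ~ u

  Anticomplete : Subset n → Subset n → Set
  Anticomplete X Y = ∀ {u v} → u ∈ X → v ∈ Y → ¬ (u ~ v)

  EdgeWithin : Subset n → Rel (Fin n) 0ℓ
  EdgeWithin X u v = u ∈ X × v ∈ X × u ~ v

  -- G[X] is connected; the null graph is not.
  Connected : Subset n → Set
  Connected X = Nonempty X × (∀ {u v} → u ∈ X → v ∈ X → Star (EdgeWithin X) u v)

  -- C is the vertex set of a connected component of G[X].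
  IsComponent : Subset n → Subset n → Set
  IsComponent X C =
    Connected C × C ⊆ X × (∀ D → Connected D → D ⊆ X → C ⊆ D → D ⊆ C)

  IsMinimalSeparator : Subset n → Set
  IsMinimalSeparator S = Nonempty S × ∃₂ λ L R →
    L ≢ R
    × IsComponent (∁ S) L × IsComponent (∁ S) R
    × OpenNeighborhood L ≐ (_∈ S) × OpenNeighborhood R ≐ (_∈ S)

  record Creature (k : ℕ) : Set where
    field
      A B : Subset n
      x y : Fin k → Fin n
      x-injective : Injective _≡_ _≡_ x
      y-injective : Injective _≡_ _≡_ y
      A∩B-empty   : Empty (A ∩ B)
      x∉A         : ∀ i → x i ∉ A
      x∉B         : ∀ i → x i ∉ B
      y∉A         : ∀ i → y i ∉ A
      y∉B         : ∀ i → y i ∉ B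
      x≢y         : ∀ i j → x i ≢ y j
      A-connected : Connected A
      B-connected : Connected B
      A-B-anti    : Anticomplete A B
      x~y         : ∀ i → x i ~ y i
      x-A         : ∀ i → HasNeighborIn (x i) A
      x-B         : ∀ i → ¬ HasNeighborIn (x i) B
      y-B         : ∀ i → HasNeighborIn (y i) B
      y-A         : ∀ i → ¬ HasNeighborIn (y i) A
      x≁y         : ∀ i j → i ≢ j → ¬ (x i ~ y j)

  CreatureFree : ℕ → Set
  CreatureFree k = ¬ Creature k

record _≅_ (G : Graph m) (H : Graph n) : Set where
  field
    bijection : Fin m ↔ Fin n
  open Inverse bijection using (to)
  field
    preserves : ∀ u v → Graph._~_ G u v ⇔ Graph._~_ H (to u) (to v)

-- `punchIn v` embeds Fin n into Fin (suc n) with image everything except v.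
delete : Graph (suc n) → Fin (suc n) → Graph n
delete G v = record
  { _~_      = _~_ on punchIn v
  ; ~-sym    = ~-sym
  ; ~-irrefl = λ { refl → ~-irrefl refl }
  ; _~?_     = λ a b → punchIn v a ~? punchIn v b
  }
  where open Graph G

-- Contraction of the edge uv: v is removed and u plays the role of the merged
-- vertex, so it additionally becomes adjacent to the neighbors of v.
contract : (G : Graph (suc n)) {u v : Fin (suc n)} → Graph._~_ G u v → Graph n
contract {n} G {u} {v} _ = record
  { _~_      = _~′_
  ; ~-sym    = λ { (a≢b , e) → (λ b≡a → a≢b (sym b≡a)) , flipped e }
  ; ~-irrefl = λ { a≡b (a≢b , _) → a≢b a≡b }
  ; _~?_     = λ a b → ¬? (a ≟ b) ×-dec
      ((ι a ~? ι b) ⊎-dec ((ι a ≟ u) ×-dec (v ~? ι b)) ⊎-dec ((ι b ≟ u) ×-dec (v ~? ι a)))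
  }
  where
  open Graph G

  ι : Fin n → Fin (suc n)
  ι = punchIn v

  Joined : Rel (Fin n) 0ℓ
  Joined a b = ι a ~ ι b ⊎ (ι a ≡ u × v ~ ι b) ⊎ (ι b ≡ u × v ~ ι a)

  _~′_ : Rel (Fin n) 0ℓ
  a ~′ b = a ≢ b × Joined a b

  flipped : Symmetric Joined
  flipped (inj₁ e)        = inj₁ (~-sym e)
  flipped (inj₂ (inj₁ e)) = inj₂ (inj₂ e)
  flipped (inj₂ (inj₂ e)) = inj₂ (inj₁ e)

data InducedMinor (H : Graph m) : Graph n → Set₁ where
  iso         : {G : Graph n} → H ≅ G → InducedMinor H G
  by-delete   : {G : Graph (suc n)} (v : Fin (suc n)) →
                InducedMinor H (delete G v) → InducedMinor H G
  by-contract : {G : Graph (suc n)} {u v : Fin (suc n)} (e : Graph._~_ G u v) →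
                InducedMinor H (contract G e) → InducedMinor H G

-- The three rows ℓ, s, r of the skinny ladder.
pattern ℓ i = 0F , i
pattern s i = 1F , i
pattern r i = 2F , i

data LadderEdge {k : ℕ} : Rel (Fin 3 × Fin k) 0ℓ where
  ℓℓ : ∀ {i j} → toℕ j ≡ suc (toℕ i) → LadderEdge (ℓ i) (ℓ j)
  rr : ∀ {i j} → toℕ j ≡ suc (toℕ i) → LadderEdge (r i) (r j)
  ℓs : ∀ {i} → LadderEdge (ℓ i) (s i)
  sr : ∀ {i} → LadderEdge (s i) (r i)

private
  ladderEdge? : Decidable (LadderEdge {k})
  ladderEdge? (ℓ i) (ℓ j) = map′ ℓℓ (λ { (ℓℓ e) → e }) (toℕ j ℕ.≟ suc (toℕ i))
  ladderEdge? (ℓ i) (s j) = map′ (λ { refl → ℓs }) (λ { ℓs → refl }) (i ≟ j)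
  ladderEdge? (ℓ _) (r _) = no λ ()
  ladderEdge? (s _) (ℓ _) = no λ ()
  ladderEdge? (s _) (s _) = no λ ()
  ladderEdge? (s i) (r j) = map′ (λ { refl → sr }) (λ { sr → refl }) (i ≟ j)
  ladderEdge? (r _) (ℓ _) = no λ ()
  ladderEdge? (r _) (s _) = no λ ()
  ladderEdge? (r i) (r j) = map′ rr (λ { (rr e) → e }) (toℕ j ℕ.≟ suc (toℕ i))

  ladderEdge-irrefl : ∀ {p : Fin 3 × Fin k} → ¬ LadderEdge p p
  ladderEdge-irrefl (ℓℓ e) = ℕ.1+n≢n (sym e)
  ladderEdge-irrefl (rr e) = ℕ.1+n≢n (sym e)

skinnyLadder : ∀ k → Graph (3 * k)
skinnyLadder k = record
  { _~_      = SymClosure LadderEdge on remQuot {3} k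
  ; ~-sym    = symmetric LadderEdge
  ; ~-irrefl = λ { refl (fwd e) → ladderEdge-irrefl e ; refl (bwd e) → ladderEdge-irrefl e }
  ; _~?_     = λ a b → map′ (λ { (inj₁ e) → fwd e ; (inj₂ e) → bwd e })
                            (λ { (fwd e) → inj₁ e ; (bwd e) → inj₂ e })
                            (ladderEdge? (remQuot {3} k a) (remQuot {3} k b)
                              ⊎-dec ladderEdge? (remQuot {3} k b) (remQuot {3} k a))
  }

Family : Set₂
Family = ∀ {n} → Graph n → Set₁

AtMostMinimalSeparators : Graph n → ℕ → Set
AtMostMinimalSeparators {n} G N =
  ∀ (Ss : List (Subset n)) → Unique Ss → All (IsMinimalSeparator G) Ss → length Ss ≤ N

-- For n ≥ 2 we have ⌊log₂ n⌋ ≤ log₂ n ≤ 2 ⌊log₂ n⌋, and both vanish at n = 1, so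
-- neither rounding the logarithm, nor its base, nor requiring c to be a natural
-- number affects whether such a constant exists.
StronglyQuasiTame : Family → Set₁
StronglyQuasiTame 𝓕 = ∃ λ c → ∀ n .{{_ : NonZero n}} (G : Graph n) → 𝓕 G →
  AtMostMinimalSeparators G (n ^ (c * ⌊log₂ n ⌋))

CreatureAndLadderFree : ℕ → Family
CreatureAndLadderFree k G = CreatureFree G k × ¬ InducedMinor (skinnyLadder k) G

{-# OPTIONS --safe #-}

-- Part one: a minimal separator S with full components L and R is dominated by boundedly
-- many vertices of L ∪ R ∪ S, and so is every subset of S within its union with L and R.
-- Call a part of S big if it is not dominated by few vertices. If S is big then, in the
-- absence of a creature, an induced path P in L and an induced path Q in R both hit a
-- common big part of S. Two nonadjacent vertices that alternate often along a path yield
-- a creature, so a big set cannot hit many consecutive intervals of P; splitting P at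
-- thresholds of the first hit therefore produces big sets each confined to its own
-- interval. Doing the same along Q and choosing independent representatives whose
-- intervals appear in monotone order on both paths gives a skinny ladder.
--
-- Part two: keep a set W of undecided vertices that contains the part of S not yet
-- accounted for. A vertex v close to a constant fraction of W is either in S, which needs
-- no guess since v is simply removed, or lies outside of S; then S ∩ N(v) is accounted for
-- and W shrinks by that fraction. When no such v is left, guess the few dominators of the
-- rest of S: their neighborhoods cover less than half of W. So O(log n) guesses exhaust W
-- and leave X ⊆ L, Y ⊆ R and O, outside of L ∪ R ∪ S, whose neighborhoods cover the rest
-- of S. Finally S ∖ N(X) is what a set of O(|X|) vertices of L sees through the vertices
-- not adjacent to X ∪ Y ∪ O, since k irredundant viewpoints around one x ∈ X would form a
-- creature; together with the symmetric statement for Y this determines S.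
--
-- The final claim is an inequality of natural numbers and hence stable, so all of this can
-- be argued under double negation.

module Submission where

open import Defs hiding (ℓ; s; r)
open import Data.Bool.Base using (true)
open import Data.Fin.Base as Fin
  using (Fin; zero; suc; toℕ; fromℕ<; inject≤; opposite; punchIn; punchOut; remQuot; combine)
open import Data.Fin.Patterns using (0F; 1F; 2F)
open import Data.Fin.Properties as Fin
  using (_≟_; combine-remQuot; inject≤-injective; opposite-involutive; opposite-prop;
         punchIn-injective; punchIn-punchOut; punchInᵢ≢i; toℕ-fromℕ<; toℕ<n)
open import Data.Fin.Subset using (Subset; _∈_; _∉_; _-_; ∣_∣; ⁅_⁆)
open import Data.Fin.Subset.Properties
  using (_∈?_; p─q⊆p; p─q─q≡p─q; x∈p⇒∣p-x∣<∣p∣; x∈p∧x≢y⇒x∈p-y; x∈p∩q⁻; x∈∁p⇒x∉p; x∈⁅x⁆; x∈⁅y⁆⇒x≡y; ⊆-antisym)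
open import Data.List.Base
  using (List; []; _∷_; _++_; allFin; filter; length; lookup; map; replicate; tabulate)
import Data.List.Membership.DecPropositional as DecList
import Data.List.Membership.Propositional as List
open import Data.List.Membership.Propositional.Properties using (∈-allFin; ∈-filter⁺; ∈-lookup)
open import Data.List.Properties using (length-++; length-map; length-replicate; length-tabulate)
open import Data.List.Relation.Binary.Permutation.Propositional
  using (_↭_; prep; swap; ↭-refl; ↭-trans; ↭⇒↭ₛ)
open import Data.List.Relation.Binary.Permutation.Propositional.Properties using (All-resp-↭; ↭-length)
import Data.List.Relation.Binary.Permutation.Setoid.Properties as Perm
open import Data.List.Relation.Unary.All as All using (All; []; _∷_)
import Data.List.Relation.Unary.All.Properties as All
open import Data.List.Relation.Unary.AllPairs as AllPairs using (AllPairs; []; _∷_)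
import Data.List.Relation.Unary.AllPairs.Properties as AllPairs
open import Data.List.Relation.Unary.Any as Any using (Any; here; there)
import Data.List.Relation.Unary.Any.Properties as Any
open import Data.List.Relation.Unary.Unique.Propositional using (Unique)
open import Data.Nat.Base
  using (ℕ; zero; suc; pred; _+_; _*_; _∸_; _^_; _⊔_; _≤_; _<_; _≤′_; z≤n; s≤s; ≤′-refl; ≤′-step; NonZero; >-nonZero)
open import Data.Nat.Induction using (<-wellFounded)
open import Data.Nat.Logarithm using (⌊log₂_⌋; ⌊log₂⌋-mono-≤; ⌊log₂[2^n]⌋≡n)
open import Data.Nat.Properties as ℕ
  using (_≤?_; _<?_; ≤-refl; ≤-reflexive; ≤-total; ≤-trans; <-≤-trans; ≤-<-trans; anyUpTo?)
open import Data.Product.Base using (∃; ∃₂; _×_; _,_; proj₁; proj₂; uncurry)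
open import Data.Sum.Base as Sum using (_⊎_; inj₁; inj₂)
open import Data.Unit.Base using (⊤; tt)
open import Data.Vec.Base as Vec using (Vec; []; _∷_)
open import Data.Vec.Properties using (lookup∘tabulate; lookup⇒[]=; []=⇒lookup)
import Data.Vec.Relation.Unary.All as VecAll
import Data.Vec.Relation.Unary.Any as VecAny
open import Function.Base using (_∘_; id; case_of_; _on_)
open import Function.Bundles using (mk↔ₛ′; mk⇔)
open import Induction.WellFounded using (Acc; acc)
open import Level using (Level; 0ℓ)
open import Relation.Binary.Construct.Closure.ReflexiveTransitive using (Star; ε; _◅_; _◅◅_; reverse)
open import Relation.Binary.Construct.Closure.Symmetric using (SymClosure; fwd; bwd)
open import Relation.Binary.Core using (Rel)
open import Relation.Binary.Definitions using (Symmetric; tri<; tri≈; tri>)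
open import Relation.Binary.PropositionalEquality
  using (_≡_; _≢_; refl; sym; trans; cong; cong₂; subst; setoid; resp₂)
open import Relation.Nullary using (¬_; Dec; yes; no)
open import Relation.Nullary.Decidable using (decidable-stable; does; ¬?; ¬¬-excluded-middle; _⊎-dec_)
open import Relation.Nullary.Negation using (contradiction)
open import Relation.Unary using (Decidable)

private
  variable
    k m n : ℕ
    ℓ₁ ℓ₂ : Level

-- Double negation and creatures from stars

infixl 1 _>>=_

pure : {A : Set ℓ₁} → A → ¬ ¬ A
pure x ¬x = ¬x x

_>>=_ : {A : Set ℓ₁} {B : Set ℓ₂} → ¬ ¬ A → (A → ¬ B) → ¬ B
(m >>= f) y = m λ x → f x y

em : {A : Set ℓ₁} → ¬ ¬ Dec A
em = ¬¬-excluded-middle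

-- Double-negation shift, available because `Fin n` is finite: the instances are obtained one after
-- another.
¬¬-∀ : {P : Fin n → Set ℓ₁} → (∀ i → ¬ ¬ P i) → ¬ ¬ (∀ i → P i)
¬¬-∀ {n = zero}  f = pure λ ()
¬¬-∀ {n = suc n} f = do
  p  ← f zero
  ps ← ¬¬-∀ (f ∘ suc)
  pure λ { zero → p ; (suc i) → ps i }

-- A `Subset` is a vector of booleans, so a predicate becomes one only after all its instances are
-- decided, which double negation permits.
comprehension : (P : Fin n → Set) →
                ¬ ¬ (∃ λ (X : Subset n) → (∀ v → v ∈ X → P v) × (∀ v → P v → v ∈ X))
comprehension {n = n} P = do
  P? ← ¬¬-∀ (λ v → em {A = P v})
  pure (build P?)
  where
  module _ (P? : ∀ v → Dec (P v)) where
    X : Subset n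
    X = Vec.tabulate (does ∘ P?)
    sound : ∀ v → v ∈ X → P v
    sound v v∈X with P? v | trans (sym (lookup∘tabulate (does ∘ P?) v)) ([]=⇒lookup v∈X)
    ... | yes p | _ = p
    complete : ∀ v → P v → v ∈ X
    complete v p = lookup⇒[]= v X (trans (lookup∘tabulate (does ∘ P?) v) lemma)
      where
      lemma : does (P? v) ≡ true
      lemma with P? v
      ... | yes _ = refl
      ... | no ¬p = contradiction p ¬p
    build : ∃ λ (X : Subset n) → (∀ v → v ∈ X → P v) × (∀ v → P v → v ∈ X)
    build = X , sound , complete

module _ (G : Graph n) where
  open Graph G

  EdgeIn : (Fin n → Set) → Fin n → Fin n → Set
  EdgeIn P u v = P u × P v × u ~ v

  -- Connectedness for predicates, by walks from one root; walks between other vertices pass through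
  -- it.
  Rooted : (Fin n → Set) → Fin n → Set
  Rooted P r = P r × (∀ v → P v → Star (EdgeIn P) r v)

module _ {G : Graph n} where
  open Graph G

  EdgeIn-sym : ∀ {P u v} → EdgeIn G P u v → EdgeIn G P v u
  EdgeIn-sym (p , q , e) = q , p , ~-sym e

  Star-mono : ∀ {P Q : Fin n → Set} → (∀ v → P v → Q v) →
              ∀ {u v} → Star (EdgeIn G P) u v → Star (EdgeIn G Q) u v
  Star-mono P⊆Q ε = ε
  Star-mono P⊆Q ((p , q , e) ◅ es) = (P⊆Q _ p , P⊆Q _ q , e) ◅ Star-mono P⊆Q es

  Rooted-connects : ∀ {P r} → Rooted G P r → ∀ {u v} → P u → P v → Star (EdgeIn G P) u v
  Rooted-connects (_ , walk) u∈ v∈ = reverse EdgeIn-sym (walk _ u∈) ◅◅ walk _ v∈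

  component-rooted : ∀ {P : Fin n → Set} {r} → Rooted G (Star (EdgeIn G P) r) r
  component-rooted {P} {r} = ε , λ v → go ε
    where
    infixl 5 _▻_
    _▻_ : ∀ {u v} → Star (EdgeIn G P) r u → EdgeIn G P u v → Star (EdgeIn G P) r v
    c ▻ e = c ◅◅ (e ◅ ε)
    go : ∀ {u v} → Star (EdgeIn G P) r u → Star (EdgeIn G P) u v →
         Star (EdgeIn G (Star (EdgeIn G P) r)) u v
    go c ε = ε
    go c (e ◅ es) = (c , c ▻ e , proj₂ (proj₂ e)) ◅ go (c ▻ e) es

  exit : ∀ {P A : Fin n → Set} {u v} → Star (EdgeIn G P) u v → A u → ¬ A v →
         ¬ ¬ (∃₂ λ w w′ → A w × ¬ A w′ × P w′ × w ~ w′)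
  exit ε u∈A v∉A = contradiction u∈A v∉A
  exit {A = A} (_◅_ {j = w} (_ , w∈P , e) es) u∈A v∉A = em {A = A w} >>= λ where
    (yes w∈A) → exit es w∈A v∉A
    (no w∉A)  → pure (_ , _ , u∈A , w∉A , w∈P , e)

  -- A is the component of the root in D minus the neighborhoods of all the q i; inside
  -- C i it is left through a neighbor of q i, which can be a neighbor of no other q j.
  star-creature : {C : Fin k → Fin n → Set} {D : Fin n → Set} {x : Fin n} {q : Fin k → Fin n}
                  {B : Subset n} →
    Connected G B → D x → (∀ i → Rooted G (C i) x) → (∀ i v → C i v → D v) →
    (∀ v → D v → v ∉ B) → (∀ u v → D u → v ∈ B → ¬ u ~ v) →
    (∀ i → q i ∉ B) → (∀ i → HasNeighborIn G (q i) B) → (∀ i → ¬ D (q i)) →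
    (∀ i → ∃ λ v → C i v × v ~ q i) → (∀ i j → i ≢ j → ∀ v → C j v → ¬ v ~ q i) →
    (∀ i → ¬ x ~ q i) → ¬ ¬ Creature G k
  star-creature {k = k} {C = C} {D} {x} {q} {B} B-conn x∈D C-rooted C⊆D D∉B D≁B q∉B q-B q∉D C~q C≁q x≁q = do
    A , A⇒ , ⇒A ← comprehension A′
    xs ← ¬¬-∀ (λ i → exit-at i)
    pure (creature A A⇒ ⇒A xs)
    where
    Region : Fin n → Set
    Region v = D v × (∀ j → ¬ v ~ q j)
    A′ : Fin n → Set
    A′ = Star (EdgeIn G Region) x
    A′⊆Region : ∀ {v} → A′ v → Region v
    A′⊆Region = go (x∈D , x≁q)
      where
      go : ∀ {u v} → Region u → Star (EdgeIn G Region) u v → Region v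
      go r ε = r
      go r ((_ , s , _) ◅ es) = go s es

    Exit : Fin k → Fin n → Set
    Exit i w = (∃ λ u → A′ u × w ~ u) × C i w × w ~ q i
    exit-at : ∀ i → ¬ ¬ ∃ (Exit i)
    exit-at i = do
      let v , v∈C , v~q = C~q i
      w , w′ , w∈A , w′∉A , w′∈C , w~w′ ←
        exit {A = A′} (proj₂ (C-rooted i) v v∈C) ε (λ v∈A → proj₂ (A′⊆Region v∈A) i v~q)
      -- If `w′` were not adjacent to `q i`, it would avoid the neighborhoods of all `q j`, since
      -- `C i` meets none of the others, and hence would belong to the component that the walk has
      -- just left.
      yes w′~q ← em {A = w′ ~ q i}
        where no w′≁q → λ _ → w′∉A (w∈A ◅◅ (( A′⊆Region w∈A
                                     , (C⊆D i w′ w′∈C , λ j → away w′∈C w′≁q j) , w~w′) ◅ ε))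
      pure (w′ , (w , w∈A , ~-sym w~w′) , w′∈C , w′~q)
      where
      away : ∀ {w} → C i w → ¬ w ~ q i → ∀ j → ¬ w ~ q j
      away w∈C w≁qi j w~qj with j ≟ i
      ... | yes refl = w≁qi w~qj
      ... | no j≢i   = C≁q j i j≢i _ w∈C w~qj

    module _ (A : Subset n) (A⇒ : ∀ v → v ∈ A → A′ v) (⇒A : ∀ v → A′ v → v ∈ A)
             (xs : ∀ i → ∃ (Exit i)) where
      ≡-of-edge : ∀ i j {v} → C j v → v ~ q i → i ≡ j
      ≡-of-edge i j v∈C v~q with i ≟ j
      ... | yes e = e
      ... | no i≢j = contradiction v~q (C≁q i j i≢j _ v∈C)

      x∉A′ : ∀ i → proj₁ (xs i) ∉ A
      x∉A′ i x∈A = proj₂ (A′⊆Region (A⇒ _ x∈A)) i (proj₂ (proj₂ (proj₂ (xs i))))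

      x-inD : ∀ i → D (proj₁ (xs i))
      x-inD i = C⊆D i _ (proj₁ (proj₂ (proj₂ (xs i))))

      creature : Creature G k
      creature = record
        { A = A ; B = B
        ; x = proj₁ ∘ xs ; y = q
        ; x-injective = λ {i} {j} e → sym (≡-of-edge j i (subst (C i) e (proj₁ (proj₂ (proj₂ (xs i)))))
                                       (proj₂ (proj₂ (proj₂ (xs j)))))
        ; y-injective = λ {i} {j} e → let v , v∈C , v~q = C~q i in
                          sym (≡-of-edge j i v∈C (subst (v ~_) e v~q))
        ; A∩B-empty = λ (v , v∈) → let v∈A , v∈B = x∈p∩q⁻ A B v∈ in
                          D∉B v (proj₁ (A′⊆Region (A⇒ v v∈A))) v∈B
        ; x∉A = x∉A′
        ; x∉B = λ i → D∉B _ (x-inD i)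
        ; y∉A = λ i y∈A → q∉D i (proj₁ (A′⊆Region (A⇒ _ y∈A)))
        ; y∉B = q∉B
        ; x≢y = λ i j e → q∉D j (subst D e (x-inD i))
        ; A-connected = (x , ⇒A x ε) , λ u∈A v∈A →
            Star-mono ⇒A (Rooted-connects component-rooted (A⇒ _ u∈A) (A⇒ _ v∈A))
        ; B-connected = B-conn
        ; A-B-anti = λ u∈A v∈B → D≁B _ _ (proj₁ (A′⊆Region (A⇒ _ u∈A))) v∈B
        ; x~y = λ i → proj₂ (proj₂ (proj₂ (xs i)))
        ; x-A = λ i → let w , w∈A , x~w = proj₁ (proj₂ (xs i)) in w , ⇒A w w∈A , x~w
        ; x-B = λ i (u , u∈B , x~u) → D≁B _ _ (x-inD i) u∈B x~u
        ; y-B = q-B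
        ; y-A = λ i (u , u∈A , y~u) → proj₂ (A′⊆Region (A⇒ u u∈A)) i (~-sym y~u)
        ; x≁y = λ i j i≢j x~y → i≢j (sym (≡-of-edge j i (proj₁ (proj₂ (proj₂ (xs i)))) x~y))
        }

-- Domination and geodesics

-- A discrete intermediate value principle. Layers of a search, first hits and bigness thresholds
-- are all selected with it.
crossing : ∀ {F : ℕ → Set ℓ₁} m → F 0 → ¬ F m → ¬ ¬ (∃ λ i → i < m × F i × ¬ F (suc i))
crossing zero    f0 ¬fm = contradiction f0 ¬fm
crossing {F = F} (suc m) f0 ¬fm = em {A = F m} >>= λ where
  (yes fm)  → pure (m , ≤-refl , fm , ¬fm)
  (no ¬fm′) → crossing {F = F} m f0 ¬fm′ >>= λ (i , i<m , f , ¬f) → pure (i , ℕ.m<n⇒m<1+n i<m , f , ¬f)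

uniform : (Q : ℕ → Fin n → Set) → (∀ {i j v} → i ≤ j → Q i v → Q j v) →
          (∀ v → ∃ λ i → Q i v) → ∃ λ m → ∀ v → Q m v
uniform {zero}  Q mono f = 0 , λ ()
uniform {suc n} Q mono f with f zero | uniform (λ i → Q i ∘ suc) mono (f ∘ suc)
... | i , q | m , qs = i ⊔ m , λ { zero → mono (ℕ.m≤m⊔n i m) q ; (suc v) → mono (ℕ.m≤n⊔m i m) (qs v) }

¬∀⇒∃¬ : {P : Fin n → Set} → ¬ (∀ v → P v) → ¬ ¬ (∃ λ v → ¬ P v)
¬∀⇒∃¬ ¬∀ none = ¬¬-∀ (λ v ¬p → none (v , ¬p)) ¬∀

x∉p-x : ∀ (p : Subset n) {x} → x ∉ p - x
x∉p-x p {x} x∈ = ℕ.<-irrefl refl (≤-trans (x∈p⇒∣p-x∣<∣p∣ x∈)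
  (≤-reflexive (cong ∣_∣ (sym (p─q─q≡p─q p ⁅ x ⁆)))))

-- Vertices are deleted one at a time while `P` survives, so the minimality obtained concerns single
-- deletions; this is what produces private neighbors.
minimal-subset : (P : Subset n → Set) (T : Subset n) → P T →
                 ¬ ¬ (∃ λ T′ → (∀ v → v ∈ T′ → v ∈ T) × P T′ × (∀ z → z ∈ T′ → ¬ P (T′ - z)))
minimal-subset {n} P T = go T (<-wellFounded ∣ T ∣)
  where
  go : ∀ T → Acc _<_ ∣ T ∣ → P T → ¬ ¬ (∃ λ T′ → (∀ v → v ∈ T′ → v ∈ T) × P T′ × (∀ z → z ∈ T′ → ¬ P (T′ - z)))
  go T (acc rs) pT = em {A = ∃ λ z → z ∈ T × P (T - z)} >>= λ where
    (no ¬∃) → pure (T , (λ _ v∈ → v∈) , pT , λ z z∈ p → ¬∃ (z , z∈ , p))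
    (yes (z , z∈T , p)) → go (T - z) (rs (x∈p⇒∣p-x∣<∣p∣ z∈T)) p >>=
      λ (T′ , T′⊆ , rest) → pure (T′ , (λ v v∈ → p─q⊆p T _ (T′⊆ v v∈)) , rest)

module Domination (G : Graph n) (U : Fin n → Set) where
  open Graph G

  Dominated : List (Fin n) → Fin n → Set
  Dominated D s = Any (λ d → d ≡ s ⊎ d ~ s) D

  -- Small sets form an ideal with additive cost, so a big set can be split in two with its budget
  -- divided (`big-split`). Dominators are confined to `U` so that they can later be kept away from
  -- the vertices already known to be in the separator.
  Small Big : ℕ → (Fin n → Set) → Set
  Small c X = ∃ λ D → length D ≤ c × All U D × (∀ s → X s → ¬ ¬ Dominated D s)
  Big c X = ¬ Small c X

  private
    variable
      a b c c′ : ℕ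
      X Y Z : Fin n → Set

  small-mono : c ≤ c′ → (∀ s → Y s → X s) → Small c X → Small c′ Y
  small-mono c≤ Y⊆X (D , l , u , d) = D , ≤-trans l c≤ , u , λ s y → d s (Y⊆X s y)

  small-∪ : (∀ s → X s → ¬ ¬ (Y s ⊎ Z s)) → Small a Y → Small b Z → Small (a + b) X
  small-∪ {X = X} cover (D , l , u , d) (E , l′ , u′ , e) =
    D ++ E , subst (_≤ _) (sym (length-++ D)) (ℕ.+-mono-≤ l l′) , All.++⁺ u u′ ,
    λ s x → cover s x >>= λ where
      (inj₁ y) → d s y >>= λ p → pure (Any.++⁺ˡ p)
      (inj₂ z) → e s z >>= λ p → pure (Any.++⁺ʳ D p)

  small-singleton : ∀ {d} → U d → (∀ s → X s → d ≡ s ⊎ d ~ s) → Small 1 X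
  small-singleton u f = _ ∷ [] , ≤-refl , u ∷ [] , λ s x → pure (here (f s x))

  small-∅ : (∀ s → ¬ X s) → Small c X
  small-∅ empty = [] , z≤n , [] , λ s x → contradiction x (empty s)

  big-mono : c′ ≤ c → (∀ s → X s → Y s) → Big c X → Big c′ Y
  big-mono c≤ X⊆Y big = big ∘ small-mono c≤ X⊆Y

  big-split : (∀ s → X s → ¬ ¬ (Y s ⊎ Z s)) → Big (a + b) X → ¬ ¬ (Big a Y ⊎ Big b Z)
  big-split cover big none = none (inj₁ λ y → none (inj₂ λ z → big (small-∪ cover y z)))

  big-split-em : Big (a + b) X → ¬ ¬ (Big a (λ s → X s × Y s) ⊎ Big b (λ s → X s × ¬ Y s))
  big-split-em {Y = Y} = big-split λ s x → em {A = Y s} >>= λ where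
    (yes y) → pure (inj₁ (x , y))
    (no ¬y) → pure (inj₂ (x , ¬y))

  big-inhabited : Big c X → ¬ ¬ ∃ X
  big-inhabited big none = big (small-∅ λ s x → none (s , x))

  -- Bigness enters the constructions through this choice of a vertex distinct from and nonadjacent
  -- to earlier ones.
  big-avoid : ∀ D → All U D → Big (length D) X → ¬ ¬ (∃ λ s → X s × ¬ Dominated D s)
  big-avoid D u big none = big (D , ≤-refl , u , λ s x nd → none (s , x , nd))

record InducedPath (G : Graph n) (C : Fin n → Set) (m : ℕ) (p : ℕ → Fin n) : Set where
  open Graph G
  field
    inside   : ∀ {i} → i < m → C (p i)
    edge     : ∀ {i} → suc i < m → p i ~ p (suc i)
    chord    : ∀ {i j} → i < m → j < m → p i ~ p j → j ≡ suc i ⊎ i ≡ suc j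
    distinct : ∀ {i j} → i < m → j < m → p i ≡ p j → i ≡ j

module Geodesic (G : Graph n) (A : Fin n → Set) (T : Subset n) where
  open Graph G

  -- Breadth-first search from `A` through `T`: the ball of radius `i`.
  Within : ℕ → Fin n → Set
  Within zero    v = A v
  Within (suc i) v = Within i v ⊎ (v ∈ T × ∃ λ u → Within i u × u ~ v)

  within-mono : ∀ {i j v} → i ≤ j → Within i v → Within j v
  within-mono = go ∘ ℕ.≤⇒≤′
    where
    go : ∀ {i j v} → i ≤′ j → Within i v → Within j v
    go ≤′-refl     w = w
    go (≤′-step l) w = inj₁ (go l w)

  within-walk : ∀ {i u v} → Within i u → Star (EdgeIn G (λ w → A w ⊎ w ∈ T)) u v → ∃ λ j → Within j v
  within-walk {i} w ε = i , w
  within-walk w ((_ , inj₁ a , e) ◅ es) = within-walk {0} a es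
  within-walk {i} w ((_ , inj₂ t , e) ◅ es) = within-walk {suc i} (inj₂ (t , _ , w , e)) es

  -- A shortest path from `A` to `z`, without its vertex in `A`: `p j` is at distance exactly
  -- `j + 1`, so a chord would be a shortcut and the path is induced.
  record Layered (i : ℕ) (z : Fin n) : Set where
    field
      p        : ℕ → Fin n
      end      : p i ≡ z
      in-T     : ∀ {j} → j ≤ i → p j ∈ T
      within   : ∀ {j} → j ≤ i → Within (suc j) (p j)
      ¬within  : ∀ {j} → j ≤ i → ¬ Within j (p j)
      edge     : ∀ {j} → j < i → p j ~ p (suc j)
      start    : ∃ λ u → A u × u ~ p 0

    gap : ∀ {j j′} → j ≤ i → j′ ≤ i → p j ~ p j′ → j′ ≤ suc j
    gap {j} {j′} l l′ e = ℕ.≮⇒≥ λ lt →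
      ¬within l′ (within-mono {suc (suc j)} lt (inj₂ (in-T l′ , _ , within l , e)))

    chord : ∀ {j j′} → j ≤ i → j′ ≤ i → p j ~ p j′ → j′ ≡ suc j ⊎ j ≡ suc j′
    chord {j} {j′} l l′ e with ℕ.<-cmp j j′
    ... | tri< j<j′ _ _ = inj₁ (ℕ.≤-antisym (gap l l′ e) j<j′)
    ... | tri≈ _ refl _ = contradiction e (~-irrefl refl)
    ... | tri> _ _ j′<j = inj₂ (ℕ.≤-antisym (gap l′ l (~-sym e)) j′<j)

    p-≢ : ∀ {j j′} → j < j′ → j′ ≤ i → p j ≢ p j′
    p-≢ {j} j<j′ l e = ¬within l (within-mono j<j′ (subst (Within (suc j)) e (within (≤-trans (ℕ.<⇒≤ j<j′) l))))

    distinct : ∀ {j j′} → j ≤ i → j′ ≤ i → p j ≡ p j′ → j ≡ j′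
    distinct {j} {j′} l l′ e with ℕ.<-cmp j j′
    ... | tri< j<j′ _ _ = contradiction e (p-≢ j<j′ l′)
    ... | tri≈ _ eq _   = eq
    ... | tri> _ _ j′<j = contradiction (sym e) (p-≢ j′<j l)

  layered : ∀ i {z} → Within (suc i) z → ¬ Within i z → Layered i z
  layered zero {z} (inj₁ w) ¬w = contradiction w ¬w
  layered zero {z} (inj₂ (z∈T , u , a , e)) ¬w = record
    { p = λ _ → z ; end = refl ; in-T = λ _ → z∈T
    ; within = λ { z≤n → inj₂ (z∈T , u , a , e) } ; ¬within = λ { z≤n → ¬w }
    ; edge = λ () ; start = u , a , e }
  layered (suc i) (inj₁ w) ¬w = contradiction w ¬w
  layered (suc i) {z} (inj₂ (z∈T , u , w , e)) ¬w = record
    { p = p ; end = at-end ; in-T = in-T ; within = within ; ¬within = ¬within ; edge = edge ; start = start }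
    where
    module L = Layered (layered i w (λ w′ → ¬w (inj₂ (z∈T , u , w′ , e))))
    p : ℕ → Fin n
    p j with j ≤? i
    ... | yes _ = L.p j
    ... | no  _ = z
    cases : ∀ {P : ℕ → Fin n → Set} → (∀ {j} → j ≤ i → P j (L.p j)) → P (suc i) z →
            ∀ {j} → j ≤ suc i → P j (p j)
    cases f last {j} l with j ≤? i
    ... | yes j≤i = f j≤i
    ... | no  j≰i with ℕ.≤-antisym l (ℕ.≰⇒> j≰i)
    ...   | refl = last
    at-end : p (suc i) ≡ z
    at-end with suc i ≤? i
    ... | yes l = contradiction l ℕ.1+n≰n
    ... | no _  = refl
    p≡ : ∀ {j} → j ≤ i → p j ≡ L.p j
    p≡ {j} l with j ≤? i
    ... | yes _  = refl
    ... | no j≰i = contradiction l j≰i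
    in-T : ∀ {j} → j ≤ suc i → p j ∈ T
    in-T = cases {λ _ v → v ∈ T} L.in-T z∈T
    within : ∀ {j} → j ≤ suc i → Within (suc j) (p j)
    within = cases {λ j v → Within (suc j) v} L.within (inj₂ (z∈T , u , w , e))
    ¬within : ∀ {j} → j ≤ suc i → ¬ Within j (p j)
    ¬within = cases {λ j v → ¬ Within j v} L.¬within ¬w
    start : ∃ λ u → A u × u ~ p 0
    start = subst (λ v → ∃ λ u → A u × u ~ v) (sym (p≡ z≤n)) L.start
    edge : ∀ {j} → j < suc i → p j ~ p (suc j)
    edge {j} (s≤s l) rewrite p≡ l with ℕ.m≤n⇒m<n∨m≡n l
    ... | inj₁ j<i  rewrite p≡ j<i = L.edge j<i
    ... | inj₂ refl rewrite at-end | L.end = e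

  -- A vertex `z` of the last layer is an inner vertex of no shortest path from `A`, so deleting it
  -- disconnects nothing.
  layered-rooted : ∀ {a} i {z} → Rooted G A a → (∀ v → v ∈ T → Within (suc i) v) → ¬ Within i z →
                   Rooted G (λ v → A v ⊎ v ∈ T - z) a
  layered-rooted {a} i {z} (a∈A , walk) all ¬w = inj₁ a∈A , reach
    where
    Rest : Fin n → Set
    Rest v = A v ⊎ v ∈ T - z
    up : ∀ j {v} → j ≤ i → Within j v → Rest v × Star (EdgeIn G Rest) a v
    up zero    l v∈A = inj₁ v∈A , Star-mono {G = G} (λ _ → inj₁) (walk _ v∈A)
    up (suc j) l (inj₁ w) = up j (ℕ.<⇒≤ l) w
    up (suc j) {v} l w@(inj₂ (v∈T , u , w′ , e)) =
      let u∈ , s = up j (ℕ.<⇒≤ l) w′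
          v∈ = inj₂ (x∈p∧x≢y⇒x∈p-y v∈T λ v≡z → ¬w (subst (Within i) v≡z (within-mono l w)))
      in v∈ , s ◅◅ ((u∈ , v∈ , e) ◅ ε)
    last : ∀ v → Within (suc i) v → Rest v → Star (EdgeIn G Rest) a v
    last v (inj₁ w) v∈ = proj₂ (up i ≤-refl w)
    last v (inj₂ (_ , u , w , e)) v∈ = let u∈ , s = up i ≤-refl w in s ◅◅ ((u∈ , v∈ , e) ◅ ε)
    reach : ∀ v → Rest v → Star (EdgeIn G Rest) a v
    reach v (inj₁ v∈A)   = Star-mono {G = G} (λ _ → inj₁) (walk v v∈A)
    reach v (inj₂ v∈T-z) = last v (all v (p─q⊆p T _ v∈T-z)) (inj₂ v∈T-z)

-- Induced paths that hit a big set

module _ (G : Graph n) (U : Fin n → Set) {C B : Subset n} {X : Fin n → Set} where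
  open Graph G
  open Domination G U

  PathHitting : ℕ → Set
  PathHitting c = ∃₂ λ m p → InducedPath G (_∈ C) m p × Big c (λ s → X s × ∃ λ i → i < m × p i ~ s)

  -- While geodesics hit too little of X, each of them contributes a vertex z i together with
  -- a vertex s i attached to it privately; k such pairs form a creature.
  path-hitting : Connected G C → Connected G B → (∀ {v} → v ∈ C → v ∉ B) → Anticomplete G C B →
                 (∀ {v} → v ∈ C → U v) →
                 (∀ {s} → X s → s ∉ C × s ∉ B × (∃ λ v → v ∈ C × v ~ s) × HasNeighborIn G s B) →
                 CreatureFree G k → ∀ c → Big (suc (k * c)) X → ¬ ¬ PathHitting c
  path-hitting {k = k} ((a , a∈C) , C-conn) B-conn C∩B C-B C⊆U X-props free c big = do
    -- `A` starts as the single vertex `a` and must see nothing of `Xr`; the extra unit in the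
    -- budget pays for discarding the neighbors of `a`.
    inj₂ big′ ← big-split-em {Y = λ s → a ~ s} big
      where inj₁ b → λ _ → b (small-singleton (C⊆U a∈C) λ s → inj₂ ∘ proj₂)
    loop k (ℕ.+-identityʳ k) initial big′
    where
    -- `A` is the connected core built so far, `T` the vertices of `C` it may still absorb, and `Xr`
    -- the part of `X` still in play. Since `s i` sees neither `A` nor `T`, and `z i` sees nothing
    -- of `Xr`, the pairs stay private while `A` grows into `T` and new pairs are drawn from `T` and
    -- `Xr`.
    record State (j : ℕ) : Set₁ where
      field
        A    : Fin n → Set
        A-rooted : Rooted G A a
        A⊆C  : ∀ {v} → A v → v ∈ C
        T    : Subset n
        T⊆C  : ∀ v → v ∈ T → v ∈ C
        A∩T  : ∀ {v} → A v → v ∉ T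
        A∪T-rooted : Rooted G (λ v → A v ⊎ v ∈ T) a
        Xr   : Fin n → Set
        Xr⊆X : ∀ {s} → Xr s → X s
        A≁Xr : ∀ {v s} → A v → Xr s → ¬ v ~ s
        T~Xr : ∀ s → Xr s → ¬ ¬ (∃ λ v → v ∈ T × v ~ s)
        z s  : Fin j → Fin n
        z∈C  : ∀ i → z i ∈ C
        z~A  : ∀ i → ∃ λ u → A u × u ~ z i
        s∈X  : ∀ i → X (s i)
        s≁A  : ∀ i {v} → A v → ¬ v ~ s i
        s≁T  : ∀ i {v} → v ∈ T → ¬ v ~ s i
        z~s  : ∀ i → z i ~ s i
        z≁s  : ∀ i i′ → i ≢ i′ → ¬ z i ~ s i′
        z≁Xr : ∀ i {t} → Xr t → ¬ z i ~ t

    initial : State 0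
    initial = record
      { A = _≡ a ; A-rooted = refl , (λ { v refl → ε }) ; A⊆C = λ { refl → a∈C }
      ; T = C - a ; T⊆C = λ v → p─q⊆p C _
      ; A∩T = λ { refl a∈ → x∉p-x C a∈ }
      ; A∪T-rooted = inj₁ refl , λ v v∈ → Star-mono {G = G} C⊆ (C-conn a∈C (⊆C v v∈))
      ; Xr = λ s → X s × ¬ a ~ s ; Xr⊆X = proj₁ ; A≁Xr = λ { refl → proj₂ }
      ; T~Xr = λ s (x , a≁s) → let v , v∈C , e = proj₁ (proj₂ (proj₂ (X-props x))) in
                 pure (v , x∈p∧x≢y⇒x∈p-y v∈C (λ v≡a → a≁s (subst (_~ s) v≡a e)) , e)
      ; z = λ () ; s = λ () ; z∈C = λ () ; z~A = λ () ; s∈X = λ () ; s≁A = λ () ; s≁T = λ ()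
      ; z~s = λ () ; z≁s = λ () ; z≁Xr = λ () }
      where
      C⊆ : ∀ v → v ∈ C → v ≡ a ⊎ v ∈ C - a
      C⊆ v v∈C with v ≟ a
      ... | yes v≡a = inj₁ v≡a
      ... | no  v≢a = inj₂ (x∈p∧x≢y⇒x∈p-y v∈C v≢a)
      ⊆C : ∀ v → v ≡ a ⊎ v ∈ C - a → v ∈ C
      ⊆C v (inj₁ refl) = a∈C
      ⊆C v (inj₂ v∈) = p─q⊆p C _ v∈

    finish : ∀ {j} → State j → ¬ ¬ Creature G j
    finish st = star-creature {C = λ i v → A v ⊎ v ≡ z i} {D = _∈ C} {x = a} {q = s} B-conn a∈C rooted
      (λ { i v (inj₁ v∈A) → A⊆C v∈A ; i v (inj₂ refl) → z∈C i })
      (λ v → C∩B) (λ u v → C-B)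
      (λ i → proj₁ (proj₂ (X-props (s∈X i)))) (λ i → proj₂ (proj₂ (proj₂ (X-props (s∈X i)))))
      (λ i → proj₁ (X-props (s∈X i)))
      (λ i → z i , inj₂ refl , z~s i)
      (λ { i j i≢j v (inj₁ v∈A) → s≁A i v∈A ; i j i≢j v (inj₂ refl) → z≁s j i (i≢j ∘ sym) })
      (λ i → s≁A i (proj₁ A-rooted))
      where
      open State st
      rooted : ∀ i → Rooted G (λ v → A v ⊎ v ≡ z i) a
      rooted i = inj₁ (proj₁ A-rooted) , λ where
        v (inj₁ v∈A)  → Star-mono {G = G} (λ _ → inj₁) (proj₂ A-rooted v v∈A)
        v (inj₂ refl) → let u , u∈A , e = z~A i in
          Star-mono {G = G} (λ _ → inj₁) (proj₂ A-rooted u u∈A) ◅◅ ((inj₁ u∈A , inj₂ refl , e) ◅ ε)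

    round : ∀ {j} (st : State j) → ¬ ¬ ∃ (State.Xr st) → ¬ ¬ (∃₂ λ m p → InducedPath G (_∈ C) m p ×
              ∃ λ (st′ : State (suc j)) → ∀ s → State.Xr st s → ¬ (∃ λ i → i < m × p i ~ s) → State.Xr st′ s)
    round {j} st inhabited = do
      T , T⊆ , (T-rooted , T~) , T-min ← minimal-subset Good T₀ (A∪T-rooted , T~Xr)
      reach ← ¬¬-∀ {P = λ v → ∃ λ i → v ∈ T → Geodesic.Within G A T i v} λ v → em {A = v ∈ T} >>= λ where
                (yes v∈T) → let i , w = Geodesic.within-walk G A T {0} (proj₁ A-rooted) (proj₂ T-rooted v (inj₂ v∈T)) in
                            pure (i , λ _ → w)
                (no v∉T)  → pure (0 , λ v∈T → contradiction v∈T v∉T)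
      let m , Wm = uniform (λ i v → v ∈ T → Geodesic.Within G A T i v) (λ l f → Geodesic.within-mono G A T l ∘ f) reach
      -- Pick `z` in the last layer of `T`. Deleting it keeps `A` and the rest of `T` connected, so
      -- the minimality of `T` can only be due to some `s` in `Xr` that has `z` as its sole neighbor
      -- in `T`.
      i , _ , ¬Wi , ¬¬Wi+1 ← crossing {F = λ i → ¬ (∀ v → v ∈ T → Geodesic.Within G A T i v)} m
          (λ T⊆A → inhabited λ (s , xs) → T~ s xs λ (v , v∈T , _) → A∩T (T⊆A v v∈T) (T⊆ v v∈T))
          (λ ¬Wm → ¬Wm Wm)
      Wi+1 ← ¬¬Wi+1
      z , ¬w ← ¬∀⇒∃¬ ¬Wi
      yes z∈T ← em {A = z ∈ T}
        where no z∉T → λ _ → ¬w (λ z∈T → contradiction z∈T z∉T)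
      let rooted = Geodesic.layered-rooted G A T i A-rooted Wi+1 λ w → ¬w λ _ → w
      s , xs , s-private ← private-of T T~ z (T-min z z∈T) rooted
      z~s ← T~ s xs >>= λ (v , v∈T , e) → (case v ≟ z of λ where
               (yes refl) → pure e
               (no v≢z) → λ _ → s-private (v , x∈p∧x≢y⇒x∈p-y v∈T v≢z , e))
      conclude T T⊆ T~ i z z∈T s xs s-private rooted
        (Geodesic.layered G A T i (Wi+1 z z∈T) λ w → ¬w λ _ → w) z~s
      where
      open State st renaming (T to T₀; z to zs; s to ss; z~s to zs~ss)
      Good : Subset n → Set
      Good T = Rooted G (λ v → A v ⊎ v ∈ T) a × (∀ s → Xr s → ¬ ¬ (∃ λ v → v ∈ T × v ~ s))

      private-of : ∀ T → (∀ s → Xr s → ¬ ¬ (∃ λ v → v ∈ T × v ~ s)) → ∀ z → ¬ Good (T - z) →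
                   Rooted G (λ v → A v ⊎ v ∈ T - z) a →
                   ¬ ¬ (∃ λ s → Xr s × ¬ (∃ λ v → v ∈ T - z × v ~ s))
      private-of T T~ z ¬good rooted none = ¬good (rooted , λ s xs ¬hit → none (s , xs , ¬hit))

      module _ (T : Subset n) (T⊆ : ∀ v → v ∈ T → v ∈ T₀)
               (T~ : ∀ s → Xr s → ¬ ¬ (∃ λ v → v ∈ T × v ~ s)) (i : ℕ) (z : Fin n) (z∈T : z ∈ T)
               (s : Fin n) (xs : Xr s) (s-private : ¬ (∃ λ v → v ∈ T - z × v ~ s))
               (rooted : Rooted G (λ v → A v ⊎ v ∈ T - z) a)
               (layers : Geodesic.Layered G A T i z) (z~s : z ~ s) where
        open Geodesic.Layered layers
        module _ (T₁ : Subset n) (T₁⇒ : ∀ v → v ∈ T₁ → v ∈ T × (∀ j → j ≤ i → p j ≢ v))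
                 (⇒T₁ : ∀ v → v ∈ T × (∀ j → j ≤ i → p j ≢ v) → v ∈ T₁) where
          -- The geodesic joins the core except for its end `z`, which is also dropped from `T₁`:
          -- `z` becomes the private link between the core and `s`.
          A₁ : Fin n → Set
          A₁ v = A v ⊎ ∃ λ j → j < i × p j ≡ v

          private-≢ : ∀ {v} → v ∈ T → v ≢ z → ¬ v ~ s
          private-≢ v∈T v≢z e = s-private (_ , x∈p∧x≢y⇒x∈p-y v∈T v≢z , e)

          T₁-≢ : ∀ {v} → v ∈ T₁ → v ≢ z
          T₁-≢ v∈ v≡z = proj₂ (T₁⇒ _ v∈) i ≤-refl (trans end (sym v≡z))

          A₁-s : ∀ {v} → A₁ v → ¬ v ~ s
          A₁-s (inj₁ v∈A) = A≁Xr v∈A xs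
          A₁-s (inj₂ (j , l , refl)) = private-≢ (in-T (ℕ.<⇒≤ l))
            λ e → p-≢ l ≤-refl (trans e (sym end))

          walk-to : ∀ j → j < i → Star (EdgeIn G A₁) a (p j)
          walk-to zero l = let u , u∈A , e = start in
            Star-mono {G = G} (λ _ → inj₁) (proj₂ A-rooted u u∈A) ◅◅ ((inj₁ u∈A , inj₂ (0 , l , refl) , e) ◅ ε)
          walk-to (suc j) l = walk-to j (ℕ.<⇒≤ l) ◅◅
            ((inj₂ (j , ℕ.<⇒≤ l , refl) , inj₂ (suc j , l , refl) , edge (ℕ.<⇒≤ l)) ◅ ε)

          cover : ∀ v → A v ⊎ v ∈ T - z → A₁ v ⊎ v ∈ T₁
          cover v (inj₁ v∈A) = inj₁ (inj₁ v∈A)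
          cover v (inj₂ v∈) with anyUpTo? (λ j → p j ≟ v) i
          ... | yes ∃j = inj₁ (inj₂ ∃j)
          ... | no ¬∃j = inj₂ (⇒T₁ v (p─q⊆p T _ v∈ , λ j l e → case ℕ.m≤n⇒m<n∨m≡n l of λ where
              (inj₁ j<i)  → ¬∃j (j , j<i , e)
              (inj₂ refl) → x∉p-x T (subst (_∈ T - z) (trans (sym e) end) v∈)))

          uncover : ∀ v → A₁ v ⊎ v ∈ T₁ → A v ⊎ v ∈ T - z
          uncover v (inj₁ (inj₁ v∈A)) = inj₁ v∈A
          uncover v (inj₁ (inj₂ (j , l , refl))) =
            inj₂ (x∈p∧x≢y⇒x∈p-y (in-T (ℕ.<⇒≤ l)) λ e → p-≢ l ≤-refl (trans e (sym end)))
          uncover v (inj₂ v∈) = inj₂ (x∈p∧x≢y⇒x∈p-y (proj₁ (T₁⇒ v v∈)) (T₁-≢ v∈))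

          z~A₁ : ∃ λ u → A₁ u × u ~ z
          z~A₁ = subst (λ v → ∃ λ u → A₁ u × u ~ v) end (lemma i ≤-refl)
            where
            lemma : ∀ j → j ≤ i → ∃ λ u → A₁ u × u ~ p j
            lemma zero l = let u , u∈A , e = start in u , inj₁ u∈A , e
            lemma (suc j) l = p j , inj₂ (j , l , refl) , edge l

          next : State (suc j)
          next = record
            { A = A₁
            ; A-rooted = inj₁ (proj₁ A-rooted) , λ where
                v (inj₁ v∈A) → Star-mono {G = G} (λ _ → inj₁) (proj₂ A-rooted v v∈A)
                v (inj₂ (j , l , refl)) → walk-to j l
            ; A⊆C = λ { (inj₁ v∈A) → A⊆C v∈A ; (inj₂ (j , l , refl)) → T⊆C _ (T⊆ _ (in-T (ℕ.<⇒≤ l))) }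
            ; T = T₁
            ; T⊆C = λ v v∈ → T⊆C v (T⊆ v (proj₁ (T₁⇒ v v∈)))
            ; A∩T = λ { (inj₁ v∈A) v∈ → A∩T v∈A (T⊆ _ (proj₁ (T₁⇒ _ v∈)))
                      ; (inj₂ (j , l , e)) v∈ → proj₂ (T₁⇒ _ v∈) j (ℕ.<⇒≤ l) e }
            ; A∪T-rooted = inj₁ (inj₁ (proj₁ A-rooted)) , λ v v∈ →
                Star-mono {G = G} cover (proj₂ rooted v (uncover v v∈))
            ; Xr = λ t → Xr t × (∀ j → j ≤ i → ¬ p j ~ t)
            ; Xr⊆X = Xr⊆X ∘ proj₁
            ; A≁Xr = λ { (inj₁ v∈A) (xt , _) → A≁Xr v∈A xt ; (inj₂ (j , l , refl)) (_ , f) → f j (ℕ.<⇒≤ l) }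
            ; T~Xr = λ t (xt , f) → T~ t xt >>= λ (v , v∈T , e) →
                pure (v , ⇒T₁ v (v∈T , λ { j l refl → f j l e }) , e)
            ; z = λ { zero → z ; (suc i) → zs i }
            ; s = λ { zero → s ; (suc i) → ss i }
            ; z∈C = λ { zero → T⊆C z (T⊆ z z∈T) ; (suc i) → z∈C i }
            ; z~A = λ { zero → z~A₁ ; (suc i) → let u , u∈A , e = z~A i in u , inj₁ u∈A , e }
            ; s∈X = λ { zero → Xr⊆X xs ; (suc i) → s∈X i }
            ; s≁A = λ { zero → A₁-s
                      ; (suc i) (inj₁ v∈A) → s≁A i v∈A
                      ; (suc i) (inj₂ (j , l , refl)) → s≁T i (T⊆ _ (in-T (ℕ.<⇒≤ l))) }
            ; s≁T = λ { zero v∈ → private-≢ (proj₁ (T₁⇒ _ v∈)) (T₁-≢ v∈)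
                      ; (suc i) v∈ → s≁T i (T⊆ _ (proj₁ (T₁⇒ _ v∈))) }
            ; z~s = λ { zero → z~s ; (suc i) → zs~ss i }
            ; z≁s = λ { zero zero 0≢0 → contradiction refl 0≢0
                      ; zero (suc i) _ → s≁T i (T⊆ z z∈T)
                      ; (suc i) zero _ → z≁Xr i xs
                      ; (suc i) (suc i′) ne → z≁s i i′ (ne ∘ cong suc) }
            ; z≁Xr = λ { zero (_ , f) → subst (λ v → ¬ v ~ _) end (f i ≤-refl)
                       ; (suc i) (xt , _) → z≁Xr i xt }
            }

        conclude : ¬ ¬ (∃₂ λ m p → InducedPath G (_∈ C) m p ×
              ∃ λ (st′ : State (suc j)) → ∀ s → Xr s → ¬ (∃ λ i → i < m × p i ~ s) → State.Xr st′ s)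
        conclude = do
          T₁ , T₁⇒ , ⇒T₁ ← comprehension (λ v → v ∈ T × (∀ j → j ≤ i → p j ≢ v))
          pure (suc i , p , record
            { inside = λ { (s≤s l) → T⊆C _ (T⊆ _ (in-T l)) } ; edge = λ { (s≤s l) → edge l }
            ; chord = λ { (s≤s l) (s≤s l′) → chord l l′ } ; distinct = λ { (s≤s l) (s≤s l′) → distinct l l′ } }
            , next T₁ T₁⇒ ⇒T₁ , λ t xt ¬hit → xt , λ j l e → ¬hit (j , s≤s l , e))

    loop : ∀ {j} rem → rem + j ≡ k → (st : State j) → Big (rem * c) (State.Xr st) → ¬ ¬ PathHitting c
    loop zero refl st _ = finish st >>= λ cr → contradiction cr free
    loop {j} (suc rem) eq st bigX = do
      m , p , path , st′ , into ← round st (big-inhabited bigX)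
      -- Either the geodesic of this round hits a `c`-big set, or the set it misses retains the
      -- budget for the remaining rounds and survives into the next state.
      inj₂ big′ ← big-split-em {Y = λ s → ∃ λ i → i < m × p i ~ s} bigX
        where inj₁ hit → pure (m , p , path , big-mono ≤-refl (λ s (x , h) → State.Xr⊆X st x , h) hit)
      loop rem (trans (ℕ.+-suc rem j) eq) st′ (big-mono ≤-refl (λ s (x , h) → into s x h) big′)

-- Vertices interleaving along a path

-- `2 ^ r * c`, in the form consumed by `r` successive halvings of a big set.
doublings : ℕ → ℕ → ℕ
doublings zero    c = c
doublings (suc r) c = doublings r c + doublings r c

module _ (G : Graph n) (U : Fin n → Set) {C : Fin n → Set} {m : ℕ} {p : ℕ → Fin n}
         (path : InducedPath G C m p) where
  open Graph G
  open Domination G U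
  open InducedPath path

  HitIn : ℕ → ℕ → Fin n → Set
  HitIn lo hi s = ∃ λ x → lo ≤ x × x < hi × p x ~ s

  -- The `r` consecutive intervals are listed from the end `hi` of the path downwards.
  HitsMany : (Fin n → Set) → ℕ → ℕ → Set
  HitsMany Y hi zero    = ⊤
  HitsMany Y hi (suc r) = ∃ λ mid → (∀ s → Y s → HitIn mid hi s) × HitsMany Y mid r

  private
    Late : ℕ → ℕ → Fin n → Set
    Late lo t s = ∀ x → lo ≤ x → x < t → ¬ p x ~ s

    -- A threshold `t` for the first hits in the interval: those of `Y` come no later than `t`,
    -- those of `Z` no earlier. Ties at `t` are allowed.
    Before : (Y Z : Fin n → Set) → ℕ → ℕ → Set
    Before Y Z lo hi = ∃ λ t → (∀ s → Y s → HitIn lo (suc t) s) × (∀ s → Z s → Late lo t s × HitIn lo hi s)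

    BeforeMany : (Y Z : Fin n → Set) → ℕ → ℕ → Set
    BeforeMany Y Z hi zero    = ⊤
    BeforeMany Y Z hi (suc r) = ∃₂ λ lo h → h ≤ hi × Before Y Z lo h ×
                                  ∃ λ hi′ → hi′ < lo × hi′ ≤ hi × BeforeMany Y Z hi′ r

    raise : ∀ {Y Z hi hi′} r → hi ≤ hi′ → BeforeMany Y Z hi r → BeforeMany Y Z hi′ r
    raise zero    l _ = tt
    raise (suc r) l (lo , h , h≤ , b , hi″ , lt , le , rest) =
      lo , h , ≤-trans h≤ l , b , hi″ , lt , ≤-trans le l , rest

    truncate : ∀ {Y Z hi} a {b} → BeforeMany Y Z hi (a + b) → BeforeMany Y Z hi a
    truncate zero    _ = tt
    truncate (suc a) (lo , h , h≤ , b , hi″ , lt , le , rest) = lo , h , h≤ , b , hi″ , lt , le , truncate a rest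

    before-⊆ : ∀ {Y Z Y′ Z′ lo hi} → (∀ s → Y′ s → Y s) → (∀ s → Z′ s → Z s) →
               Before Y Z lo hi → Before Y′ Z′ lo hi
    before-⊆ Y⊆ Z⊆ (t , f , g) = t , (λ s y → f s (Y⊆ s y)) , (λ s z → g s (Z⊆ s z))

    -- `t` acts as a median of the first hits: the part late for `t` is big but the part late for
    -- `t + 1` is not, so what hits up to `t` is big too.
    threshold : ∀ {Y lo hi d} → (∀ s → Y s → HitIn lo hi s) → Big (d + d) Y →
                ¬ ¬ (∃ λ t → Big d (λ s → Y s × HitIn lo (suc t) s) × Big d (λ s → Y s × Late lo t s))
    threshold {Y} {lo} {hi} {d} hits big = do
      t , _ , late , ¬late ← crossing {F = λ t → Big d (λ s → Y s × Late lo t s)} hi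
        (big-mono (ℕ.m≤m+n d d) (λ s y → y , λ _ _ ()) big)
        (λ b → b (small-∅ λ s (y , l) → let x , lo≤ , <hi , e = hits s y in l x lo≤ <hi e))
      inj₁ early ← big-split-em {a = d} {b = d} {Y = HitIn lo (suc t)} big
        where inj₂ b → λ _ → ¬late (big-mono ≤-refl (λ s (y , ¬h) → y , λ x l l′ e → ¬h (x , l , l′ , e)) b)
      pure (t , early , late)

    -- The set with the smaller median keeps its early part and the other set its late part.
    compare : ∀ {Y Z lo hi d} → (∀ s → Y s → HitIn lo hi s) → (∀ s → Z s → HitIn lo hi s) →
              Big (d + d) Y → Big (d + d) Z →
              ¬ ¬ (∃₂ λ Y′ Z′ → (∀ s → Y′ s → Y s) × (∀ s → Z′ s → Z s) × Big d Y′ × Big d Z′ ×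
                   (Before Y′ Z′ lo hi ⊎ Before Z′ Y′ lo hi))
    compare {lo = lo} {d = d} Y-hits Z-hits bigY bigZ = do
      t , Y-early , Y-late ← threshold {d = d} Y-hits bigY
      t′ , Z-early , Z-late ← threshold {d = d} Z-hits bigZ
      case ≤-total t t′ of λ where
        (inj₁ t≤t′) → pure (_ , _ , (λ _ → proj₁) , (λ _ → proj₁) , Y-early , Z-late ,
          inj₁ (t , (λ s → proj₂) , λ s (z , l) → (λ x l₁ l₂ → l x l₁ (<-≤-trans l₂ t≤t′)) , Z-hits s z))
        (inj₂ t′≤t) → pure (_ , _ , (λ _ → proj₁) , (λ _ → proj₁) , Y-late , Z-early ,
          inj₂ (t′ , (λ s → proj₂) , λ s (y , l) → (λ x l₁ l₂ → l x l₁ (<-≤-trans l₂ t′≤t)) , Y-hits s y))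

    Separated : (Y Z : Fin n → Set) → ℕ → ℕ → ℕ → Set₁
    Separated Y Z c hi r = ∃₂ λ Y′ Z′ → (∀ s → Y′ s → Y s) × (∀ s → Z′ s → Z s) × Big c Y′ × Big c Z′ ×
                   ∃₂ λ a b → a + b ≡ r × BeforeMany Y′ Z′ hi a × BeforeMany Z′ Y′ hi b

    -- Only every second interval is compared. The skipped interval is nonempty, so positions chosen
    -- in different intervals are never consecutive on the path.
    separate : ∀ {c W Y Z hi} r → HitsMany W hi (r * 2) → (∀ s → Y s → W s) → (∀ s → Z s → W s) →
               Big (doublings r c) Y → Big (doublings r c) Z → ¬ ¬ Separated Y Z c hi r
    separate zero _ _ _ bigY bigZ =
      pure (_ , _ , (λ _ y → y) , (λ _ z → z) , bigY , bigZ , 0 , 0 , refl , tt , tt)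
    separate {hi = hi} (suc r) (mid , hits , low , hits′ , rest) Y⊆W Z⊆W bigY bigZ = do
      s , y ← big-inhabited bigY
      let low<mid = let x , l , l′ , _ = hits′ s (Y⊆W s y) in ≤-<-trans l l′
          mid<hi = let x , l , l′ , _ = hits s (Y⊆W s y) in ≤-<-trans l l′
          low≤hi = ℕ.<⇒≤ (ℕ.<-trans low<mid mid<hi)
      Y₁ , Z₁ , Y₁⊆Y , Z₁⊆Z , bigY₁ , bigZ₁ , order ←
        compare (λ s y → hits s (Y⊆W s y)) (λ s z → hits s (Z⊆W s z)) bigY bigZ
      Y₂ , Z₂ , Y₂⊆ , Z₂⊆ , bigY₂ , bigZ₂ , a , b , a+b , before , after ←
        separate r rest (λ s y → Y⊆W s (Y₁⊆Y s y)) (λ s z → Z⊆W s (Z₁⊆Z s z)) bigY₁ bigZ₁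
      case order of λ where
        (inj₁ Y<Z) → pure (Y₂ , Z₂ , (λ s y → Y₁⊆Y s (Y₂⊆ s y)) , (λ s z → Z₁⊆Z s (Z₂⊆ s z)) , bigY₂ , bigZ₂ ,
          suc a , b , cong suc a+b ,
          (mid , hi , ≤-refl , before-⊆ Y₂⊆ Z₂⊆ Y<Z , low , low<mid , low≤hi , before) ,
          raise b low≤hi after)
        (inj₂ Z<Y) → pure (Y₂ , Z₂ , (λ s y → Y₁⊆Y s (Y₂⊆ s y)) , (λ s z → Z₁⊆Z s (Z₂⊆ s z)) , bigY₂ , bigZ₂ ,
          a , suc b , trans (ℕ.+-suc a b) (cong suc a+b) ,
          raise a low≤hi before ,
          (mid , hi , ≤-refl , before-⊆ Z₂⊆ Y₂⊆ Z<Y , low , low<mid , low≤hi , after))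

    -- For a single `v`, `f i` is its first hit in the `i`-th chosen interval, by which all of `Y`
    -- has been hit.
    record Firsts (Y : Fin n → Set) (v : Fin n) (hi r : ℕ) : Set where
      field
        lo f   : Fin r → ℕ
        f<hi   : ∀ i → f i < hi
        hit    : ∀ i → p (f i) ~ v
        late   : ∀ i → Late (lo i) (f i) v
        early  : ∀ i s → Y s → HitIn (lo i) (suc (f i)) s
        spread : ∀ i j → i ≢ j → (suc (f i) < lo j) ⊎ (suc (f j) < lo i)
        lo≤f   : ∀ i → lo i ≤ f i

    first-hit : ∀ {lo hi v} → HitIn lo hi v → ¬ ¬ (∃ λ f → lo ≤ f × f < hi × p f ~ v × Late lo f v)
    first-hit {lo} {hi} {v} (x , lo≤x , x<hi , e) = do
      f , f<hi , ¬f , ¬¬f+1 ← crossing {F = λ t → ¬ HitIn lo t v} hi (λ { (_ , _ , () , _) })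
        (λ none → none (x , lo≤x , x<hi , e))
      y , lo≤y , y<f+1 , e′ ← ¬¬f+1
      pure (y , lo≤y , ≤-trans y<f+1 f<hi , e′ ,
            λ z lo≤z z<y e″ → ¬f (z , lo≤z , <-≤-trans z<y (ℕ.≤-pred y<f+1) , e″))

    firsts : ∀ {Y Z v hi} r → BeforeMany Y Z hi r → Z v → ¬ ¬ Firsts Y v hi r
    firsts zero _ _ = pure record
      { lo = λ () ; f = λ () ; f<hi = λ () ; hit = λ () ; late = λ () ; early = λ () ; spread = λ () ; lo≤f = λ () }
    firsts {Y} {v = v} {hi} (suc r) (lo₀ , h , h≤hi , (t , Y-early , Z-late) , hi′ , hi′<lo , hi′≤hi , rest) z = do
      rec ← firsts r rest z
      let late-t , hits = Z-late v z
      f₀ , lo≤f , f<h , e , late₀ ← first-hit hits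
      let t≤f = ℕ.≮⇒≥ λ f<t → late-t f₀ lo≤f f<t e
      pure (extended rec f₀ lo≤f f<h e late₀ t≤f)
      where
      module _ (rec : Firsts Y v hi′ r) (f₀ : ℕ) (lo≤f₀ : lo₀ ≤ f₀) (f<h : f₀ < h) (e : p f₀ ~ v)
               (late₀ : Late lo₀ f₀ v) (t≤f : t ≤ f₀) where
        module R = Firsts rec
        below : ∀ i → suc (R.f i) < lo₀
        below i = ≤-<-trans (R.f<hi i) hi′<lo
        extended : Firsts Y v hi (suc r)
        extended = record
          { lo = λ { zero → lo₀ ; (suc i) → R.lo i }
          ; f = λ { zero → f₀ ; (suc i) → R.f i }
          ; f<hi = λ { zero → <-≤-trans f<h h≤hi ; (suc i) → <-≤-trans (R.f<hi i) hi′≤hi }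
          ; hit = λ { zero → e ; (suc i) → R.hit i }
          ; late = λ { zero → late₀ ; (suc i) → R.late i }
          ; early = λ { zero s y → let x , l , l′ , e = Y-early s y in x , l , ≤-trans l′ (s≤s t≤f) , e
                      ; (suc i) → R.early i }
          ; spread = λ { zero zero ne → contradiction refl ne
                       ; zero (suc j) _ → inj₂ (below j)
                       ; (suc i) zero _ → inj₁ (below i)
                       ; (suc i) (suc j) ne → R.spread i j (ne ∘ cong suc) }
          ; lo≤f = λ { zero → lo≤f₀ ; (suc i) → R.lo≤f i }
          }

    -- The root is u; C i is u together with the path from a neighbor of u up to just before
    -- the first neighbor f i of v, and B consists of v alone.
    interleaved-creature : ∀ {X : Fin n → Set} → (∀ {s} → X s → ¬ C s) → (∀ {s} → X s → U s) → (∀ {v} → C v → U v) →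
      ∀ {Y Z hi} → (∀ s → Y s → X s) → (∀ s → Z s → X s) → hi ≤ m →
      Big (suc k) Y → Big (suc k) Z → BeforeMany Y Z hi k → ¬ ¬ Creature G k
    interleaved-creature {k = k} X∉C X⊆U C⊆U {Y} {Z} {hi} Y⊆X Z⊆X hi≤m bigY bigZ many = do
      v , v∈Z ← big-inhabited bigZ
      fs ← firsts k many v∈Z
      let f<m = λ i → <-≤-trans (Firsts.f<hi fs i) hi≤m
          D = v ∷ tabulate (p ∘ Firsts.f fs)
      -- `u` must avoid `v` and its `k` first hits, which is why `suc k` is the bigness required.
      u , u∈Y , u∤D ← big-avoid D (X⊆U (Z⊆X v v∈Z) ∷ All.tabulate⁺ (λ i → C⊆U (inside (f<m i))))
        (big-mono (≤-reflexive (cong suc (length-tabulate (p ∘ Firsts.f fs)))) (λ _ y → y) bigY)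
      build v v∈Z fs f<m u u∈Y (λ e → u∤D (here e))
        (λ i e → u∤D (there (Any.tabulate⁺ i (inj₂ e))))
      where
      module _ (v : Fin n) (v∈Z : Z v) (fs : Firsts Y v hi k) (f<m : ∀ i → Firsts.f fs i < m)
               (u : Fin n) (u∈Y : Y u) (v≁u : ¬ (v ≡ u ⊎ v ~ u)) (f≁u : ∀ i → ¬ p (Firsts.f fs i) ~ u) where
        open Firsts fs
        start : Fin k → ℕ
        start i = proj₁ (early i u u∈Y)
        lo≤start : ∀ i → lo i ≤ start i
        lo≤start i = proj₁ (proj₂ (early i u u∈Y))
        start~u : ∀ i → p (start i) ~ u
        start~u i = proj₂ (proj₂ (proj₂ (early i u u∈Y)))
        start<f : ∀ i → start i < f i
        -- A tie is impossible because `u` was chosen nonadjacent to `p (f i)`.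
        start<f i = ℕ.≤∧≢⇒< (ℕ.≤-pred (proj₁ (proj₂ (proj₂ (early i u u∈Y)))))
          λ eq → f≁u i (subst (λ x → p x ~ u) eq (start~u i))
        Segment Arm : Fin k → Fin n → Set
        Segment i w = ∃ λ y → start i ≤ y × y < f i × p y ≡ w
        Arm i w = w ≡ u ⊎ Segment i w
        in-C : ∀ {i y} → y < f i → C (p y)
        in-C {i} l = inside (ℕ.<-trans l (f<m i))
        walk : ∀ i d → start i + d < f i → Star (EdgeIn G (Arm i)) u (p (start i + d))
        walk i zero l rewrite ℕ.+-identityʳ (start i) =
          (inj₁ refl , inj₂ (_ , ≤-refl , l , refl) , ~-sym (start~u i)) ◅ ε
        walk i (suc d) l rewrite ℕ.+-suc (start i) d =
          walk i d (ℕ.<⇒≤ l) ◅◅ ((inj₂ (_ , ℕ.m≤m+n _ d , ℕ.<⇒≤ l , refl) ,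
                                  inj₂ (_ , ℕ.m≤n⇒m≤1+n (ℕ.m≤m+n _ d) , l , refl) , edge (ℕ.<-trans l (f<m i))) ◅ ε)
        rooted : ∀ i → Rooted G (Arm i) u
        rooted i = inj₁ refl , λ where
          w (inj₁ refl) → ε
          w (inj₂ (y , l , y<f , refl)) → subst (λ z → Star _ u (p z)) (ℕ.m+[n∸m]≡n l)
            (walk i _ (subst (_< f i) (sym (ℕ.m+[n∸m]≡n l)) y<f))
        D : Fin n → Set
        D w = w ≡ u ⊎ ∃ λ i → Segment i w
        v∉C : ¬ C v
        v∉C = X∉C (Z⊆X v v∈Z)
        u∉C : ¬ C u
        u∉C = X∉C (Y⊆X u u∈Y)
        B = ⁅ v ⁆
        B-connected : Connected G B
        B-connected = (v , x∈⁅x⁆ v) , λ a b → subst (λ w → Star _ w _) (sym (x∈⁅y⁆⇒x≡y v a))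
                                     (subst (Star _ v) (sym (x∈⁅y⁆⇒x≡y v b)) ε)
        D∉B : ∀ w → D w → w ∉ B
        D∉B w (inj₁ refl) w∈B = v≁u (inj₁ (sym (x∈⁅y⁆⇒x≡y v w∈B)))
        D∉B w (inj₂ (i , y , l , y<f , refl)) w∈B = v∉C (subst C (x∈⁅y⁆⇒x≡y v w∈B) (in-C y<f))
        D≁B : ∀ w w′ → D w → w′ ∈ B → ¬ w ~ w′
        D≁B w w′ w∈D w′∈B e with x∈⁅y⁆⇒x≡y v w′∈B
        D≁B w w′ (inj₁ refl) w′∈B e | refl = v≁u (inj₂ (~-sym e))
        D≁B w w′ (inj₂ (i , y , l , y<f , refl)) w′∈B e | refl = late i y (≤-trans (lo≤start i) l) y<f e
        q∉D : ∀ i → ¬ D (p (f i))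
        q∉D i (inj₁ eq) = u∉C (subst C eq (inside (f<m i)))
        q∉D i (inj₂ (j , y , l , y<f , eq)) with i ≟ j | distinct (ℕ.<-trans y<f (f<m j)) (f<m i) eq
        ... | yes refl | refl = ℕ.<-irrefl refl y<f
        ... | no i≢j | refl with spread i j i≢j
        ...   | inj₁ lt = ℕ.<-irrefl refl (<-≤-trans (ℕ.<⇒≤ lt) (≤-trans (lo≤start j) l))
        ...   | inj₂ lt = ℕ.<-irrefl refl (<-≤-trans (ℕ.<-trans y<f (ℕ.<⇒≤ lt)) (lo≤f i))
        C~q : ∀ i → ∃ λ w → Arm i w × w ~ p (f i)
        C~q i = aux (f i) refl
          where
          aux : ∀ x → x ≡ f i → ∃ λ w → Arm i w × w ~ p (f i)
          aux zero eq = contradiction (subst (start i <_) (sym eq) (start<f i)) λ ()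
          aux (suc x) eq = p x , inj₂ (x , ℕ.≤-pred (subst (start i <_) (sym eq) (start<f i)) , ≤-reflexive eq , refl) ,
            subst (λ z → p x ~ p z) eq (edge (subst (_< m) (sym eq) (f<m i)))
        C≁q : ∀ i j → i ≢ j → ∀ w → Arm j w → ¬ w ~ p (f i)
        C≁q i j i≢j w (inj₁ refl) e = f≁u i (~-sym e)
        C≁q i j i≢j w (inj₂ (y , l , y<f , refl)) e with spread i j i≢j | chord (ℕ.<-trans y<f (f<m j)) (f<m i) e
        ... | inj₁ lt | inj₁ eq = ℕ.<-irrefl refl
                (<-≤-trans (<-≤-trans lt (≤-trans (lo≤start j) l)) (≤-trans (ℕ.n≤1+n y) (≤-trans (≤-reflexive (sym eq)) (ℕ.n≤1+n _))))
        ... | inj₁ lt | inj₂ eq = ℕ.<-irrefl (sym eq) (<-≤-trans lt (≤-trans (lo≤start j) l))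
        ... | inj₂ lt | inj₁ eq = ℕ.<-irrefl (sym eq) (<-≤-trans (s≤s y<f) (≤-trans (ℕ.<⇒≤ lt) (lo≤f i)))
        ... | inj₂ lt | inj₂ eq = ℕ.<-irrefl eq (<-≤-trans (ℕ.<-trans y<f (ℕ.<⇒≤ lt)) (≤-trans (lo≤f i) (ℕ.n≤1+n _)))
        build : ¬ ¬ Creature G k
        build = star-creature {C = Arm} {D = D} {x = u} {q = p ∘ f} B-connected (inj₁ refl) rooted
          (λ { i w (inj₁ eq) → inj₁ eq ; i w (inj₂ seg) → inj₂ (i , seg) })
          D∉B D≁B
          (λ i q∈B → v∉C (subst C (x∈⁅y⁆⇒x≡y v q∈B) (inside (f<m i))))
          (λ i → v , x∈⁅x⁆ v , hit i) q∉D C~q C≁q (λ i e → f≁u i (~-sym e))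

  hits-many⇒creature : ∀ {X : Fin n → Set} → (∀ {s} → X s → ¬ C s) → (∀ {s} → X s → U s) → (∀ {v} → C v → U v) →
    ∀ {Y hi} → (∀ s → Y s → X s) → hi ≤ m → Big (doublings (k + k) (suc k)) Y →
    HitsMany Y hi ((k + k) * 2) → ¬ ¬ Creature G k
  hits-many⇒creature {k = k} X∉C X⊆U C⊆U {Y} {hi} Y⊆X hi≤m big many = do
    -- Both families start as the same set. Of the `k + k` comparisons, one of the two orders wins
    -- at least `k`.
    Y′ , Z′ , Y′⊆Y , Z′⊆Y , bigY , bigZ , a , b , a+b , before , after ←
      separate (k + k) many (λ _ y → y) (λ _ y → y) big big
    case ≤-total k a of λ where
      (inj₁ k≤a) → interleaved-creature X∉C X⊆U C⊆U (λ s y → Y⊆X s (Y′⊆Y s y)) (λ s y → Y⊆X s (Z′⊆Y s y)) hi≤m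
        bigY bigZ (truncate k (subst (BeforeMany Y′ Z′ hi) (sym (ℕ.m+[n∸m]≡n k≤a)) before))
      (inj₂ a≤k) → interleaved-creature X∉C X⊆U C⊆U (λ s y → Y⊆X s (Z′⊆Y s y)) (λ s y → Y⊆X s (Y′⊆Y s y)) hi≤m
        bigZ bigY (truncate k (subst (BeforeMany Z′ Y′ hi) (sym (ℕ.m+[n∸m]≡n (k≤b a≤k a+b))) after))
    where
    k≤b : ∀ {a b} → a ≤ k → a + b ≡ k + k → k ≤ b
    k≤b {a} {b} a≤k eq = ℕ.+-cancelˡ-≤ k k b (≤-trans (≤-reflexive (sym eq)) (ℕ.+-monoˡ-≤ b a≤k))

-- Ladders along one path

¬¬-All : {A : Set ℓ₁} {P : A → Set ℓ₂} {xs : List A} → All (λ x → ¬ ¬ P x) xs → ¬ ¬ All P xs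
¬¬-All [] = pure []
¬¬-All (p ∷ ps) = p >>= λ p → ¬¬-All ps >>= λ ps → pure (p ∷ ps)

extract : {A : Set ℓ₁} {Q : A → Set ℓ₂} {xs : List A} → Any Q xs → ∃₂ λ x ys → xs ↭ x ∷ ys × Q x
extract (here q) = _ , _ , ↭-refl , q
extract (there {x = x} any) with y , ys , perm , q ← extract any =
  y , x ∷ ys , ↭-trans (prep x perm) (swap x y ↭-refl) , q

AllPairs-↭ : {A : Set ℓ₁} {R : Rel A ℓ₂} → Symmetric R → ∀ {xs ys} → xs ↭ ys → AllPairs R xs → AllPairs R ys
AllPairs-↭ {R = R} R-sym perm = Perm.AllPairs-resp-↭ (setoid _) R-sym (resp₂ R) (↭⇒↭ₛ perm)

-- `suc (groupCount N r)` groups of bigness `groupSize t N r` contain either t-big vertices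
-- hitting r consecutive intervals or a ladder of suc N rungs of bigness t.
groupCount : ℕ → ℕ → ℕ
groupCount N zero    = 0
groupCount N (suc r) = groupCount N r + N * suc (groupCount N r)

groupSize : ℕ → ℕ → ℕ → ℕ
groupSize t N zero    = t
groupSize t N (suc r) = suc (groupCount N (suc r)) * suc (groupSize t N r + t)

-- Labels and their relation `R` are merely transported. They are trivial along the first path;
-- along the second they remember pairwise disjoint segments of the first.
module Ladders (G : Graph n) (U : Fin n → Set) {C : Fin n → Set} {m : ℕ} {p : ℕ → Fin n}
         (path : InducedPath G C m p) (p∈U : ∀ {x} → x < m → U (p x))
         {I : Set} {R : Rel I 0ℓ} (R-sym : Symmetric R) (𝒳 : I → Fin n → Set) (t N : ℕ) where
  open Graph G
  open Domination G U

  private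
    Hits : ℕ → ℕ → Fin n → Set
    Hits = HitIn G U path

    Many : (Fin n → Set) → ℕ → ℕ → Set
    Many = HitsMany G U path

  Item : Set₁
  Item = I × (Fin n → Set)

  _∼_ : Rel Item _
  _∼_ = R on proj₁

  Fits : ℕ → (Fin n → Set) → ℕ → Item → Set
  Fits c Φ hi (a , Y) = Big c Y × (∀ s → Y s → 𝒳 a s × Φ s × Hits 0 hi s)

  record Rep : Set₁ where
    constructor rep
    field
      label : I
      lo hi : ℕ
      Y     : Fin n → Set
  open Rep

  -- Hits at or beyond `top` are disregarded, because the rails of the ladder use only the path
  -- below `top`.
  Exclusive : ℕ → Rep → Set
  Exclusive top ρ = Big t (Y ρ) × hi ρ ≤ top ×
    (∀ s → Y ρ s → 𝒳 (label ρ) s × Hits (lo ρ) (hi ρ) s × (∀ x → x < top → p x ~ s → lo ρ ≤ x × x < hi ρ))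

  _⊲_ : Rel Rep _
  ρ ⊲ σ = hi ρ ≤ lo σ × R (label ρ) (label σ)

  Ladder : Set₁
  Ladder = ∃₂ λ top reps → top ≤ m × length reps ≡ suc N × All (Exclusive top) reps × AllPairs _⊲_ reps

  Result : (Fin n → Set) → ℕ → ℕ → Set₁
  Result Φ r hi = (∃ λ Y → Big t Y × (∀ s → Y s → Φ s) × Many Y hi r) ⊎ Ladder

  private
    groups size : ℕ → ℕ
    groups = groupCount N
    size = groupSize t N

  fits-mono : ∀ {c c′ Φ hi} → c′ ≤ c → ∀ {x} → Fits c Φ hi x → Fits c′ Φ hi x
  fits-mono l (big , f) = big-mono l (λ _ y → y) big , f

  module _ {Φ : Fin n → Set} where

    record Extracted (c b low : ℕ) (items : List Item) : Set₂ where
      field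
        f       : ℕ
        f<low   : f < low
        label′  : I
        Z       : Fin n → Set
        bigZ    : Big c Z
        Z-props : ∀ s → Z s → 𝒳 label′ s × Φ s × Hits 0 low s × ¬ Hits 0 f s
        rest    : List Item
        size≡   : length items ≡ suc (length rest)
        fits    : All (Fits b Φ f) rest
        labels  : ∀ {Q : I → Set₁} → All (Q ∘ proj₁) items → Q label′ × All (Q ∘ proj₁) rest
        pairs   : AllPairs _∼_ items → All (R label′ ∘ proj₁) rest × AllPairs _∼_ rest

    -- f is the largest threshold beyond which some group is still big.
    extract-item : ∀ {c b low} x items → low ≤ m → All (Fits (suc c + b) Φ low) (x ∷ items) →
                   ¬ ¬ Extracted c b low (x ∷ items)
    extract-item {c} {b} {low} x items low≤m all@((big , _) ∷ _) = do
      f , f<low , late , ¬late ← crossing {F = λ f → Any (λ y → LateBig f y) (x ∷ items)} low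
        (here (big-mono (≤-trans (ℕ.n≤1+n c) (ℕ.m≤m+n (suc c) b)) (λ s y → y , λ { (_ , _ , () , _) }) big))
        (λ any → let fits , late = All.lookupAny all any in
                 late (small-∅ λ s (y , ¬hit) → ¬hit (proj₂ (proj₂ (proj₂ fits s y)))))
      let (a , Y) , rest , perm , bigY = extract late
          all′ = All-resp-↭ perm all
          Y-props = proj₂ (All.head all′)
          rest-fits = All.tail all′
          rest-¬late = All.tail (All-resp-↭ perm (All.¬Any⇒All¬ _ ¬late))
      rest-fits′ ← ¬¬-All (All.zipWith (λ {y} → restrict f (<-≤-trans f<low low≤m) {y}) (rest-fits , rest-¬late))
      pure record
        { f = f ; f<low = f<low ; label′ = a ; Z = λ s → Y s × ¬ Hits 0 f s ; bigZ = bigY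
        ; Z-props = λ s (y , ¬h) → let x , φ , h = Y-props s y in x , φ , h , ¬h
        ; rest = map (early f) rest
        ; size≡ = trans (↭-length perm) (cong suc (sym (length-map (early f) rest)))
        ; fits = All.map⁺ rest-fits′
        ; labels = λ qs → let qs = All-resp-↭ perm qs in All.head qs , All.map⁺ (All.tail qs)
        ; pairs = λ ps → let ps = AllPairs-↭ R-sym perm ps in All.map⁺ (AllPairs.head ps) , AllPairs.map⁺ (AllPairs.tail ps)
        }
      where
      LateBig : ℕ → Item → Set
      LateBig f (a , Y) = Big c (λ s → Y s × ¬ Hits 0 f s)
      early : ℕ → Item → Item
      early f y = proj₁ y , λ s → proj₂ y s × Hits 0 f s
      restrict : ∀ f → f < m → ∀ {y} → Fits (suc c + b) Φ low y × ¬ LateBig (suc f) y →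
                 ¬ ¬ Fits b Φ f (early f y)
      restrict f f<m {a , Y} ((big , props) , ¬late) = do
        small ← ¬late
        -- What is not hit before `f` is hit at `f` or not before `f + 1`: the single vertex `p f`
        -- dominates the former and `c` vertices the latter. So `suc c` pays for it, and the part
        -- hit before `f` is still `b`-big.
        inj₂ big′ ← big-split {a = suc c} {b = b} (λ s y → em {A = Hits 0 f s} >>= λ where
              (yes h) → pure (inj₂ (y , h))
              (no ¬h) → pure (inj₁ (y , ¬h))) big
          where inj₁ b → λ _ → b (small-∪ {Y = λ s → p f ~ s} {a = 1} {b = c}
                  (λ s (y , ¬h) → em {A = Hits 0 (suc f) s} >>= λ where
                     (no ¬h′) → pure (inj₂ (y , ¬h′))
                     (yes (x , l , s≤s x≤f , e)) → case ℕ.m≤n⇒m<n∨m≡n x≤f of λ where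
                        (inj₁ x<f) → contradiction (x , l , x<f , e) ¬h
                        (inj₂ refl) → pure (inj₁ e))
                  (small-singleton (p∈U f<m) (λ s → inj₂)) small)
        pure (big′ , λ s (y , h) → let x , φ , _ = props s y in x , φ , h)

  -- `taken` holds finished rungs from `cur` upwards, `pend` groups that hit both sides of `cur`,
  -- and `rem` groups that are still available below `low`. Missing are `suc ν` rungs for a ladder,
  -- or `suc μ` pending groups for a recursive call.
  record State (Φ : Fin n → Set) (r top ν μ : ℕ) : Set₁ where
    field
      taken       : List Rep
      pend rem  : List Item
      cur low   : ℕ
      low≤cur   : low ≤ cur
      cur≤top   : cur ≤ top
      taken-size  : length taken + suc ν ≡ suc N
      pend-size : length pend + suc μ ≡ suc (groups r)
      rem-size  : suc (μ + ν * suc (groups r)) ≤ length rem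
      taken-excl  : All (Exclusive top) taken
      taken-pairs : AllPairs _⊲_ taken
      taken-above : All (λ ρ → cur ≤ lo ρ) taken
      pend-fits : All (Fits (size r) (λ s → Φ s × Hits cur top s) cur) pend
      pend-pairs : AllPairs _∼_ pend
      rem-fits  : All (Fits (suc (μ + ν * suc (groups r)) * suc (size r + t)) Φ low) rem
      rem-pairs : AllPairs _∼_ rem
      rem-pend  : All (λ x → All (x ∼_) pend) rem
      rem-taken   : All (λ x → All (λ ρ → R (proj₁ x) (label ρ)) taken) rem

  claim : ∀ r {Φ hi} (items : List Item) → hi ≤ m → suc (groups r) ≤ length items →
          All (Fits (size r) Φ hi) items → AllPairs _∼_ items → ¬ ¬ Result Φ r hi
  loop : ∀ r ν μ {Φ top} → top ≤ m → State Φ r top ν μ → ¬ ¬ Result Φ (suc r) top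

  claim zero ((a , Y) ∷ _) _ _ ((big , props) ∷ _) _ =
    pure (inj₁ (Y , big , (λ s y → proj₁ (proj₂ (props s y))) , tt))
  claim (suc r) {Φ} {hi} items hi≤m len fits pairs = loop r N (groups r) hi≤m record
    { taken = [] ; pend = [] ; rem = items ; cur = hi ; low = hi ; low≤cur = ≤-refl ; cur≤top = ≤-refl
    ; taken-size = refl ; pend-size = refl ; rem-size = len
    ; taken-excl = [] ; taken-pairs = [] ; taken-above = [] ; pend-fits = [] ; pend-pairs = []
    ; rem-fits = fits ; rem-pairs = pairs
    ; rem-pend = All.universal (λ _ → []) items ; rem-taken = All.universal (λ _ → []) items }

  loop r ν μ {Φ} {top} top≤m st with State.rem st in eq | State.rem-size st
  ... | x ∷ items | _ = do
    ex ← extract-item {Φ} {c = size r + t} {b = (μ + ν * suc (groups r)) * suc (size r + t)} x items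
           (≤-trans low≤cur (≤-trans cur≤top top≤m)) (subst (All _) eq rem-fits)
    go ex
    where
    open State st
    module _ (ex : Extracted {Φ} (size r + t) ((μ + ν * suc (groups r)) * suc (size r + t)) low (x ∷ items)) where
      open Extracted ex
      remains : suc (μ + ν * suc (groups r)) ≤ suc (length rest)
      remains = ≤-trans rem-size (≤-reflexive (trans (cong length eq) size≡))
      f≤cur : f ≤ cur
      f≤cur = ≤-trans (ℕ.<⇒≤ f<low) low≤cur
      pends : All (R label′ ∘ proj₁) pend × All (λ x → All (x ∼_) pend) rest
      pends = labels {Q = λ a → All (R a ∘ proj₁) pend} (subst (All _) eq rem-pend)
      accs : All (λ ρ → R label′ (label ρ)) taken × All (λ x → All (λ ρ → R (proj₁ x) (label ρ)) taken) rest
      accs = labels {Q = λ a → All (λ ρ → R a (label ρ)) taken} (subst (All _) eq rem-taken)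
      rests : All (R label′ ∘ proj₁) rest × AllPairs _∼_ rest
      rests = pairs (subst (AllPairs _) eq rem-pairs)

      accepted : Rep
      accepted = rep label′ f cur (λ s → Z s × ¬ Hits cur top s)
      f≤hit : ∀ {s y} → Z s → p y ~ s → f ≤ y
      f≤hit z e = ℕ.≮⇒≥ λ y<f → proj₂ (proj₂ (proj₂ (Z-props _ z))) (_ , z≤n , y<f , e)
      accepted-excl : Big t (Y accepted) → Exclusive top accepted
      accepted-excl big = big , cur≤top , λ s (z , ¬hit) →
        let x , φ , (y , _ , y<low , e) , _ = Z-props s z in
        x , (y , f≤hit z e , <-≤-trans y<low low≤cur , e) ,
        λ y y<top e → f≤hit z e , ℕ.≰⇒> λ cur≤y → ¬hit (y , cur≤y , y<top , e)

      -- The pending groups were cut off at thresholds above the new `cur` and have no hits below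
      -- it, so they are dropped. Each rung thus costs up to `groups r` groups besides its own,
      -- whence the recursion of `groupCount`.
      accept : ∀ ν′ → ν ≡ suc ν′ → Big t (Y accepted) → State Φ r top ν′ (groups r)
      accept ν′ refl big = record
        { taken = accepted ∷ taken ; pend = [] ; rem = rest ; cur = f ; low = f
        ; low≤cur = ≤-refl ; cur≤top = ≤-trans f≤cur cur≤top
        ; taken-size = trans (sym (ℕ.+-suc (length taken) (suc ν′))) taken-size
        ; pend-size = refl
        ; rem-size = ≤-trans (ℕ.m≤n+m _ μ) (ℕ.≤-pred remains)
        ; taken-excl = accepted-excl big ∷ taken-excl
        ; taken-pairs = All.zipWith (λ x → x) (taken-above , proj₁ accs) ∷ taken-pairs
        ; taken-above = ≤-refl ∷ All.map (≤-trans f≤cur) taken-above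
        ; pend-fits = [] ; pend-pairs = []
        ; rem-fits = All.map (λ {x} → fits-mono (ℕ.*-monoˡ-≤ (suc (size r + t)) (ℕ.m≤n+m _ μ)) {x}) fits
        ; rem-pairs = proj₂ rests ; rem-pend = All.universal (λ _ → []) rest
        ; rem-taken = All.zipWith (λ (q , qs) → q ∷ qs) (All.map (λ {x} → R-sym {label′} {proj₁ x}) (proj₁ rests) , proj₂ accs) }

      deferred : Item
      deferred = label′ , λ s → Z s × Hits cur top s
      deferred-fits : Big (size r) (proj₂ deferred) → Fits (size r) (λ s → Φ s × Hits cur top s) cur deferred
      deferred-fits big = big , λ s (z , hit) →
        let x , φ , (y , l , y<low , e) , _ = Z-props s z in x , (φ , hit) , (y , l , <-≤-trans y<low low≤cur , e)

      defer : ∀ μ′ → μ ≡ suc μ′ → Big (size r) (proj₂ deferred) → State Φ r top ν μ′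
      defer μ′ refl big = record
        { taken = taken ; pend = deferred ∷ pend ; rem = rest ; cur = cur ; low = f
        ; low≤cur = f≤cur ; cur≤top = cur≤top
        ; taken-size = taken-size
        ; pend-size = trans (sym (ℕ.+-suc (length pend) (suc μ′))) pend-size
        ; rem-size = ℕ.≤-pred remains
        ; taken-excl = taken-excl ; taken-pairs = taken-pairs ; taken-above = taken-above
        ; pend-fits = deferred-fits big ∷ pend-fits
        ; pend-pairs = proj₁ pends ∷ pend-pairs
        ; rem-fits = fits
        ; rem-pairs = proj₂ rests
        ; rem-pend = All.zipWith (λ (q , qs) → R-sym q ∷ qs) (proj₁ rests , proj₂ pends)
        ; rem-taken = proj₂ accs }

      accept-or-stop : ∀ ν′ → ν ≡ ν′ → Big t (Y accepted) → ¬ ¬ Result Φ (suc r) top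
      accept-or-stop zero refl big = pure (inj₂ (top , accepted ∷ taken , top≤m ,
        trans (sym (trans (ℕ.+-suc (length taken) 0) (cong suc (ℕ.+-identityʳ _)))) taken-size ,
        accepted-excl big ∷ taken-excl , All.zipWith (λ x → x) (taken-above , proj₁ accs) ∷ taken-pairs))
      accept-or-stop (suc ν′) refl big = loop r ν′ (groups r) top≤m (accept ν′ refl big)

      -- Once enough groups are pending, the recursive call below `cur` yields a ladder or a big set
      -- hitting `r` intervals there; that set also hits the interval from `cur` to `top`, which is
      -- one more.
      defer-or-recurse : ∀ μ′ → μ ≡ μ′ → Big (size r) (proj₂ deferred) → ¬ ¬ Result Φ (suc r) top
      defer-or-recurse zero refl big =
        claim r (deferred ∷ pend) (≤-trans cur≤top top≤m)
          (≤-reflexive (trans (sym pend-size) (trans (ℕ.+-suc (length pend) 0) (cong suc (ℕ.+-identityʳ _)))))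
          (deferred-fits big ∷ pend-fits) (proj₁ pends ∷ pend-pairs) >>= λ where
          (inj₂ ladder) → pure (inj₂ ladder)
          (inj₁ (Y , bigY , props , many)) →
            pure (inj₁ (Y , bigY , (λ s y → proj₁ (props s y)) , cur , (λ s y → proj₂ (props s y)) , many))
      defer-or-recurse (suc μ′) refl big = loop r ν μ′ top≤m (defer μ′ refl big)

      -- The extracted group has no hits below `f`. If a big part of it also misses everything from
      -- `cur` to `top`, that part is confined between `f` and `cur` and forms a rung; otherwise a
      -- big part hits both sides of `cur` and is deferred.
      go : ¬ ¬ Result Φ (suc r) top
      go = big-split-em {a = size r} {b = t} {Y = Hits cur top} bigZ >>= λ where
        (inj₁ big) → defer-or-recurse μ refl big
        (inj₂ big) → accept-or-stop ν refl big

-- Minor models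

-- Branch sets of a minor; `edge⇐` is what makes the minor induced. Vertices outside all bags are
-- the ones to be deleted.
record Model (H : Graph m) (G : Graph n) : Set₁ where
  private
    module H = Graph H
    module G = Graph G
  field
    Bag       : Fin m → Fin n → Set
    disjoint  : ∀ {a b v} → Bag a v → Bag b v → a ≡ b
    inhabited : ∀ a → ∃ (Bag a)
    connected : ∀ a {u v} → Bag a u → Bag a v → Star (EdgeIn G (Bag a)) u v
    edge⇒     : ∀ {a b} → a H.~ b → ∃₂ λ u v → Bag a u × Bag b v × u G.~ v
    edge⇐     : ∀ {a b u v} → Bag a u → Bag b v → u G.~ v → a ≢ b → a H.~ b

module _ {H : Graph m} where

  delete-model : (G : Graph (suc n)) (M : Model H G) (v : Fin (suc n)) →
                 (∀ a → ¬ Model.Bag M a v) → Model H (delete G v)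
  delete-model G M v uncovered = record
    { Bag = λ a w → Bag a (punchIn v w)
    ; disjoint = disjoint
    ; inhabited = λ a → let u , u∈ = inhabited a in
        punchOut (v≢ u∈) , subst (Bag a) (sym (punchIn-punchOut (v≢ u∈))) u∈
    ; connected = λ a u∈ w∈ → go (connected a u∈ w∈) _ _ refl refl
    ; edge⇒ = λ e → let u , w , u∈ , w∈ , u~w = edge⇒ e in
        punchOut (v≢ u∈) , punchOut (v≢ w∈) , back u∈ u∈ , back w∈ w∈ ,
        adj u∈ w∈ u~w
    ; edge⇐ = edge⇐
    }
    where
    open Model M
    open Graph G
    v≢ : ∀ {a u} → Bag a u → v ≢ u
    v≢ u∈ refl = uncovered _ u∈
    back : ∀ {a b u} (u∈ : Bag a u) → Bag b u → Bag b (punchIn v (punchOut (v≢ u∈)))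
    back u∈ = subst (Bag _) (sym (punchIn-punchOut (v≢ u∈)))
    adj : ∀ {a b u w} (u∈ : Bag a u) (w∈ : Bag b w) → u ~ w →
          punchIn v (punchOut (v≢ u∈)) ~ punchIn v (punchOut (v≢ w∈))
    adj u∈ w∈ e rewrite punchIn-punchOut (v≢ u∈) | punchIn-punchOut (v≢ w∈) = e
    go : ∀ {a u w} → Star (EdgeIn G (Bag a)) u w → ∀ u₀ w₀ → punchIn v u₀ ≡ u → punchIn v w₀ ≡ w →
         Star (EdgeIn (delete G v) (Bag a ∘ punchIn v)) u₀ w₀
    go {a} ε u₀ w₀ eq eq′ = subst (Star _ u₀) (punchIn-injective v u₀ w₀ (trans eq (sym eq′))) ε
    go {a} ((u∈ , x∈ , e) ◅ es) u₀ w₀ refl eq′ =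
      (u∈ , back x∈ x∈ , subst (punchIn v u₀ ~_) (sym (punchIn-punchOut (v≢ x∈))) e)
      ◅ go es _ w₀ (punchIn-punchOut (v≢ x∈)) eq′

  module _ (G : Graph (suc n)) (M : Model H G) {a₀ : Fin m} {u v : Fin (suc n)} where
    open Model M
    open Graph G

    contract-model : (e : u ~ v) → Bag a₀ u → Bag a₀ v → Model H (contract G e)
    contract-model e u∈ v∈ = record
      { Bag = λ a w → Bag a (ι w)
      ; disjoint = disjoint
      ; inhabited = λ a → let w , w∈ = inhabited a in φ w , φ-bag w∈
      ; connected = λ a {x} {y} x∈ y∈ → subst (λ z → Star _ z y) (φι x)
                      (subst (Star _ (φ (ι x))) (φι y) (go (connected a x∈ y∈)))
      ; edge⇒ = λ {a} {b} ab → let x , y , x∈ , y∈ , x~y = edge⇒ ab in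
          φ x , φ y , φ-bag x∈ , φ-bag y∈ , φ-adj x~y λ φx≡φy →
            Graph.~-irrefl H (disjoint (φ-bag x∈) (subst (Bag b ∘ ι) (sym φx≡φy) (φ-bag y∈))) ab
      ; edge⇐ = λ { x∈ y∈ (_ , inj₁ x~y) a≢b → edge⇐ x∈ y∈ x~y a≢b
                  ; x∈ y∈ (_ , inj₂ (inj₁ (x≡u , v~y))) a≢b → edge⇐ (swap-v x≡u x∈) y∈ v~y a≢b
                  ; x∈ y∈ (_ , inj₂ (inj₂ (y≡u , v~x))) a≢b → edge⇐ x∈ (swap-v y≡u y∈) (~-sym v~x) a≢b }
      }
      where
      G′ = contract G e
      ι = punchIn v
      v≢u : v ≢ u
      v≢u refl = ~-irrefl refl e
      -- The retraction onto the contracted graph, which identifies `v` with `u`.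
      φ : Fin (suc _) → Fin _
      φ w with v ≟ w
      ... | yes _  = punchOut v≢u
      ... | no v≢w = punchOut v≢w
      ιφ : ∀ w → (ι (φ w) ≡ w) ⊎ (w ≡ v × ι (φ w) ≡ u)
      ιφ w with v ≟ w
      ... | yes v≡w = inj₂ (sym v≡w , punchIn-punchOut v≢u)
      ... | no v≢w  = inj₁ (punchIn-punchOut v≢w)
      φι : ∀ x → φ (ι x) ≡ x
      φι x with v ≟ ι x
      ... | yes v≡ιx = contradiction (sym v≡ιx) (punchInᵢ≢i v x)
      ... | no v≢ιx  = punchIn-injective v _ _ (punchIn-punchOut v≢ιx)
      φ-bag : ∀ {b w} → Bag b w → Bag b (ι (φ w))
      φ-bag {b} {w} w∈ with ιφ w
      ... | inj₁ eq = subst (Bag b) (sym eq) w∈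
      ... | inj₂ (refl , eq) = subst (Bag b) (sym eq) (subst (λ c → Bag c u) (disjoint v∈ w∈) u∈)
      swap-v : ∀ {b x} → ι x ≡ u → Bag b (ι x) → Bag b v
      swap-v {b} eq x∈ = subst (λ c → Bag c v) (disjoint u∈ (subst (Bag b) eq x∈)) v∈
      φ-adj : ∀ {x y} → x ~ y → φ x ≢ φ y → Graph._~_ G′ (φ x) (φ y)
      φ-adj {x} {y} x~y ne with ιφ x | ιφ y
      ... | inj₁ eq | inj₁ eq′ = ne , inj₁ (subst (_~ ι (φ y)) (sym eq) (subst (x ~_) (sym eq′) x~y))
      ... | inj₁ eq | inj₂ (refl , eq′) = ne , inj₂ (inj₂ (eq′ , subst (v ~_) (sym eq) (~-sym x~y)))
      ... | inj₂ (refl , eq) | inj₁ eq′ = ne , inj₂ (inj₁ (eq , subst (v ~_) (sym eq′) x~y))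
      ... | inj₂ (refl , _) | inj₂ (refl , _) = contradiction refl ne
      go : ∀ {b x y} → Star (EdgeIn G (Bag b)) x y → Star (EdgeIn G′ (Bag b ∘ ι)) (φ x) (φ y)
      go ε = ε
      go (_◅_ {i = x} {j = x′} (x∈ , x′∈ , x~x′) es) with φ x ≟ φ x′
      ... | yes eq = subst (λ z → Star _ z _) (sym eq) (go es)
      ... | no ne  = (φ-bag x∈ , φ-bag x′∈ , φ-adj x~x′ ne) ◅ go es

  singletons-iso : (G : Graph n) (M : Model H G) → (∀ v → ∃ λ a → Model.Bag M a v) →
                   (∀ {a u v} → Model.Bag M a u → Model.Bag M a v → u ≡ v) → H ≅ G
  singletons-iso G M cover single = record
    { bijection = mk↔ₛ′ (proj₁ ∘ inhabited) (proj₁ ∘ cover)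
        (λ v → single (proj₂ (inhabited _)) (proj₂ (cover v)))
        (λ a → disjoint (proj₂ (cover _)) (proj₂ (inhabited a)))
    ; preserves = λ a b → mk⇔
        (λ e → let u , v , u∈ , v∈ , u~v = edge⇒ e in
          subst (_~ _) (single u∈ (proj₂ (inhabited a))) (subst (u ~_) (single v∈ (proj₂ (inhabited b))) u~v))
        (λ e → edge⇐ (proj₂ (inhabited a)) (proj₂ (inhabited b)) e λ { refl → ~-irrefl refl e })
    }
    where
    open Model M
    open Graph G

  -- Induction on the number of vertices: delete a vertex outside the bags, else contract an edge
  -- within a bag. If neither exists, the connected bags are single vertices and the model is an
  -- isomorphism.
  Model⇒InducedMinor : (G : Graph n) → Model H G → ¬ ¬ InducedMinor H G
  Model⇒InducedMinor {n = n} G M = do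
    no ¬uncovered ← em {A = ∃ λ v → ∀ a → ¬ Bag a v}
      where yes (v , uncovered) → delete-case n G M v uncovered
    no ¬edge ← em {A = ∃ λ a → ∃₂ λ u v → Bag a u × Bag a v × u ~ v}
      where yes (a , u , v , u∈ , v∈ , e) → contract-case n G M u∈ v∈ e
    cover ← ¬¬-∀ (λ v → λ ¬∃ → ¬uncovered (v , λ a v∈ → ¬∃ (a , v∈)))
    pure (iso (singletons-iso G M cover λ u∈ v∈ → case connected _ u∈ v∈ of λ where
      ε → refl
      ((u∈ , x∈ , e) ◅ _) → contradiction (_ , _ , _ , u∈ , x∈ , e) ¬edge))
    where
    open Model M
    open Graph G
    delete-case : ∀ n (G : Graph n) (M : Model H G) v → (∀ a → ¬ Model.Bag M a v) → ¬ ¬ InducedMinor H G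
    delete-case (suc n) G M v uncovered =
      Model⇒InducedMinor (delete G v) (delete-model G M v uncovered) >>= λ minor → pure (by-delete v minor)
    contract-case : ∀ n (G : Graph n) (M : Model H G) {a u v} → Model.Bag M a u → Model.Bag M a v →
                    Graph._~_ G u v → ¬ ¬ InducedMinor H G
    contract-case (suc n) G M u∈ v∈ e =
      Model⇒InducedMinor (contract G e) (contract-model G M e u∈ v∈) >>= λ minor → pure (by-contract e minor)

-- Skinny ladders between two paths

-- An upper bound for the two-color Ramsey number, from the Pascal-type recursion.
ramsey : ℕ → ℕ → ℕ
ramsey zero    b       = 0
ramsey (suc a) zero    = 0
ramsey (suc a) (suc b) = suc (ramsey a (suc b) + ramsey (suc a) b)

Clique : {A : Set ℓ₁} → (A → Set ℓ₂) → Rel A ℓ₂ → ℕ → Set _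
Clique Φ R a = ∃ λ ys → length ys ≡ a × All Φ ys × AllPairs R ys

module _ {A : Set ℓ₁} {T R S : Rel A 0ℓ} where

  private
    T∧ : Rel A 0ℓ → Rel A 0ℓ
    T∧ R x y = T x y × R x y

  -- Both sublists keep the order of the list, so the colors may be directed relations and a clique
  -- is a monotone sequence.
  partition : ∀ {Φ : A → Set} x ys → All Φ ys → AllPairs (λ x y → T x y × (R x y ⊎ S x y)) (x ∷ ys) →
    ∃₂ λ ps qs → length ps + length qs ≡ length ys ×
      (All (λ y → Φ y × T∧ R x y) ps × AllPairs (λ x y → T x y × (R x y ⊎ S x y)) ps × (∀ {P : A → Set} → All P ys → All P ps)) ×
      (All (λ y → Φ y × T∧ S x y) qs × AllPairs (λ x y → T x y × (R x y ⊎ S x y)) qs × (∀ {P : A → Set} → All P ys → All P qs))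
  partition x [] [] _ = [] , [] , refl , ([] , [] , id) , ([] , [] , id)
  partition x (y ∷ ys) (φ ∷ φs) (((t , r⊎s) ∷ rel) ∷ (yrel ∷ pairs))
    with ps , qs , len , (ps-all , ps-pairs , ps⊆) , (qs-all , qs-pairs , qs⊆) ← partition x ys φs (rel ∷ pairs) | r⊎s
  ... | inj₁ r = y ∷ ps , qs , cong suc len ,
        ((φ , t , r) ∷ ps-all , ps⊆ yrel ∷ ps-pairs , λ { (p ∷ pys) → p ∷ ps⊆ pys }) ,
        (qs-all , qs-pairs , λ { (p ∷ pys) → qs⊆ pys })
  ... | inj₂ s = ps , y ∷ qs , trans (ℕ.+-suc (length ps) (length qs)) (cong suc len) ,
        (ps-all , ps-pairs , λ { (p ∷ pys) → ps⊆ pys }) ,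
        ((φ , t , s) ∷ qs-all , qs⊆ yrel ∷ qs-pairs , λ { (p ∷ pys) → p ∷ qs⊆ pys })

  ramsey-clique : ∀ {Φ : A → Set} a b xs → All Φ xs → AllPairs (λ x y → T x y × (R x y ⊎ S x y)) xs →
                  ramsey a b ≤ length xs → Clique Φ (T∧ R) a ⊎ Clique Φ (T∧ S) b
  ramsey-clique zero b xs _ _ _ = inj₁ ([] , refl , [] , [])
  ramsey-clique (suc a) zero xs _ _ _ = inj₂ ([] , refl , [] , [])
  ramsey-clique {Φ} (suc a) (suc b) (x ∷ xs) (φ ∷ φs) pairs (s≤s len)
    with ps , qs , eq , (ps-all , ps-pairs , _) , (qs-all , qs-pairs , _) ← partition x xs φs pairs
    = case ramsey a (suc b) ≤? length ps of λ where
        (yes l) → case ramsey-clique a (suc b) ps ps-all ps-pairs l of λ where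
          (inj₁ c) → inj₁ (extend c)
          (inj₂ c) → inj₂ (forget {R} c)
        (no ¬l) → case ramsey-clique (suc a) b qs qs-all qs-pairs
            (ℕ.+-cancelˡ-≤ (ramsey a (suc b)) _ _ (≤-trans len (≤-trans (≤-reflexive (sym eq))
              (ℕ.+-monoˡ-≤ _ (ℕ.<⇒≤ (ℕ.≰⇒> ¬l)))))) of λ where
          (inj₁ c) → inj₁ (forget {S} c)
          (inj₂ c) → inj₂ (extend c)
    where
    extend : ∀ {Q a} → Clique (λ y → Φ y × T∧ Q x y) (T∧ Q) a → Clique Φ (T∧ Q) (suc a)
    extend (ys , l , all , rel) = x ∷ ys , cong suc l , φ ∷ All.map proj₁ all , All.map proj₂ all ∷ rel
    forget : ∀ {Q Q′ a} → Clique (λ y → Φ y × T∧ Q x y) (T∧ Q′) a → Clique Φ (T∧ Q′) a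
    forget (ys , l , all , rel) = ys , l , All.map proj₁ all , rel

AllPairs-lookup : {A : Set ℓ₁} {R : Rel A ℓ₂} → ∀ {xs} → AllPairs R xs → ∀ {i j} → i Fin.< j → R (lookup xs i) (lookup xs j)
AllPairs-lookup (rs ∷ _) {zero} {suc j} _ = All.lookup rs (∈-lookup j)
AllPairs-lookup (_ ∷ ps) {suc i} {suc j} (s≤s l) = AllPairs-lookup ps l

module _ (G : Graph n) where
  open Graph G

  -- One rail of a skinny ladder: bags that contract to an induced path, the `i`-th attached to
  -- `s i` and to no other `s j`.
  record Track (C : Fin n → Set) (s : Fin k → Fin n) : Set₁ where
    field
      Bag       : Fin k → Fin n → Set
      inside    : ∀ {i v} → Bag i v → C v
      disjoint  : ∀ {i j v} → Bag i v → Bag j v → i ≡ j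
      inhabited : ∀ i → ∃ (Bag i)
      connected : ∀ i {u v} → Bag i u → Bag i v → Star (EdgeIn G (Bag i)) u v
      next      : ∀ {i j} → toℕ j ≡ suc (toℕ i) → ∃₂ λ u v → Bag i u × Bag j v × u ~ v
      only-next : ∀ {i j u v} → Bag i u → Bag j v → u ~ v → i ≢ j → toℕ j ≡ suc (toℕ i) ⊎ toℕ i ≡ suc (toℕ j)
      rung      : ∀ i → ∃ λ u → Bag i u × u ~ s i
      only-rung : ∀ {i j u} → Bag i u → u ~ s j → i ≡ j

  opposite-suc : ∀ {i j : Fin k} → toℕ j ≡ suc (toℕ i) → toℕ (opposite i) ≡ suc (toℕ (opposite j))
  opposite-suc {k} {i} {j} eq = trans (opposite-prop i) (trans (∸-peel (subst (_< k) eq (toℕ<n j)))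
    (cong suc (sym (trans (opposite-prop j) (cong (λ x → k ∸ suc x) eq)))))
    where
    ∸-peel : ∀ {a b} → suc b < a → a ∸ suc b ≡ suc (a ∸ suc (suc b))
    ∸-peel {suc a} {zero}  (s≤s (s≤s _)) = refl
    ∸-peel {suc a} {suc b} (s≤s l) = ∸-peel l

  -- Serves the case in which the segments appear along `P` in the reverse of their order along `Q`.
  flip-track : ∀ {C} {s : Fin k → Fin n} → Track C (s ∘ opposite) → Track C s
  flip-track {s = s} tr = record
    { Bag = Bag ∘ opposite ; inside = inside
    ; disjoint = λ {i} {j} u v → opposite-injective (disjoint u v)
    ; inhabited = inhabited ∘ opposite
    ; connected = connected ∘ opposite
    ; next = λ eq → let u , v , u∈ , v∈ , e = next (opposite-suc eq) in v , u , v∈ , u∈ , ~-sym e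
    ; only-next = λ {i} {j} u∈ v∈ e i≢j → case only-next u∈ v∈ e (i≢j ∘ opposite-injective) of λ where
        (inj₁ eq) → inj₂ (trans (sym (cong toℕ (opposite-involutive i)))
                      (trans (opposite-suc eq) (cong (suc ∘ toℕ) (opposite-involutive j))))
        (inj₂ eq) → inj₁ (trans (sym (cong toℕ (opposite-involutive j)))
                      (trans (opposite-suc eq) (cong (suc ∘ toℕ) (opposite-involutive i))))
    ; rung = λ i → subst (λ j → ∃ λ u → Bag (opposite i) u × u ~ s j) (opposite-involutive i) (rung (opposite i))
    ; only-rung = λ {i} {j} u∈ e → opposite-injective
        (only-rung u∈ (subst (λ j → _ ~ s j) (sym (opposite-involutive j)) e))
    }
    where
    open Track tr
    opposite-injective : ∀ {i j : Fin _} → opposite i ≡ opposite j → i ≡ j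
    opposite-injective {i} {j} eq =
      trans (sym (opposite-involutive i)) (trans (cong opposite eq) (opposite-involutive j))

  -- Each bag extends from its own segment up to the start of the next one.
  ascending-track : ∀ {U C m p} (path : InducedPath G C m p) {top} → top ≤ m →
    (l h : Fin k → ℕ) {s : Fin k → Fin n} → (∀ i → h i ≤ top) → (∀ {i j} → i Fin.< j → h i ≤ l j) →
    (∀ i → HitIn G U path (l i) (h i) (s i)) →
    (∀ i x → x < top → p x ~ s i → l i ≤ x × x < h i) → Track C s
  ascending-track {k = k} {C = C} {p = p} path {top} top≤m l h {s} h≤top asc hits only = record
    { Bag = Bag
    ; inside = λ { (x , _ , x<top , _ , refl) → inside (in-m x<top) }
    ; disjoint = λ { {i} {j} (x , lx , x<top , before , refl) (y , ly , y<top , before′ , eq) →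
        disjoint lx before ly before′ (distinct (in-m x<top) (in-m y<top) (sym eq)) }
    ; inhabited = λ i → p (l i) , l-bag i
    ; connected = λ i → Rooted-connects {G = G} (rooted i)
    ; next = next
    ; only-next = λ { {i} {j} (x , lx , x<top , before , refl) (y , ly , y<top , before′ , refl) e i≢j →
        case Fin.<-cmp i j of λ where
          (tri< i<j _ _) → inj₁ (consecutive i<j before ly y<top (chord (in-m x<top) (in-m y<top) e))
          (tri≈ _ i≡j _) → contradiction i≡j i≢j
          (tri> _ _ j<i) → inj₂ (consecutive j<i before′ lx x<top (chord (in-m y<top) (in-m x<top) (~-sym e))) }
    ; rung = λ i → let x , lx , x<h , e = hits i in
        p x , (x , lx , <-≤-trans x<h (h≤top i) , (λ j i<j → <-≤-trans x<h (asc i<j)) , refl) , e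
    ; only-rung = λ { {i} {j} (x , lx , x<top , before , refl) e → case Fin.<-cmp i j of λ where
        (tri< i<j _ _) → contradiction (proj₁ (only j x x<top e)) (ℕ.<⇒≱ (before j i<j))
        (tri≈ _ i≡j _) → i≡j
        (tri> _ _ j<i) → contradiction (≤-trans (asc j<i) lx) (ℕ.<⇒≱ (proj₂ (only j x x<top e))) }
    }
    where
    open InducedPath path
    in-m : ∀ {x} → x < top → x < _
    in-m x<top = <-≤-trans x<top top≤m
    l<h : ∀ i → l i < h i
    l<h i = let x , lx , x<h , _ = hits i in ≤-<-trans lx x<h
    Bag : Fin k → Fin n → Set
    Bag i v = ∃ λ x → l i ≤ x × x < top × (∀ j → i Fin.< j → x < l j) × p x ≡ v
    l-bag : ∀ i → Bag i (p (l i))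
    l-bag i = l i , ≤-refl , <-≤-trans (l<h i) (h≤top i) , (λ j i<j → <-≤-trans (l<h i) (asc i<j)) , refl
    disjoint : ∀ {i j x y} → l i ≤ x → (∀ j → i Fin.< j → x < l j) → l j ≤ y → (∀ i → j Fin.< i → y < l i) →
               x ≡ y → i ≡ j
    disjoint {i} {j} lx before ly before′ refl with Fin.<-cmp i j
    ... | tri< i<j _ _ = contradiction ly (ℕ.<⇒≱ (before j i<j))
    ... | tri≈ _ i≡j _ = i≡j
    ... | tri> _ _ j<i = contradiction lx (ℕ.<⇒≱ (before′ i j<i))
    walk : ∀ i d → l i + d < top → (∀ j → i Fin.< j → l i + d < l j) →
           Star (EdgeIn G (Bag i)) (p (l i)) (p (l i + d))
    walk i zero x<top before rewrite ℕ.+-identityʳ (l i) = ε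
    walk i (suc d) x<top before rewrite ℕ.+-suc (l i) d =
      walk i d (ℕ.<⇒≤ x<top) (λ j i<j → ℕ.<⇒≤ (before j i<j)) ◅◅
      (((_ , ℕ.m≤m+n _ d , ℕ.<⇒≤ x<top , (λ j i<j → ℕ.<⇒≤ (before j i<j)) , refl) ,
        (_ , ℕ.m≤n⇒m≤1+n (ℕ.m≤m+n _ d) , x<top , before , refl) , edge (in-m x<top)) ◅ ε)
    rooted : ∀ i → Rooted G (Bag i) (p (l i))
    rooted i = l-bag i , λ { v (x , lx , x<top , before , refl) →
      subst (λ z → Star _ _ (p z)) (ℕ.m+[n∸m]≡n lx) (walk i _
        (subst (_< top) (sym (ℕ.m+[n∸m]≡n lx)) x<top)
        (λ j i<j → subst (_< l j) (sym (ℕ.m+[n∸m]≡n lx)) (before j i<j))) }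
    next : ∀ {i j} → toℕ j ≡ suc (toℕ i) → ∃₂ λ u v → Bag i u × Bag j v × u ~ v
    next {i} {j} eq = aux (l j) refl
      where
      i<j : i Fin.< j
      i<j = ≤-reflexive (sym eq)
      li<lj : l i < l j
      li<lj = <-≤-trans (l<h i) (asc i<j)
      lj<top : l j < top
      lj<top = <-≤-trans (l<h j) (h≤top j)
      lj≤ : ∀ j′ → i Fin.< j′ → l j ≤ l j′
      lj≤ j′ i<j′ with ℕ.m≤n⇒m<n∨m≡n i<j′
      ... | inj₁ lt = ℕ.<⇒≤ (<-≤-trans (l<h j) (asc (subst (_< toℕ j′) (sym eq) lt)))
      ... | inj₂ e  = ≤-reflexive (cong l (Fin.toℕ-injective (trans eq e)))
      aux : ∀ x → x ≡ l j → ∃₂ λ u v → Bag i u × Bag j v × u ~ v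
      aux zero    e = contradiction (subst (l i <_) (sym e) li<lj) λ ()
      aux (suc g) e = p g , p (l j) ,
        (g , ℕ.≤-pred (subst (l i <_) (sym e) li<lj) , ≤-trans (≤-reflexive e) (ℕ.<⇒≤ lj<top) ,
          (λ j′ i<j′ → ≤-trans (≤-reflexive e) (lj≤ j′ i<j′)) , refl) , l-bag j ,
        subst (λ z → p g ~ p z) e (edge (in-m (subst (_< top) (sym e) lj<top)))
    consecutive : ∀ {i j x y} → i Fin.< j → (∀ j → i Fin.< j → x < l j) → l j ≤ y → y < top →
                  y ≡ suc x ⊎ x ≡ suc y → toℕ j ≡ suc (toℕ i)
    consecutive {i} {j} i<j before ly y<top (inj₂ refl) =
      contradiction (≤-trans ly (ℕ.n≤1+n _)) (ℕ.<⇒≱ (before j i<j))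
    consecutive {i} {j} {x} i<j before ly y<top (inj₁ refl) with ℕ.m≤n⇒m<n∨m≡n i<j
    ... | inj₂ e = sym e
    -- The nonempty segment of a rung `i′` strictly between `i` and `j` would have to fit between
    -- the consecutive positions `x` and `suc x`.
    ... | inj₁ lt = contradiction (ℕ.≤-pred (<-≤-trans (<-≤-trans (l<h i′) (asc i′<j)) ly))
                      (ℕ.<⇒≱ (before i′ (≤-reflexive (sym (toℕ-fromℕ< i′<k)))))
      where
      i′<k : suc (toℕ i) < k
      i′<k = ℕ.<-trans lt (toℕ<n j)
      i′ = fromℕ< i′<k
      i′<j : i′ Fin.< j
      i′<j = subst (_< toℕ j) (sym (toℕ-fromℕ< i′<k)) lt

  module _ {L R : Fin n → Set} {s : Fin k → Fin n} (TL : Track L s) (TR : Track R s)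
           (L∩R : ∀ {v} → L v → ¬ R v) (L≁R : ∀ {u v} → L u → R v → ¬ u ~ v)
           (s∉L : ∀ i → ¬ L (s i)) (s∉R : ∀ i → ¬ R (s i)) (s≁s : ∀ i j → ¬ s i ~ s j)
           (s-injective : ∀ {i j} → s i ≡ s j → i ≡ j) where
    private
      module TL = Track TL
      module TR = Track TR

      BagOf : Fin 3 × Fin k → Fin n → Set
      BagOf (0F , i) = TL.Bag i
      BagOf (1F , i) = _≡ s i
      BagOf (2F , i) = TR.Bag i

      BagOf-disjoint : ∀ {a b v} → BagOf a v → BagOf b v → a ≡ b
      BagOf-disjoint {0F , i} {0F , j} u v = cong (0F ,_) (TL.disjoint u v)
      BagOf-disjoint {0F , i} {1F , j} u refl = contradiction (TL.inside u) (s∉L j)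
      BagOf-disjoint {0F , i} {2F , j} u v = contradiction (TR.inside v) (L∩R (TL.inside u))
      BagOf-disjoint {1F , i} {0F , j} refl v = contradiction (TL.inside v) (s∉L i)
      BagOf-disjoint {1F , i} {1F , j} refl v = cong (1F ,_) (s-injective v)
      BagOf-disjoint {1F , i} {2F , j} refl v = contradiction (TR.inside v) (s∉R i)
      BagOf-disjoint {2F , i} {0F , j} u v = contradiction (TR.inside u) (L∩R (TL.inside v))
      BagOf-disjoint {2F , i} {1F , j} u refl = contradiction (TR.inside u) (s∉R j)
      BagOf-disjoint {2F , i} {2F , j} u v = cong (2F ,_) (TR.disjoint u v)

      BagOf-connected : ∀ a {u v} → BagOf a u → BagOf a v → Star (EdgeIn G (BagOf a)) u v
      BagOf-connected (0F , i) u v = TL.connected i u v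
      BagOf-connected (1F , i) refl refl = ε
      BagOf-connected (2F , i) u v = TR.connected i u v

      edge : ∀ {a b} → LadderEdge a b → ∃₂ λ u v → BagOf a u × BagOf b v × u ~ v
      edge (ℓℓ e) = TL.next e
      edge (rr e) = TR.next e
      edge (ℓs {i}) = let u , u∈ , e = TL.rung i in u , s i , u∈ , refl , e
      edge (sr {i}) = let u , u∈ , e = TR.rung i in s i , u , refl , u∈ , ~-sym e

      ladder-edge : ∀ {a b u v} → BagOf a u → BagOf b v → u ~ v → a ≢ b → SymClosure LadderEdge a b
      ladder-edge {0F , i} {0F , j} u v e ne with TL.only-next u v e (ne ∘ cong (0F ,_))
      ... | inj₁ eq = fwd (ℓℓ eq)
      ... | inj₂ eq = bwd (ℓℓ eq)
      ladder-edge {0F , i} {1F , j} u refl e ne with TL.only-rung u e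
      ... | refl = fwd ℓs
      ladder-edge {0F , i} {2F , j} u v e ne = contradiction e (L≁R (TL.inside u) (TR.inside v))
      ladder-edge {1F , i} {0F , j} refl v e ne with TL.only-rung v (~-sym e)
      ... | refl = bwd ℓs
      ladder-edge {1F , i} {1F , j} refl refl e ne = contradiction e (s≁s i j)
      ladder-edge {1F , i} {2F , j} refl v e ne with TR.only-rung v (~-sym e)
      ... | refl = fwd sr
      ladder-edge {2F , i} {0F , j} u v e ne = contradiction (~-sym e) (L≁R (TL.inside v) (TR.inside u))
      ladder-edge {2F , i} {1F , j} u refl e ne with TR.only-rung u e
      ... | refl = bwd sr
      ladder-edge {2F , i} {2F , j} u v e ne with TR.only-next u v e (ne ∘ cong (2F ,_))
      ... | inj₁ eq = fwd (rr eq)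
      ... | inj₂ eq = bwd (rr eq)

      row = remQuot {3} k
      row-injective : ∀ {a b} → row a ≡ row b → a ≡ b
      row-injective {a} {b} e = trans (sym (combine-remQuot {3} k a)) (trans (cong (uncurry combine) e) (combine-remQuot {3} k b))

      BagOf-inhabited : ∀ a → ∃ (BagOf a)
      BagOf-inhabited (0F , i) = TL.inhabited i
      BagOf-inhabited (1F , i) = s i , refl
      BagOf-inhabited (2F , i) = TR.inhabited i

      edge⇒ : ∀ {a b} → SymClosure LadderEdge a b → ∃₂ λ u v → BagOf a u × BagOf b v × u ~ v
      edge⇒ (fwd e) = edge e
      edge⇒ (bwd e) = let u , v , u∈ , v∈ , u~v = edge e in v , u , v∈ , u∈ , ~-sym u~v

    ladder-model : Model (skinnyLadder k) G
    ladder-model = record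
      { Bag = BagOf ∘ row
      ; disjoint = λ u v → row-injective (BagOf-disjoint u v)
      ; inhabited = BagOf-inhabited ∘ row
      ; connected = BagOf-connected ∘ row
      ; edge⇒ = edge⇒
      ; edge⇐ = λ u v e ne → ladder-edge u v e (ne ∘ row-injective)
      }

-- Minimal separators have few dominators

-- Read from the end of the argument backwards. `rungs` feeds Ramsey's theorem; `sizeQ` leaves room
-- for independent representatives and for a creature along `Q`; `sizeP` lets the rungs found along
-- `P` serve as groups along `Q`; `dominators` pays for two uses of `path-hitting`.
module Constants (k : ℕ) where
  rounds pairSize rungs sizeQ sizeP dominators : ℕ
  rounds   = (k + k) * 2
  pairSize = doublings (k + k) (suc k)
  rungs    = ramsey k k
  sizeQ    = suc rungs + pairSize
  sizeP    = groupSize sizeQ rungs rounds + pairSize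
  dominators = suc (k * suc (k * groupSize sizeP (groupCount rungs rounds) rounds))

opposite-< : ∀ {k} {i j : Fin k} → i Fin.< j → opposite j Fin.< opposite i
opposite-< {k} {i} {j} i<j rewrite opposite-prop i | opposite-prop j = ℕ.∸-monoʳ-< (s≤s i<j) (toℕ<n j)

module _ (G : Graph n) {k : ℕ} (free : CreatureFree G k) (¬ladder : ¬ InducedMinor (skinnyLadder k) G) where
  open Graph G
  open Constants k

  module _ {L R : Subset n} {X : Fin n → Set} (L-conn : Connected G L) (R-conn : Connected G R)
           (L∩R : ∀ {v} → v ∈ L → v ∉ R) (L≁R : Anticomplete G L R)
           (X-props : ∀ {s} → X s → s ∉ L × s ∉ R × HasNeighborIn G s L × HasNeighborIn G s R) where

    U : Fin n → Set
    U v = v ∈ L ⊎ v ∈ R ⊎ X v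

    open Domination G U

    module _ {mP p} (P : InducedPath G (_∈ L) mP p) {mQ q} (Q : InducedPath G (_∈ R) mQ q)
             {Y : Fin n → Set} (Y⊆X : ∀ {s} → Y s → X s)
             (hitP : ∀ {s} → Y s → HitIn G U P 0 mP s) (hitQ : ∀ {s} → Y s → HitIn G U Q 0 mQ s) where

      private
        no-many-P : ∀ {Z hi} → (∀ s → Z s → Y s) → hi ≤ mP → Big pairSize Z → ¬ HitsMany G U P Z hi rounds
        no-many-P Z⊆Y hi≤m big many = hits-many⇒creature G U P {k = k} {X = Y}
          (λ y → proj₁ (X-props (Y⊆X y))) (λ y → inj₂ (inj₂ (Y⊆X y))) inj₁ Z⊆Y hi≤m big many free
        no-many-Q : ∀ {Z hi} → (∀ s → Z s → Y s) → hi ≤ mQ → Big pairSize Z → ¬ HitsMany G U Q Z hi rounds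
        no-many-Q Z⊆Y hi≤m big many = hits-many⇒creature G U Q {k = k} {X = Y}
          (λ y → proj₁ (proj₂ (X-props (Y⊆X y)))) (λ y → inj₂ (inj₂ (Y⊆X y))) (inj₂ ∘ inj₁) Z⊆Y hi≤m big many free

      module LP = Ladders G U P (λ l → inj₁ (InducedPath.inside P l)) {I = ⊤} {R = λ _ _ → ⊤} (λ _ → tt)
                          (λ _ → Y) sizeP (groupCount rungs rounds)

      ladder-P : Big (groupSize sizeP (groupCount rungs rounds) rounds) Y → ¬ ¬ LP.Ladder
      -- All groups start as copies of `Y`; they become separated only through the segments of `P`
      -- they are confined to.
      ladder-P big = LP.claim rounds {Φ = Y} {hi = mP} items ≤-refl (≤-reflexive (sym (length-replicate count)))
          (All.replicate⁺ count (big , λ s y → y , y , hitP y))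
          (AllPairs.map (λ _ → tt) (trivial items)) >>= λ
        { (inj₂ ladder) → pure ladder
        ; (inj₁ (Z , bigZ , Z⊆Y , many)) → λ _ → no-many-P Z⊆Y ≤-refl
            (big-mono (ℕ.m≤n+m pairSize _) (λ _ z → z) bigZ) many }
        where
        count = suc (groupCount (groupCount rungs rounds) rounds)
        items = replicate count (tt , Y)
        trivial : ∀ {A : Set₁} (xs : List A) → AllPairs (λ _ _ → ⊤) xs
        trivial [] = []
        trivial (x ∷ xs) = All.universal (λ _ → tt) xs ∷ trivial xs

      -- A label (l , h) records the segment of P to which a group is confined.
      module _ (topP : ℕ) (topP≤m : topP ≤ mP) where
        Confined : ℕ × ℕ → Fin n → Set
        Confined (l , h) s = Y s × h ≤ topP × HitIn G U P l h s ×
                             (∀ x → x < topP → p x ~ s → l ≤ x × x < h)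
        Apart : Rel (ℕ × ℕ) 0ℓ
        Apart (l , h) (l′ , h′) = h ≤ l′ ⊎ h′ ≤ l
        Apart-sym : ∀ {x y} → Apart x y → Apart y x
        Apart-sym (inj₁ a) = inj₂ a
        Apart-sym (inj₂ a) = inj₁ a

        module LQ = Ladders G U Q (λ l → inj₂ (inj₁ (InducedPath.inside Q l))) {I = ℕ × ℕ} {R = Apart}
                            (λ {x} {y} → Apart-sym {x} {y}) Confined sizeQ rungs

        item : LP.Rep → LQ.Item
        item ρ = (LP.Rep.lo ρ , LP.Rep.hi ρ) , LP.Rep.Y ρ

        ladder-Q : ∀ reps → length reps ≡ suc (groupCount rungs rounds) → All (LP.Exclusive topP) reps →
                   AllPairs LP._⊲_ reps → ¬ ¬ LQ.Ladder
        ladder-Q reps len excl pairs = LQ.claim rounds {Φ = Y} {hi = mQ} (map item reps) ≤-refl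
            (≤-reflexive (sym (trans (length-map item reps) len)))
            (All.map⁺ (All.map fits excl)) (AllPairs.map⁺ (AllPairs.map (λ (h≤l , _) → inj₁ h≤l) pairs)) >>= λ
          { (inj₂ ladder) → pure ladder
          ; (inj₁ (Z , bigZ , Z⊆Y , many)) → λ _ → no-many-Q Z⊆Y ≤-refl
              (big-mono (ℕ.m≤n+m pairSize (suc rungs)) (λ _ z → z) bigZ) many }
          where
          fits : ∀ {ρ} → LP.Exclusive topP ρ → LQ.Fits (groupSize sizeQ rungs rounds) Y mQ (item ρ)
          fits (big , h≤top , f) = big-mono (ℕ.m≤m+n _ pairSize) (λ _ z → z) big , λ s z →
            let y , hit , only = f s z in (y , h≤top , hit , only) , y , hitQ y

        module _ (topQ : ℕ) (topQ≤m : topQ ≤ mQ) where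
          Rung : Set₁
          Rung = LQ.Rep × Fin n

          seg : Rung → ℕ × ℕ
          seg (ρ , _) = LQ.Rep.label ρ

          Good : Rung → Set
          Good (ρ , s) = Confined (LQ.Rep.label ρ) s × LQ.Rep.hi ρ ≤ topQ ×
            HitIn G U Q (LQ.Rep.lo ρ) (LQ.Rep.hi ρ) s ×
            (∀ x → x < topQ → q x ~ s → LQ.Rep.lo ρ ≤ x × x < LQ.Rep.hi ρ)

          T : Rel Rung 0ℓ
          T (ρ , s) (σ , s′) = LQ.Rep.hi ρ ≤ LQ.Rep.lo σ × s ≢ s′ × ¬ s ~ s′

          Left Right : Rel Rung 0ℓ
          Left  ρ σ = proj₂ (seg ρ) ≤ proj₁ (seg σ)
          Right ρ σ = proj₂ (seg σ) ≤ proj₁ (seg ρ)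

          -- Greedy from the end of the list: a representative is taken from each group outside the
          -- closed neighborhoods of those already chosen.
          choose : ∀ reps → length reps ≤ sizeQ → All (LQ.Exclusive topQ) reps → AllPairs LQ._⊲_ reps →
                   ¬ ¬ (∃ λ ρs → map proj₁ ρs ≡ reps × All Good ρs ×
                        AllPairs (λ ρ σ → T ρ σ × (Left ρ σ ⊎ Right ρ σ)) ρs)
          choose [] _ _ _ = pure ([] , refl , [] , [])
          choose (ρ ∷ reps) len ((big , h≤ , f) ∷ excl) (rel ∷ pairs) = do
            ρs , eq , good , pairs′ ← choose reps (ℕ.<⇒≤ len) excl pairs
            let size = trans (length-map proj₂ ρs) (trans (sym (length-map proj₁ ρs)) (cong length eq))
            s , s∈Y , free ← big-avoid (map proj₂ ρs)
              (All.map⁺ (All.map (λ ((y , _) , _) → inj₂ (inj₂ (Y⊆X y))) good))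
              (big-mono (≤-trans (≤-reflexive size) (ℕ.<⇒≤ len)) (λ _ y → y) big)
            let c , hit , only = f s s∈Y
            pure ((ρ , s) ∷ ρs , cong (ρ ∷_) eq , (c , h≤ , hit , only) ∷ good ,
              All.zipWith (λ ((h≤l , apart) , ¬d) → (h≤l , (λ e → ¬d (inj₁ (sym e))) , λ e → ¬d (inj₂ (~-sym e))) , apart)
                (All.map⁻ (subst (All _) (sym eq) rel) , All.map⁻ (All.¬Any⇒All¬ (map proj₂ ρs) free)) ∷ pairs′)

          no-ladder : ∀ {O : Rel Rung 0ℓ} → (∀ ρs → length ρs ≡ k → AllPairs (λ ρ σ → T ρ σ × O ρ σ) ρs → All Good ρs →
                         Track G (_∈ L) (λ i → proj₂ (lookup ρs i))) → ¬ Clique Good (λ ρ σ → T ρ σ × O ρ σ) k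
          no-ladder {O} track (ρs , len , good , pairs) =
            Model⇒InducedMinor G (subst (λ k → Model (skinnyLadder k) G) len model) ¬ladder
            where
            s : Fin (length ρs) → Fin n
            s i = proj₂ (lookup ρs i)
            at : ∀ i → Good (lookup ρs i)
            at i = All.lookup good (∈-lookup i)
            s∈X : ∀ i → X (s i)
            s∈X i = Y⊆X (proj₁ (proj₁ (at i)))
            rel : ∀ {i j} → i Fin.< j → T (lookup ρs i) (lookup ρs j)
            rel l = proj₁ (AllPairs-lookup pairs l)
            independent : ∀ i j → ¬ s i ~ s j
            independent i j e with Fin.<-cmp i j
            ... | tri< l _ _ = proj₂ (proj₂ (rel l)) e
            ... | tri≈ _ refl _ = ~-irrefl refl e
            ... | tri> _ _ l = proj₂ (proj₂ (rel l)) (~-sym e)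
            injective : ∀ {i j} → s i ≡ s j → i ≡ j
            injective {i} {j} e with Fin.<-cmp i j
            ... | tri< l _ _ = contradiction e (proj₁ (proj₂ (rel l)))
            ... | tri≈ _ eq _ = eq
            ... | tri> _ _ l = contradiction (sym e) (proj₁ (proj₂ (rel l)))
            track-Q : Track G (_∈ R) s
            track-Q = ascending-track G {U = U} Q topQ≤m (λ i → LQ.Rep.lo (proj₁ (lookup ρs i)))
              (λ i → LQ.Rep.hi (proj₁ (lookup ρs i))) (λ i → proj₁ (proj₂ (at i))) (λ l → proj₁ (rel l))
              (λ i → proj₁ (proj₂ (proj₂ (at i)))) (λ i → proj₂ (proj₂ (proj₂ (at i))))
            model : Model (skinnyLadder (length ρs)) G
            model = ladder-model G (track ρs len pairs good) track-Q L∩R L≁R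
              (λ i → proj₁ (X-props (s∈X i))) (λ i → proj₁ (proj₂ (X-props (s∈X i)))) independent injective

          -- The representatives are in order along `Q`. By Ramsey's theorem `k` of them have
          -- segments in increasing or in decreasing order along `P`, and in both cases two rails
          -- and the representatives form a skinny ladder.
          contradictory : ∀ reps → length reps ≡ suc rungs → All (LQ.Exclusive topQ) reps → ¬ AllPairs LQ._⊲_ reps
          contradictory reps len excl pairs =
            choose reps (≤-trans (≤-reflexive len) (ℕ.m≤m+n (suc rungs) pairSize)) excl pairs λ (ρs , eq , good , pairs′) →
              case ramsey-clique k k ρs good pairs′
                     (≤-trans (ℕ.n≤1+n _) (≤-reflexive (trans (sym len) (trans (sym (cong length eq)) (length-map proj₁ ρs))))) of λ where
                (inj₁ clique) → no-ladder {Left} (λ ρs _ pairs good →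
                  let at = λ i → proj₁ (All.lookup good (∈-lookup i)) in
                  ascending-track G {U = U} P topP≤m (λ i → proj₁ (seg (lookup ρs i))) (λ i → proj₂ (seg (lookup ρs i)))
                    (λ i → proj₁ (proj₂ (at i))) (λ l → proj₂ (AllPairs-lookup pairs l))
                    (λ i → proj₁ (proj₂ (proj₂ (at i)))) (λ i → proj₂ (proj₂ (proj₂ (at i))))) clique
                (inj₂ clique) → no-ladder {Right} (λ ρs _ pairs good →
                  let at = λ i → proj₁ (All.lookup good (∈-lookup (opposite i))) in
                  flip-track G (ascending-track G {U = U} P topP≤m (λ i → proj₁ (seg (lookup ρs (opposite i))))
                    (λ i → proj₂ (seg (lookup ρs (opposite i))))
                    (λ i → proj₁ (proj₂ (at i))) (λ l → proj₂ (AllPairs-lookup pairs (opposite-< l)))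
                    (λ i → proj₁ (proj₂ (proj₂ (at i)))) (λ i → proj₂ (proj₂ (proj₂ (at i)))))) clique

    private
      enough₂ enough₁ : ℕ
      enough₂ = groupSize sizeP (groupCount rungs rounds) rounds
      enough₁ = suc (k * enough₂)

      no-two-paths : ∀ {mP p} (P : InducedPath G (_∈ L) mP p) {mQ q} (Q : InducedPath G (_∈ R) mQ q) →
        ¬ Big enough₂ (λ s → (X s × ∃ λ i → i < mP × p i ~ s) × ∃ λ i → i < mQ × q i ~ s)
      no-two-paths {mP} {p} P {mQ} {q} Q big = ladder-P P Q Y⊆X hitP hitQ big λ
        (topP , repsP , topP≤m , lenP , exclP , pairsP) →
          ladder-Q P Q Y⊆X hitP hitQ topP topP≤m repsP lenP exclP pairsP λ
        (topQ , repsQ , topQ≤m , lenQ , exclQ , pairsQ) →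
          contradictory P Q Y⊆X hitP hitQ topP topP≤m topQ topQ≤m repsQ lenQ exclQ pairsQ
        where
        Y : Fin n → Set
        Y s = (X s × ∃ λ i → i < mP × p i ~ s) × ∃ λ i → i < mQ × q i ~ s
        Y⊆X : ∀ {s} → Y s → X s
        Y⊆X ((x , _) , _) = x
        hitP : ∀ {s} → Y s → HitIn G U P 0 mP s
        hitP ((_ , x , l , e) , _) = x , z≤n , l , e
        hitQ : ∀ {s} → Y s → HitIn G U Q 0 mQ s
        hitQ (_ , x , l , e) = x , z≤n , l , e

    -- A path in `L` hits a big part of `X`, and a path in `R` then hits a big part of that part.
    few-dominators : ¬ ¬ Small dominators X
    few-dominators big =
      path-hitting G U {C = L} {B = R} {X = X} L-conn R-conn L∩R L≁R inj₁ L-props free enough₁ big λ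
        (mP , p , P , big₁) →
      path-hitting G U {C = R} {B = L} {X = λ s → X s × ∃ λ i → i < mP × p i ~ s} R-conn L-conn
        (λ r l → L∩R l r) (λ r l e → L≁R l r (~-sym e)) (inj₂ ∘ inj₁) (R-props ∘ proj₁) free enough₂ big₁ λ
        (mQ , q , Q , big₂) →
      no-two-paths P Q big₂
      where
      L-props : ∀ {s} → X s → s ∉ L × s ∉ R × (∃ λ v → v ∈ L × v ~ s) × HasNeighborIn G s R
      L-props x = let s∉L , s∉R , (v , v∈ , e) , nR = X-props x in s∉L , s∉R , (v , v∈ , ~-sym e) , nR
      R-props : ∀ {s} → X s → s ∉ R × s ∉ L × (∃ λ v → v ∈ R × v ~ s) × HasNeighborIn G s L
      R-props x = let s∉L , s∉R , nL , (v , v∈ , e) = X-props x in s∉R , s∉L , (v , v∈ , ~-sym e) , nL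

-- Recovering a separator from few vertices

module _ {A : Set} where

  AtMost : (A → Set) → ℕ → Set
  AtMost Q N = ∀ xs → Unique xs → All Q xs → length xs ≤ N

  private
    variable
      Q R : A → Set
      M N : ℕ

  atMost-mono : (∀ x → Q x → R x) → M ≤ N → AtMost R M → AtMost Q N
  atMost-mono Q⊆R M≤N f xs uniq qs = ≤-trans (f xs uniq (All.map (Q⊆R _) qs)) M≤N

  -- The bound is a decidable inequality and a list is finite, so codes that exist only classically
  -- suffice for counting.
  atMost-¬¬ : AtMost Q N → AtMost (λ x → ¬ ¬ Q x) N
  atMost-¬¬ f xs uniq qs = decidable-stable (_ ≤? _) (¬¬-All qs >>= λ qs → pure (f xs uniq qs))

  atMost-one : (∀ {x y} → Q x → Q y → x ≡ y) → AtMost Q 1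
  atMost-one f [] _ _ = z≤n
  atMost-one f (_ ∷ []) _ _ = ≤-refl
  atMost-one f (_ ∷ _ ∷ _) ((x≢y ∷ _) ∷ _) (q ∷ q′ ∷ _) = contradiction (f q q′) x≢y

  atMost-none : (∀ x → ¬ Q x) → AtMost Q 0
  atMost-none f [] _ _ = z≤n
  atMost-none f (x ∷ _) _ (q ∷ _) = contradiction q (f x)

  atMost-⊎ : AtMost Q M → AtMost R N → AtMost (λ x → Q x ⊎ R x) (M + N)
  atMost-⊎ {Q} {M} {R} {N} f g xs uniq qrs = let ys , zs , len , yu , zu , qs , rs , _ = split xs uniq qrs in
    subst (_≤ M + N) len (ℕ.+-mono-≤ (f ys yu qs) (g zs zu rs))
    where
    split : ∀ xs → Unique xs → All (λ x → Q x ⊎ R x) xs → ∃₂ λ ys zs → length ys + length zs ≡ length xs ×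
            Unique ys × Unique zs × All Q ys × All R zs × (∀ {P : A → Set} → All P xs → All P ys × All P zs)
    split [] _ _ = [] , [] , refl , [] , [] , [] , [] , λ _ → [] , []
    split (x ∷ xs) (x∉ ∷ uniq) (qr ∷ qrs) with split xs uniq qrs | qr
    ... | ys , zs , len , yu , zu , qs , rs , sub | inj₁ q =
      x ∷ ys , zs , cong suc len , proj₁ (sub x∉) ∷ yu , zu , q ∷ qs , rs ,
      λ { (p ∷ ps) → p ∷ proj₁ (sub ps) , proj₂ (sub ps) }
    ... | ys , zs , len , yu , zu , qs , rs , sub | inj₂ r =
      ys , x ∷ zs , trans (ℕ.+-suc _ _) (cong suc len) , yu , proj₂ (sub x∉) ∷ zu , qs , r ∷ rs ,
      λ { (p ∷ ps) → proj₁ (sub ps) , p ∷ proj₂ (sub ps) }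

  atMost-∃ : ∀ {m} {P : Fin m → A → Set} → (∀ i → AtMost (P i) N) → AtMost (λ x → ∃ λ i → P i x) (m * N)
  atMost-∃ {m = zero}  f = atMost-none λ { x (() , _) }
  atMost-∃ {m = suc m} {P} f = atMost-mono (λ { x (zero , p) → inj₁ p ; x (suc i , p) → inj₂ (i , p) }) ≤-refl
    (atMost-⊎ (f zero) (atMost-∃ (f ∘ suc)))

  atMost-∃Vec : ∀ {m} q {P : Vec (Fin m) q → A → Set} → (∀ v → AtMost (P v) N) →
                AtMost (λ x → ∃ λ v → P v x) (m ^ q * N)
  atMost-∃Vec zero    f = atMost-mono (λ { x ([] , p) → p }) (≤-reflexive (sym (ℕ.+-identityʳ _))) (f [])
  atMost-∃Vec {m = m} (suc q) f = atMost-mono (λ { x (i ∷ v , p) → i , v , p }) (≤-reflexive (sym (ℕ.*-assoc m (m ^ q) _)))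
    (atMost-∃ λ i → atMost-∃Vec q λ v → f (i ∷ v))

-- Turns guesses of bounded length into vectors of fixed length, which `atMost-∃Vec` counts.
pad : {A : Set} {q : ℕ} (a : A) (xs : List A) → length xs ≤ q →
      ∃ λ (v : Vec A q) → (∀ {P : A → Set} → P a → All P xs → VecAll.All P v) ×
                          (∀ {P : A → Set} → Any P xs → VecAny.Any P v)
pad {q = zero}  a [] _ = [] , (λ _ _ → VecAll.[]) , λ ()
pad {q = suc q} a [] _ = let v , all , _ = pad a [] z≤n in
  a ∷ v , (λ p ps → p VecAll.∷ all p ps) , λ ()
pad a (x ∷ xs) (s≤s l) = let v , all , any = pad a xs l in
  x ∷ v , (λ { p (q ∷ qs) → q VecAll.∷ all p qs }) ,
  λ { (here p) → VecAny.here p ; (there ps) → VecAny.there (any ps) }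

-- Start with all vertices and drop redundant ones. When none is redundant, each has a target
-- covered by it alone.
irredundant-cover : (F : Fin n → Fin n → Set) → ¬ ¬ (∃ λ m → ∃₂ λ (p q : Fin m → Fin n) →
  (∀ i → F (p i) (q i)) × (∀ i j → i ≢ j → ¬ F (p j) (q i)) × (∀ v s → F v s → ¬ ¬ (∃ λ i → F (p i) s)))
irredundant-cover {n} F = go n id (λ v s f → pure (v , f))
  where
  Covers : ∀ {m} → (Fin m → Fin n) → Set
  Covers p = ∀ v s → F v s → ¬ ¬ (∃ λ i → F (p i) s)
  go : ∀ m (p : Fin m → Fin n) → Covers p → ¬ ¬ (∃ λ m → ∃₂ λ (p q : Fin m → Fin n) →
       (∀ i → F (p i) (q i)) × (∀ i j → i ≢ j → ¬ F (p j) (q i)) × Covers p)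
  go zero p covers = pure (0 , p , (λ ()) , (λ ()) , (λ ()) , covers)
  go (suc m) p covers = do
    no ¬redundant ← em {A = ∃ λ i → Covers (p ∘ punchIn i)}
      where yes (i , covers′) → go m (p ∘ punchIn i) covers′
    q ← ¬¬-∀ (λ i → private-target i (λ c → ¬redundant (i , c)))
    pure (suc m , p , proj₁ ∘ q , (λ i → proj₁ (proj₂ (q i))) , (λ i j ne → proj₂ (proj₂ (q i)) j (ne ∘ sym)) , covers)
    where
    private-target : ∀ i → ¬ Covers (p ∘ punchIn i) → ¬ ¬ (∃ λ s → F (p i) s × (∀ j → j ≢ i → ¬ F (p j) s))
    private-target i ¬covers none = ¬covers λ v s f ¬others →
      let alone = λ j j≢i fj → ¬others (punchOut (j≢i ∘ sym) , subst (λ j → F (p j) s) (sym (punchIn-punchOut (j≢i ∘ sym))) fj)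
      in covers v s f λ (j , fj) → case j ≟ i of λ where
           (yes refl) → none (s , fj , alone)
           (no j≢i)   → alone j j≢i fj

-- The two sides of a separator and what they see

module _ (G : Graph n) where
  open Graph G

  record Separation (S L R : Subset n) : Set where
    field
      L-conn   : Connected G L
      R-conn   : Connected G R
      L∩R      : ∀ {v} → v ∈ L → v ∉ R
      L∩S      : ∀ {v} → v ∈ L → v ∉ S
      R∩S      : ∀ {v} → v ∈ R → v ∉ S
      S-L      : ∀ {s} → s ∈ S → HasNeighborIn G s L
      S-R      : ∀ {s} → s ∈ S → HasNeighborIn G s R
      L-closed : ∀ {u v} → u ∈ L → u ~ v → v ∈ L ⊎ v ∈ S
      R-closed : ∀ {u v} → u ∈ R → u ~ v → v ∈ R ⊎ v ∈ S

    L≁R : Anticomplete G L R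
    L≁R u∈L v∈R e with L-closed u∈L e
    ... | inj₁ v∈L = L∩R v∈L v∈R
    ... | inj₂ v∈S = R∩S v∈R v∈S

  flip : ∀ {S L R} → Separation S L R → Separation S R L
  flip sep = record
    { L-conn = R-conn ; R-conn = L-conn ; L∩R = λ r l → L∩R l r ; L∩S = R∩S ; R∩S = L∩S
    ; S-L = S-R ; S-R = S-L ; L-closed = R-closed ; R-closed = L-closed }
    where open Separation sep

  separation : ∀ {S} → IsMinimalSeparator G S → ∃₂ λ L R → Separation S L R
  separation {S} (_ , L , R , L≢R , (L-conn , L⊆ , _) , (R-conn , R⊆ , _) , (NL⊆ , NL⊇) , (NR⊆ , NR⊇)) =
    L , R , record
      { L-conn = L-conn ; R-conn = R-conn
      -- Walks inside one side avoid `S` and so cannot leave the other side; from a common vertex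
      -- they would show that the two sides coincide.
      ; L∩R = λ l r → L≢R (⊆-antisym (λ v∈ → stays R∩S (closed NR⊆) r (proj₂ L-conn l v∈) L∩S)
                                     (λ v∈ → stays L∩S (closed NL⊆) l (proj₂ R-conn r v∈) R∩S))
      ; L∩S = L∩S ; R∩S = R∩S
      ; S-L = λ s∈ → let _ , u , u∈ , e = NL⊇ s∈ in u , u∈ , ~-sym e
      ; S-R = λ s∈ → let _ , u , u∈ , e = NR⊇ s∈ in u , u∈ , ~-sym e
      ; L-closed = closed NL⊆ ; R-closed = closed NR⊆ }
    where
    L∩S : ∀ {v} → v ∈ L → v ∉ S
    L∩S v∈L = x∈∁p⇒x∉p (L⊆ v∈L)
    R∩S : ∀ {v} → v ∈ R → v ∉ S
    R∩S v∈R = x∈∁p⇒x∉p (R⊆ v∈R)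
    closed : ∀ {C} → (∀ {v} → OpenNeighborhood G C v → v ∈ S) → ∀ {u v} → u ∈ C → u ~ v → v ∈ C ⊎ v ∈ S
    closed {C} N⊆ {u} {v} u∈ e with v ∈? C
    ... | yes v∈ = inj₁ v∈
    ... | no v∉  = inj₂ (N⊆ (v∉ , u , u∈ , e))
    stays : ∀ {C D} → (∀ {v} → v ∈ C → v ∉ S) → (∀ {u v} → u ∈ C → u ~ v → v ∈ C ⊎ v ∈ S) →
            ∀ {u v} → u ∈ C → Star (EdgeWithin G D) u v → (∀ {v} → v ∈ D → v ∉ S) → v ∈ C
    stays C∩S C-closed u∈C ε D∩S = u∈C
    stays C∩S C-closed u∈C ((_ , w∈D , e) ◅ es) D∩S with C-closed u∈C e
    ... | inj₁ w∈C = stays C∩S C-closed w∈C es D∩S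
    ... | inj₂ w∈S = contradiction w∈S (D∩S w∈D)

  Adj : Fin n → List (Fin n) → Set
  Adj s K = Any (_~ s) K

  -- Z lies in the separator and K outside of it, every vertex of the separator is in Z or
  -- adjacent to K; hence a component of the free graph lies on a single side.
  module Decode (Z K : List (Fin n)) where

    Free : Fin n → Set
    Free v = ¬ v List.∈ Z × ¬ Adj v K

    -- The starting vertex is exempt from being free: a viewpoint may itself be adjacent to `K`.
    Reach : Fin n → Fin n → Set
    Reach = Star (λ u v → u ~ v × Free v)

    Sees : Fin n → Fin n → Set
    Sees p s = ∃ λ u → Reach p u × u ~ s

    Covered : Subset n → Set
    Covered S = ∀ s → s ∈ S → s List.∈ Z ⊎ Adj s K

    module _ {S L R} (sep : Separation S L R) (covered : Covered S) where
      open Separation sep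

      free∉S : ∀ {v} → Free v → v ∉ S
      free∉S (v∉Z , v≁K) v∈S with covered _ v∈S
      ... | inj₁ v∈Z = v∉Z v∈Z
      ... | inj₂ v~K = v≁K v~K

      reach⊆L : ∀ {p u} → p ∈ L → Reach p u → u ∈ L
      reach⊆L p∈L ε = p∈L
      reach⊆L p∈L ((e , free) ◅ es) with L-closed p∈L e
      ... | inj₁ v∈L = reach⊆L v∈L es
      ... | inj₂ v∈S = contradiction v∈S (free∉S free)

      -- What is seen from `L` lies in `L` or `S`; it cannot lie in `L`, whose vertices have no
      -- neighbors outside `L` and `S`.
      sees-sound : ∀ {p s N} → p ∈ L → Sees p s → All (λ v → v ∉ S × v ∉ L) N → Adj s N → s ∈ S
      sees-sound p∈L (u , reach , e) outside adj with L-closed (reach⊆L p∈L reach) e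
      ... | inj₂ s∈S = s∈S
      ... | inj₁ s∈L with (o∉S , o∉L) , o~s ← All.lookupAny outside adj with L-closed s∈L (~-sym o~s)
      ...   | inj₁ o∈L = contradiction o∈L o∉L
      ...   | inj₂ o∈S = contradiction o∈S o∉S

      module _ (free : CreatureFree G k) {X : List (Fin n)} (X⊆L : All (_∈ L) X) where

        Target : Fin n → Set
        Target s = s ∈ S × ¬ Adj s X

        SeesFrom : Fin n → Fin n → Fin n → Set
        SeesFrom x p s = p ∈ L × (p ≡ x ⊎ x ~ p) × Sees p s × Target s

        -- In an irredundant family of viewpoints, `x` together with what the `i`-th one reaches
        -- touches the `i`-th private target only, and no target is adjacent to `x`. Against
        -- `B = R`, `k` of them give a creature by `star-creature`.
        few-viewpoints : ∀ x → x List.∈ X → ¬ ¬ (∃ λ P → length P ≤ k × All (_∈ L) P ×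
                         (∀ p s → SeesFrom x p s → ¬ ¬ Any (λ p → Sees p s) P))
        few-viewpoints x x∈X = do
          m , p , q , sees , private′ , covers ← irredundant-cover (SeesFrom x)
          no k≰m ← em {A = k ≤ m}
            where yes k≤m → λ _ → creature m p q sees private′ k≤m free
          pure (tabulate p , ≤-trans (≤-reflexive (length-tabulate p)) (ℕ.<⇒≤ (ℕ.≰⇒> k≰m)) ,
            All.tabulate⁺ (λ i → proj₁ (sees i)) ,
            λ v s f → covers v s f >>= λ (i , _ , _ , v-sees , _) → pure (Any.tabulate⁺ i v-sees))
          where
          x∈L : x ∈ L
          x∈L = All.lookup X⊆L x∈X
          creature : ∀ m (p q : Fin m → Fin n) → (∀ i → SeesFrom x (p i) (q i)) →
                     (∀ i j → i ≢ j → ¬ SeesFrom x (p j) (q i)) → k ≤ m → ¬ ¬ Creature G k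
          creature m p q sees private′ k≤m = star-creature {C = C} {D = _∈ L} {x = x} {q = q ∘ ι} {B = R}
              R-conn x∈L rooted C⊆L (λ v → L∩R) (λ u v → L≁R)
              (λ i q∈R → R∩S q∈R (q∈S i)) (λ i → S-R (q∈S i)) (λ i q∈L → L∩S q∈L (q∈S i))
              (λ i → let _ , _ , (u , reach , e) , _ = sees (ι i) in u , inj₂ reach , e)
              (λ { i j i≢j v (inj₁ refl) e → x≁q i e
                 ; i j i≢j v (inj₂ reach) e → private′ (ι i) (ι j) (i≢j ∘ inject≤-injective k≤m k≤m i j)
                     (proj₁ (sees (ι j)) , proj₁ (proj₂ (sees (ι j))) , (v , reach , e) , proj₂ (proj₂ (proj₂ (sees (ι i))))) })
              x≁q
            where
            ι : Fin k → Fin m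
            ι i = inject≤ i k≤m
            q∈S : ∀ i → q (ι i) ∈ S
            q∈S i = proj₁ (proj₂ (proj₂ (proj₂ (sees (ι i)))))
            x≁q : ∀ i → ¬ x ~ q (ι i)
            x≁q i e = proj₂ (proj₂ (proj₂ (proj₂ (sees (ι i))))) (Any.map (λ { refl → e }) x∈X)
            C : Fin k → Fin n → Set
            C i v = v ≡ x ⊎ Reach (p (ι i)) v
            C⊆L : ∀ i v → C i v → v ∈ L
            C⊆L i v (inj₁ refl) = x∈L
            C⊆L i v (inj₂ reach) = reach⊆L (proj₁ (sees (ι i))) reach
            extend : ∀ {i u v} → Reach (p (ι i)) u → Reach u v → Star (EdgeIn G (C i)) u v
            extend pre ε = ε
            extend pre (e ◅ es) = (inj₂ pre , inj₂ (pre ◅◅ (e ◅ ε)) , proj₁ e) ◅ extend (pre ◅◅ (e ◅ ε)) es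
            from-x : ∀ i {v} → Reach (p (ι i)) v → p (ι i) ≡ x ⊎ x ~ p (ι i) → Star (EdgeIn G (C i)) x v
            from-x i {v} reach (inj₁ p≡x) = subst (λ u → Star (EdgeIn G (C i)) u v) p≡x (extend ε reach)
            from-x i reach (inj₂ x~p) = (inj₁ refl , inj₂ ε , x~p) ◅ extend ε reach
            rooted : ∀ i → Rooted G (C i) x
            rooted i = inj₁ refl , λ where
              v (inj₁ refl)  → ε
              v (inj₂ reach) → from-x i reach (proj₁ (proj₂ (sees (ι i))))

        all-viewpoints : ∀ xs → All (List._∈ X) xs → ¬ ¬ (∃ λ P → length P ≤ length xs * k × All (_∈ L) P ×
                         (∀ x p s → x List.∈ xs → SeesFrom x p s → ¬ ¬ Any (λ p → Sees p s) P))
        all-viewpoints [] [] = pure ([] , z≤n , [] , λ { _ _ _ () })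
        all-viewpoints (x ∷ xs) (x∈ ∷ xs⊆) = do
          P , P≤ , P⊆L , P-sees ← few-viewpoints x x∈
          Q , Q≤ , Q⊆L , Q-sees ← all-viewpoints xs xs⊆
          pure (P ++ Q , ≤-trans (≤-reflexive (length-++ P)) (ℕ.+-mono-≤ P≤ Q≤) , All.++⁺ P⊆L Q⊆L , λ where
            _ p s (here refl) sees → P-sees p s sees >>= λ any → pure (Any.++⁺ˡ any)
            x′ p s (there x∈) sees → Q-sees x′ p s x∈ sees >>= λ any → pure (Any.++⁺ʳ P any))

        -- A walk inside L is in the free graph except at vertices of L adjacent to K, and
        -- those are adjacent to X.
        viewed : ∀ {a} → a List.∈ X → (∀ {v} → v ∈ L → Adj v K → Adj v X) → (∀ {v} → v ∈ L → ¬ v List.∈ Z) →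
                 ∀ {s} → Target s → ¬ ¬ (∃₂ λ x p → x List.∈ X × SeesFrom x p s)
        viewed {a} a∈X K⇒X L∩Z {s} target@(s∈S , _) = do
          let l , l∈L , s~l = S-L s∈S
          x , p , x∈X , p∈L , px , reach ← go (a , a , a∈X , All.lookup X⊆L a∈X , inj₁ refl , ε)
            (proj₂ L-conn (All.lookup X⊆L a∈X) l∈L)
          pure (x , p , x∈X , p∈L , px , (l , reach , ~-sym s~l) , target)
          where
          From : Fin n → Set
          From u = ∃₂ λ x p → x List.∈ X × p ∈ L × (p ≡ x ⊎ x ~ p) × Reach p u
          go : ∀ {u v} → From u → Star (EdgeWithin G L) u v → ¬ ¬ From v
          go from ε = pure from
          go (x , p , x∈X , p∈L , px , reach) (_◅_ {j = w} (_ , w∈L , e) es) = em {A = Adj w K} >>= λ where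
            (no w≁K) → go (x , p , x∈X , p∈L , px , reach ◅◅ ((e , L∩Z w∈L , w≁K) ◅ ε)) es
            (yes w~K) → let x′ , x′∈X , x′~w = List.find (K⇒X w∈L w~K) in
              go (x′ , w , x′∈X , w∈L , inj₂ x′~w , ε) es

        viewpoints : ∀ {a} → a List.∈ X → (∀ {v} → v ∈ L → Adj v K → Adj v X) → (∀ {v} → v ∈ L → ¬ v List.∈ Z) →
                     ¬ ¬ (∃ λ P → length P ≤ length X * k × All (_∈ L) P ×
                          (∀ s → Target s → ¬ ¬ Any (λ p → Sees p s) P))
        viewpoints a∈X K⇒X L∩Z = do
          P , P≤ , P⊆L , P-sees ← all-viewpoints X (All.tabulate id)
          pure (P , P≤ , P⊆L , λ s target → viewed a∈X K⇒X L∩Z target >>= λ (x , p , x∈X , sees) → P-sees x p s x∈X sees)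

-- Counting minimal separators

vec-find : {A : Set} {P Q : A → Set} {q : ℕ} {v : Vec A q} → VecAll.All P v → VecAny.Any Q v → ∃ λ x → P x × Q x
vec-find (p VecAll.∷ _) (VecAny.here q) = _ , p , q
vec-find (_ VecAll.∷ ps) (VecAny.there qs) = vec-find ps qs

module _ {A : Set} {P Q R : A → Set} (P? : Decidable P) (Q? : Decidable Q) (R? : Decidable R) where

  length-filter-⊎ : (∀ {x} → P x → Q x ⊎ R x) → ∀ xs →
                    length (filter P? xs) ≤ length (filter Q? xs) + length (filter R? xs)
  length-filter-⊎ split [] = z≤n
  length-filter-⊎ split (x ∷ xs) with P? x | Q? x | R? x
  ... | no _  | no _  | no _  = length-filter-⊎ split xs
  ... | no _  | no _  | yes _ = ≤-trans (length-filter-⊎ split xs) (ℕ.+-monoʳ-≤ _ (ℕ.n≤1+n _))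
  ... | no _  | yes _ | no _  = ℕ.m≤n⇒m≤1+n (length-filter-⊎ split xs)
  ... | no _  | yes _ | yes _ = ℕ.m≤n⇒m≤1+n (≤-trans (length-filter-⊎ split xs) (ℕ.+-monoʳ-≤ _ (ℕ.n≤1+n _)))
  ... | yes _ | yes _ | no _  = s≤s (length-filter-⊎ split xs)
  ... | yes _ | yes _ | yes _ = s≤s (≤-trans (length-filter-⊎ split xs) (ℕ.+-monoʳ-≤ _ (ℕ.n≤1+n _)))
  ... | yes _ | no _  | yes _ = ≤-trans (s≤s (length-filter-⊎ split xs)) (≤-reflexive (sym (ℕ.+-suc _ _)))
  ... | yes p | no ¬q | no ¬r with split p
  ...   | inj₁ q = contradiction q ¬q
  ...   | inj₂ r = contradiction r ¬r

length-filter-¬ : {A : Set} {P : A → Set} (P? : Decidable P) (xs : List A) →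
                  length (filter (¬? ∘ P?) xs) + length (filter P? xs) ≡ length xs
length-filter-¬ P? [] = refl
length-filter-¬ P? (x ∷ xs) with P? x
... | yes _ = trans (ℕ.+-suc _ _) (cong suc (length-filter-¬ P? xs))
... | no _  = cong suc (length-filter-¬ P? xs)

-- Branching over partial knowledge of a separator

module Count (G : Graph n) .{{n≢0 : NonZero n}} {k : ℕ} (free : CreatureFree G k) (d : ℕ)
  (dominate : ∀ {L R X} (L-conn : Connected G L) (R-conn : Connected G R) (L∩R : ∀ {v} → v ∈ L → v ∉ R)
              (L≁R : Anticomplete G L R) →
              (∀ {s} → X s → s ∉ L × s ∉ R × HasNeighborIn G s L × HasNeighborIn G s R) →
              ¬ ¬ Domination.Small G (λ v → v ∈ L ⊎ v ∈ R ⊎ X v) (suc d) X) where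
  open Graph G

  private
    V = Fin n
    open DecList (_≟_ {n}) using () renaming (_∈?_ to _∈ₗ?_)

  Cover : (Z X Y O W : List V) → V → Set
  Cover Z X Y O W s = s List.∈ Z ⊎ Adj G s X ⊎ Adj G s Y ⊎ Adj G s O ⊎ s List.∈ W

  -- The lists are the guesses made so far; a vertex of `S` they do not account for is in `W`. `a`
  -- and `b` are fixed vertices of the two sides, so that each side has a vertex to start from.
  record State (a b : V) (Z X Y O W : List V) (S : Subset n) : Set where
    constructor state
    field
      {L R} : Subset n
      sep   : Separation G S L R
      Z⊆S   : All (_∈ S) Z
      X⊆L   : All (_∈ L) (a ∷ X)
      Y⊆R   : All (_∈ R) (b ∷ Y)
      O-out : All (λ v → v ∉ S × v ∉ L × v ∉ R) O
      cover : ∀ s → s ∈ S → Cover Z (a ∷ X) (b ∷ Y) O W s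

  module _ (a b : V) (Z X Y O : List V) where

    known : List V
    known = (a ∷ X) ++ (b ∷ Y) ++ O

    open Decode G Z known

    record Coded {q q′} (P : Vec V q) (Q : Vec V q′) (S : Subset n) : Set where
      field
        given : State a b Z X Y O [] S
      open State given public
      field
        P⊆L : VecAll.All (_∈ L) P
        Q⊆R : VecAll.All (_∈ R) Q
        P-sees : ∀ s → s ∈ S → ¬ Adj G s (a ∷ X) → ¬ ¬ VecAny.Any (λ p → Sees p s) P
        Q-sees : ∀ s → s ∈ S → ¬ Adj G s (b ∷ Y) → ¬ ¬ VecAny.Any (λ p → Sees p s) Q

    state-covered : ∀ {S} → State a b Z X Y O [] S → Covered S
    state-covered st s s∈S with State.cover st s s∈S
    ... | inj₁ s∈Z = inj₁ s∈Z
    ... | inj₂ (inj₁ adj) = inj₂ (Any.++⁺ˡ adj)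
    ... | inj₂ (inj₂ (inj₁ adj)) = inj₂ (Any.++⁺ʳ (a ∷ X) (Any.++⁺ˡ adj))
    ... | inj₂ (inj₂ (inj₂ (inj₁ adj))) = inj₂ (Any.++⁺ʳ (a ∷ X) (Any.++⁺ʳ (b ∷ Y) adj))
    ... | inj₂ (inj₂ (inj₂ (inj₂ ())))

    -- The code determines the separator. A vertex missed by one of the two lists `a ∷ X` and
    -- `b ∷ Y` is in `Z` or is seen from that side, which is sound for `S′` as well; a vertex
    -- adjacent to both lists touches both sides of `S′` and hence lies in `S′`.
    coded-⊆ : ∀ {q q′} {P : Vec V q} {Q : Vec V q′} {S S′} → Coded P Q S → Coded P Q S′ → ∀ {s} → s ∈ S → s ∈ S′
    coded-⊆ {S = S} {S′} c c′ {s} s∈S = decidable-stable (s ∈? S′) (em {A = Adj G s (a ∷ X)} >>= λ where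
        (no s≁X) → C.P-sees s s∈S s≁X >>= λ any → let p , p∈L , sees = vec-find C′.P⊆L any in pure (from-L s≁X p∈L sees)
        (yes s~X) → em {A = Adj G s (b ∷ Y)} >>= λ where
          (no s≁Y) → C.Q-sees s s∈S s≁Y >>= λ any → let p , p∈R , sees = vec-find C′.Q⊆R any in pure (from-R s≁Y p∈R sees)
          (yes s~Y) → pure (common s~X s~Y))
      where
      module C = Coded c
      module C′ = Coded c′
      open Separation C′.sep
      in-Z : s List.∈ Z → s ∈ S′
      in-Z = All.lookup C′.Z⊆S
      from-L : ∀ {p} → ¬ Adj G s (a ∷ X) → p ∈ C′.L → Sees p s → s ∈ S′
      from-L s≁X p∈L sees with state-covered C.given s s∈S
      ... | inj₁ s∈Z = in-Z s∈Z
      ... | inj₂ adj with Any.++⁻ (a ∷ X) adj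
      ...   | inj₁ s~X = contradiction s~X s≁X
      ...   | inj₂ s~N = sees-sound C′.sep (state-covered C′.given) p∈L sees
                (All.++⁺ (All.map (λ y∈R → R∩S y∈R , λ y∈L → L∩R y∈L y∈R) C′.Y⊆R)
                         (All.map (λ (∉S , ∉L , _) → ∉S , ∉L) C′.O-out)) s~N
      from-R : ∀ {p} → ¬ Adj G s (b ∷ Y) → p ∈ C′.R → Sees p s → s ∈ S′
      from-R s≁Y p∈R sees with state-covered C.given s s∈S
      ... | inj₁ s∈Z = in-Z s∈Z
      ... | inj₂ adj = sees-sound (flip G C′.sep) (state-covered C′.given) p∈R sees
                (All.++⁺ (All.map (λ x∈L → L∩S x∈L , L∩R x∈L) C′.X⊆L)
                         (All.map (λ (∉S , _ , ∉R) → ∉S , ∉R) C′.O-out)) (drop-Y (Any.++⁻ (a ∷ X) adj))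
        where
        drop-Y : Adj G s (a ∷ X) ⊎ Adj G s ((b ∷ Y) ++ O) → Adj G s ((a ∷ X) ++ O)
        drop-Y (inj₁ s~X) = Any.++⁺ˡ s~X
        drop-Y (inj₂ s~YO) with Any.++⁻ (b ∷ Y) s~YO
        ... | inj₁ s~Y = contradiction s~Y s≁Y
        ... | inj₂ s~O = Any.++⁺ʳ (a ∷ X) s~O
      common : Adj G s (a ∷ X) → Adj G s (b ∷ Y) → s ∈ S′
      common s~X s~Y with All.lookupAny C′.X⊆L s~X | All.lookupAny C′.Y⊆R s~Y
      ... | x∈L , x~s | y∈R , y~s with L-closed x∈L x~s | R-closed y∈R y~s
      ...   | inj₂ s∈S′ | _ = s∈S′
      ...   | _ | inj₂ s∈S′ = s∈S′
      ...   | inj₁ s∈L | inj₁ s∈R = contradiction s∈R (L∩R s∈L)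

    encode : ∀ {Λ S} → length (a ∷ X) ≤ Λ → length (b ∷ Y) ≤ Λ → State a b Z X Y O [] S →
             ¬ ¬ (∃₂ λ (P Q : Vec V (Λ * k)) → Coded P Q S)
    encode {Λ} {S} X≤Λ Y≤Λ st = do
      P , P≤ , P⊆L , P-sees ← viewpoints sep covered free X⊆L (here refl) K⇒X (λ v∈L v∈Z → L∩S v∈L (All.lookup Z⊆S v∈Z))
      Q , Q≤ , Q⊆R , Q-sees ← viewpoints (flip G sep) covered free Y⊆R (here refl) K⇒Y (λ v∈R v∈Z → R∩S v∈R (All.lookup Z⊆S v∈Z))
      let P′ , all-P , any-P = pad {q = Λ * k} a P (≤-trans P≤ (ℕ.*-monoˡ-≤ k X≤Λ))
          Q′ , all-Q , any-Q = pad {q = Λ * k} b Q (≤-trans Q≤ (ℕ.*-monoˡ-≤ k Y≤Λ))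
      pure (P′ , Q′ , record
        { given = st ; P⊆L = all-P (All.head X⊆L) P⊆L ; Q⊆R = all-Q (All.head Y⊆R) Q⊆R
        ; P-sees = λ s s∈S s≁X → P-sees s (s∈S , s≁X) >>= λ any → pure (any-P any)
        ; Q-sees = λ s s∈S s≁Y → Q-sees s (s∈S , s≁Y) >>= λ any → pure (any-Q any) })
      where
      open State st
      open Separation sep
      covered : Covered S
      covered = state-covered st
      K⇒X : ∀ {v} → v ∈ L → Adj G v known → Adj G v (a ∷ X)
      K⇒X v∈L adj with Any.++⁻ (a ∷ X) adj
      ... | inj₁ v~X = v~X
      ... | inj₂ v~YO with Any.++⁻ (b ∷ Y) v~YO
      ...   | inj₁ v~Y with y∈R , y~v ← All.lookupAny Y⊆R v~Y = contradiction (~-sym y~v) (L≁R v∈L y∈R)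
      ...   | inj₂ v~O with (o∉S , o∉L , _) , o~v ← All.lookupAny O-out v~O with L-closed v∈L (~-sym o~v)
      ...     | inj₁ o∈L = contradiction o∈L o∉L
      ...     | inj₂ o∈S = contradiction o∈S o∉S
      K⇒Y : ∀ {v} → v ∈ R → Adj G v known → Adj G v (b ∷ Y)
      K⇒Y v∈R adj with Any.++⁻ (a ∷ X) adj
      ... | inj₁ v~X with x∈L , x~v ← All.lookupAny X⊆L v~X = contradiction x~v (L≁R x∈L v∈R)
      ... | inj₂ v~YO with Any.++⁻ (b ∷ Y) v~YO
      ...   | inj₁ v~Y = v~Y
      ...   | inj₂ v~O with (o∉S , _ , o∉R) , o~v ← All.lookupAny O-out v~O with R-closed v∈R (~-sym o~v)
      ...     | inj₁ o∈R = contradiction o∈R o∉R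
      ...     | inj₂ o∈S = contradiction o∈S o∉S

    count-base : ∀ {Λ} → length (a ∷ X) ≤ Λ → length (b ∷ Y) ≤ Λ →
                 AtMost (State a b Z X Y O []) (n ^ (Λ * k) * (n ^ (Λ * k) * 1))
    count-base {Λ} X≤Λ Y≤Λ = atMost-mono (λ S → encode X≤Λ Y≤Λ) ≤-refl
      (atMost-¬¬ (atMost-∃Vec (Λ * k) λ P → atMost-∃Vec (Λ * k) λ Q →
        atMost-one λ c c′ → ⊆-antisym (coded-⊆ c c′) (coded-⊆ c′ c)))

  -- A vertex is popular if it is close to at least a fraction `1 / E` of the size `M`. As `E` is
  -- twice the number of dominators, unpopular dominators are together close to less than half of
  -- `M`.
  E : ℕ
  E = 2 * suc d

  near? : ∀ v w → Dec (v ≡ w ⊎ v ~ w)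
  near? v w = (v ≟ w) ⊎-dec (v ~? w)

  popularity : V → List V → ℕ
  popularity v W = length (filter (near? v) W)

  distant : V → List V → List V
  distant v = filter (¬? ∘ near? v)

  beside : ∀ {a v s X} → Adj G s (a ∷ X) → Adj G s (a ∷ v ∷ X)
  beside (here e)  = here e
  beside (there e) = there (there e)

  -- A separator vertex that leaves `W` for being close to `v` is adjacent to `v`, which has just
  -- joined one of the lists.
  separate-from : ∀ v {s Z X X′ Y Y′ O O′ W} → v ≢ s →
    (Adj G s X → Adj G s X′) → (Adj G s Y → Adj G s Y′) → (Adj G s O → Adj G s O′) →
    (v ~ s → Adj G s X′ ⊎ Adj G s Y′ ⊎ Adj G s O′) →
    Cover Z X Y O W s → Cover Z X′ Y′ O′ (distant v W) s
  separate-from v v≢s fX fY fO adj (inj₁ z) = inj₁ z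
  separate-from v v≢s fX fY fO adj (inj₂ (inj₁ x)) = inj₂ (inj₁ (fX x))
  separate-from v v≢s fX fY fO adj (inj₂ (inj₂ (inj₁ y))) = inj₂ (inj₂ (inj₁ (fY y)))
  separate-from v v≢s fX fY fO adj (inj₂ (inj₂ (inj₂ (inj₁ o)))) = inj₂ (inj₂ (inj₂ (inj₁ (fO o))))
  separate-from v {s} v≢s fX fY fO adj (inj₂ (inj₂ (inj₂ (inj₂ w)))) with near? v s
  ... | yes (inj₁ v≡s) = contradiction v≡s v≢s
  ... | no far = inj₂ (inj₂ (inj₂ (inj₂ (∈-filter⁺ (¬? ∘ near? v) w far))))
  ... | yes (inj₂ v~s) with adj v~s
  ...   | inj₁ x = inj₂ (inj₁ x)
  ...   | inj₂ (inj₁ y) = inj₂ (inj₂ (inj₁ y))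
  ...   | inj₂ (inj₂ o) = inj₂ (inj₂ (inj₂ (inj₁ o)))

  nearby? : ∀ {q} (D : Vec V q) w → Dec (VecAny.Any (λ v → v ≡ w ⊎ v ~ w) D)
  nearby? D w = VecAny.any? (λ v → near? v w) D

  -- A union bound; the summand `q` records the strictness of each of the `q` inequalities.
  nearby-size : ∀ {q M} (D : Vec V q) W → VecAll.All (λ v → E * popularity v W < M) D →
                E * length (filter (nearby? D) W) + q ≤ q * M
  nearby-size [] W VecAll.[] = ≤-reflexive (trans (ℕ.+-identityʳ _) (trans (cong (E *_) (none W)) (ℕ.*-zeroʳ E)))
    where
    none : ∀ W → length (filter (nearby? []) W) ≡ 0
    none [] = refl
    none (_ ∷ W) = none W
  nearby-size {suc q} {M} (v ∷ D) W (v-unpopular VecAll.∷ rest) = begin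
    E * length (filter (nearby? (v ∷ D)) W) + suc q
      ≤⟨ ℕ.+-monoˡ-≤ (suc q) (ℕ.*-monoʳ-≤ E (length-filter-⊎ (nearby? (v ∷ D)) (near? v) (nearby? D)
           (λ { (VecAny.here p) → inj₁ p ; (VecAny.there ps) → inj₂ ps }) W)) ⟩
    E * (popularity v W + length (filter (nearby? D) W)) + suc q
      ≡⟨ cong (_+ suc q) (ℕ.*-distribˡ-+ E (popularity v W) _) ⟩
    E * popularity v W + E * length (filter (nearby? D) W) + suc q
      ≡⟨ trans (ℕ.+-suc _ q) (cong suc (ℕ.+-assoc (E * popularity v W) _ q)) ⟩
    suc (E * popularity v W) + (E * length (filter (nearby? D) W) + q)
      ≤⟨ ℕ.+-mono-≤ v-unpopular (nearby-size D W rest) ⟩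
    M + q * M ∎
    where open ℕ.≤-Reasoning

  shrunk-size : ∀ v W {M i} → M ≤ E * popularity v W → E * length W < M * suc i →
                E * length (distant v W) < M * i
  shrunk-size v W {M} {i} popular small = ℕ.+-cancelˡ-< M _ _ (begin-strict
    M + E * length (distant v W)                  ≡⟨ ℕ.+-comm M _ ⟩
    E * length (distant v W) + M                  ≤⟨ ℕ.+-monoʳ-≤ _ popular ⟩
    E * length (distant v W) + E * popularity v W ≡⟨ sym (ℕ.*-distribˡ-+ E _ (popularity v W)) ⟩
    E * (length (distant v W) + popularity v W)   ≡⟨ cong (E *_) (length-filter-¬ (near? v) W) ⟩
    E * length W                                              <⟨ small ⟩
    M * suc i                                                 ≡⟨ ℕ.*-suc M i ⟩
    M + M * i                                                 ∎)
    where open ℕ.≤-Reasoning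

  -- The branching of one level: a vector of dominators, or a vertex with one of three labels
  -- outside the separator.
  growth : ℕ
  growth = n ^ suc d + n * 3

  -- A bound for the remaining depth: `J` halvings, and `i` labels before the next one. Each halving
  -- allows up to `E` labels and costs one level itself.
  rank : ℕ → ℕ → ℕ
  rank J i = J * suc E + i

  growth-nonZero : NonZero growth
  growth-nonZero = >-nonZero (≤-trans (ℕ.m^n>0 n (suc d)) (ℕ.m≤m+n _ _))

  module _ (Λ : ℕ) where

    base : ℕ
    base = n ^ (Λ * k) * (n ^ (Λ * k) * 1)

    bound : ℕ → ℕ
    bound ρ = growth ^ ρ * base

    bound-mono : ∀ {ρ σ} → ρ ≤ σ → bound ρ ≤ bound σ
    bound-mono l = ℕ.*-monoˡ-≤ base (ℕ.^-monoʳ-≤ growth {{growth-nonZero}} l)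

    scan-bound : ∀ {ρ σ} → σ ≤ ρ → n * (bound ρ + (bound ρ + bound ρ)) + n ^ suc d * bound σ ≤ bound (suc ρ)
    scan-bound {ρ} {σ} σ≤ρ = begin
      n * (bound ρ + (bound ρ + bound ρ)) + n ^ suc d * bound σ
        ≤⟨ ℕ.+-monoʳ-≤ _ (ℕ.*-monoʳ-≤ (n ^ suc d) (bound-mono σ≤ρ)) ⟩
      n * (bound ρ + (bound ρ + bound ρ)) + n ^ suc d * bound ρ
        ≡⟨ cong (λ x → n * (bound ρ + (bound ρ + x)) + n ^ suc d * bound ρ) (sym (ℕ.+-identityʳ (bound ρ))) ⟩
      n * (3 * bound ρ) + n ^ suc d * bound ρ
        ≡⟨ cong (_+ n ^ suc d * bound ρ) (sym (ℕ.*-assoc n 3 (bound ρ))) ⟩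
      n * 3 * bound ρ + n ^ suc d * bound ρ   ≡⟨ ℕ.+-comm (n * 3 * bound ρ) _ ⟩
      n ^ suc d * bound ρ + n * 3 * bound ρ   ≡⟨ sym (ℕ.*-distribʳ-+ (bound ρ) (n ^ suc d) (n * 3)) ⟩
      growth * bound ρ                        ≡⟨ sym (ℕ.*-assoc growth (growth ^ ρ) base) ⟩
      bound (suc ρ)                           ∎
      where open ℕ.≤-Reasoning

    module Scan (a b : V) (X Y O W : List V) (M B-labelled B-dominated : ℕ)
      (labelled : ∀ {Z} v → M ≤ E * popularity v W →
         AtMost (State a b Z (v ∷ X) Y O (distant v W)) B-labelled ×
         AtMost (State a b Z X (v ∷ Y) O (distant v W)) B-labelled ×
         AtMost (State a b Z X Y (v ∷ O) (distant v W)) B-labelled)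
      (dominated : ∀ {Z} (D : Vec V (suc d)) → VecAll.All (λ v → E * popularity v W < M) D →
         AtMost (State a b Z X Y O (filter (nearby? D) W)) B-dominated) where

      label : ∀ {Z} v S → State a b Z X Y O W S →
              State a b (v ∷ Z) X Y O W S ⊎
              (State a b Z (v ∷ X) Y O (distant v W) S ⊎
               (State a b Z X (v ∷ Y) O (distant v W) S ⊎ State a b Z X Y (v ∷ O) (distant v W) S))
      label {Z} v S st with v ∈? S
      ... | yes v∈S = inj₁ record
        { sep = sep ; Z⊆S = v∈S ∷ Z⊆S ; X⊆L = X⊆L ; Y⊆R = Y⊆R ; O-out = O-out
        ; cover = λ s s∈S → Sum.map₁ there (cover s s∈S) }
        where open State st
      ... | no v∉S with v ∈? State.L st | v ∈? State.R st
      ...   | yes v∈L | _ = inj₂ (inj₁ record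
        { sep = sep ; Z⊆S = Z⊆S ; X⊆L = All.head X⊆L ∷ v∈L ∷ All.tail X⊆L ; Y⊆R = Y⊆R ; O-out = O-out
        ; cover = λ s s∈S → separate-from v (λ { refl → v∉S s∈S }) beside id id
            (λ e → inj₁ (there (here e))) (cover s s∈S) })
        where open State st
      ...   | no _ | yes v∈R = inj₂ (inj₂ (inj₁ record
        { sep = sep ; Z⊆S = Z⊆S ; X⊆L = X⊆L ; Y⊆R = All.head Y⊆R ∷ v∈R ∷ All.tail Y⊆R ; O-out = O-out
        ; cover = λ s s∈S → separate-from v (λ { refl → v∉S s∈S }) id beside id
            (λ e → inj₂ (inj₁ (there (here e)))) (cover s s∈S) }))
        where open State st
      ...   | no v∉L | no v∉R = inj₂ (inj₂ (inj₂ record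
        { sep = sep ; Z⊆S = Z⊆S ; X⊆L = X⊆L ; Y⊆R = Y⊆R ; O-out = (v∉S , v∉L , v∉R) ∷ O-out
        ; cover = λ s s∈S → separate-from v (λ { refl → v∉S s∈S }) id id there
            (λ e → inj₂ (inj₂ (here e))) (cover s s∈S) }))
        where open State st

      guess : ∀ {Z} S → State a b Z X Y O W S → ¬ ¬ (∃ λ (D : Vec V (suc d)) →
              VecAll.All (λ v → ¬ v List.∈ Z) D × State a b Z X Y O (filter (nearby? D) W) S)
      guess {Z} S st = do
        -- Only the part of `S` outside `Z` is dominated, by vertices of that part and of the two
        -- sides; so no dominator is in `Z`.
        D , D≤ , D⊆U , D-dom ← dominate {X = λ s → s ∈ S × ¬ s List.∈ Z} L-conn R-conn L∩R L≁R
          (λ (s∈S , _) → (λ s∈L → L∩S s∈L s∈S) , (λ s∈R → R∩S s∈R s∈S) , S-L s∈S , S-R s∈S)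
        let D′ , all-D , any-D = pad a D D≤
        D-near ← ¬¬-∀ (λ s → em {A = s ∈ S × ¬ s List.∈ Z} >>= λ where
          (no ¬p)  → pure λ p → contradiction p ¬p
          (yes p) → D-dom s p >>= λ any → pure λ _ → any-D any)
        pure (D′ , all-D (L∩Z (All.head X⊆L)) (All.map outside D⊆U) , record
          { sep = sep ; Z⊆S = Z⊆S ; X⊆L = X⊆L ; Y⊆R = Y⊆R ; O-out = O-out
          ; cover = λ s s∈S → recover s s∈S (D-near s) (cover s s∈S) })
        where
        open State st
        open Separation sep
        L∩Z : ∀ {v} → v ∈ L → ¬ v List.∈ Z
        L∩Z v∈L v∈Z = L∩S v∈L (All.lookup Z⊆S v∈Z)
        outside : ∀ {v} → v ∈ L ⊎ v ∈ R ⊎ (v ∈ S × ¬ v List.∈ Z) → ¬ v List.∈ Z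
        outside (inj₁ v∈L) = L∩Z v∈L
        outside (inj₂ (inj₁ v∈R)) v∈Z = R∩S v∈R (All.lookup Z⊆S v∈Z)
        outside (inj₂ (inj₂ (_ , v∉Z))) = v∉Z
        recover : ∀ {D : Vec V (suc d)} s → s ∈ S →
                  (s ∈ S × ¬ s List.∈ Z → VecAny.Any (λ v → v ≡ s ⊎ v ~ s) D) →
                  Cover Z (a ∷ X) (b ∷ Y) O W s → Cover Z (a ∷ X) (b ∷ Y) O (filter (nearby? D) W) s
        recover s s∈S near (inj₁ z) = inj₁ z
        recover s s∈S near (inj₂ (inj₁ x)) = inj₂ (inj₁ x)
        recover s s∈S near (inj₂ (inj₂ (inj₁ y))) = inj₂ (inj₂ (inj₁ y))
        recover s s∈S near (inj₂ (inj₂ (inj₂ (inj₁ o)))) = inj₂ (inj₂ (inj₂ (inj₁ o)))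
        recover {D} s s∈S near (inj₂ (inj₂ (inj₂ (inj₂ w)))) with s ∈ₗ? Z
        ... | yes z = inj₁ z
        ... | no ¬z = inj₂ (inj₂ (inj₂ (inj₂ (∈-filter⁺ (nearby? D) w (near (s∈S , ¬z))))))

      -- A popular vertex of `S` moves to `Z` and the scan goes on with the same `W`, so the
      -- alternatives add up over the vertices and do not multiply. At the end every vertex outside
      -- `Z`, in particular every dominator, is unpopular.
      scan : ∀ vs {Z} → (∀ v → v List.∈ vs ⊎ v List.∈ Z ⊎ E * popularity v W < M) →
             AtMost (State a b Z X Y O W)
                    (length vs * (B-labelled + (B-labelled + B-labelled)) + n ^ suc d * B-dominated)
      scan [] {Z} done = atMost-mono guess ≤-refl (atMost-¬¬ (atMost-∃Vec (suc d) λ D →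
          at D (VecAll.all? (λ v → ¬? (v ∈ₗ? Z)) D)))
        where
        at : ∀ D → Dec (VecAll.All (λ v → ¬ v List.∈ Z) D) →
             AtMost (λ S → VecAll.All (λ v → ¬ v List.∈ Z) D × State a b Z X Y O (filter (nearby? D) W) S) B-dominated
        at D (yes D∩Z) = atMost-mono (λ S → proj₂) ≤-refl (dominated D (VecAll.map unpopular D∩Z))
          where
          unpopular : ∀ {v} → ¬ v List.∈ Z → E * popularity v W < M
          unpopular {v} v∉Z with done v
          ... | inj₁ ()
          ... | inj₂ (inj₁ v∈Z) = contradiction v∈Z v∉Z
          ... | inj₂ (inj₂ l) = l
        at D (no ¬D∩Z) = atMost-mono (λ S (D∩Z , _) → ¬D∩Z D∩Z) z≤n (atMost-none λ _ ())
      scan (v ∷ vs) {Z} done with E * popularity v W <? M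
      ... | yes unpopular = atMost-mono (λ _ st → st) (ℕ.+-monoˡ-≤ (n ^ suc d * B-dominated) (ℕ.m≤n+m (length vs * (B-labelled + (B-labelled + B-labelled))) _)) (scan vs λ w → case done w of λ where
          (inj₁ (here refl)) → inj₂ (inj₂ unpopular)
          (inj₁ (there w∈)) → inj₁ w∈
          (inj₂ rest) → inj₂ rest)
      ... | no popular = atMost-mono (label v)
          (≤-reflexive (trans (ℕ.+-comm _ (B-labelled + (B-labelled + B-labelled))) (sym (ℕ.+-assoc (B-labelled + (B-labelled + B-labelled)) (length vs * (B-labelled + (B-labelled + B-labelled))) _))))
          (atMost-⊎ (scan vs done′) (let x , y , o = labelled v (ℕ.≮⇒≥ popular) in atMost-⊎ x (atMost-⊎ y o)))
        where
        done′ : ∀ w → w List.∈ vs ⊎ w List.∈ (v ∷ Z) ⊎ E * popularity w W < M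
        done′ w with done w
        ... | inj₁ (here refl) = inj₂ (inj₁ (here refl))
        ... | inj₁ (there w∈) = inj₁ w∈
        ... | inj₂ (inj₁ w∈Z) = inj₂ (inj₁ (there w∈Z))
        ... | inj₂ (inj₂ l) = inj₂ (inj₂ l)

    -- The undecided vertices W lose a 2^J/E fraction with each vertex labelled as lying
    -- outside the separator, and are halved by guessing d + 1 unpopular dominators.
    count : ∀ J i {a b Z X Y O} W → i ≤ E → E * length W < 2 ^ J * i →
            length (a ∷ X) + rank J i ≤ Λ → length (b ∷ Y) + rank J i ≤ Λ →
            AtMost (State a b Z X Y O W) (bound (rank J i))
    -- At `J = 0` the size condition reads `E * length W < i` with `i ≤ E`, which leaves only the
    -- empty `W`.
    count zero i {a} {b} {Z} {X} {Y} {O} [] i≤E _ X≤ Y≤ = atMost-mono (λ _ st → st) (bound-mono {0} {i} z≤n)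
      (atMost-mono (λ _ st → st) (≤-reflexive (sym (ℕ.+-identityʳ base)))
        (count-base a b Z X Y O (≤-trans (ℕ.m≤m+n _ _) X≤) (≤-trans (ℕ.m≤m+n _ _) Y≤)))
    count zero i (w ∷ W) i≤E small _ _ = contradiction
      (<-≤-trans small (≤-trans (≤-reflexive (ℕ.+-identityʳ i)) i≤E)) (ℕ.≤⇒≯ (ℕ.m≤m*n E (suc (length W))))
    count (suc J) zero W i≤E small _ _ = contradiction (subst (E * length W <_) (ℕ.*-zeroʳ (2 ^ suc J)) small) λ ()
    count (suc J) (suc i) {a} {b} {Z} {X} {Y} {O} W i≤E small X≤ Y≤ =
      atMost-mono (λ _ st → st)
        (≤-trans (≤-reflexive (cong (λ l → l * (B + (B + B)) + n ^ suc d * bound (rank J E)) (length-tabulate {n = n} id)))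
          (≤-trans (scan-bound dominated-rank) (≤-reflexive (cong bound (sym (ℕ.+-suc (suc J * suc E) i))))))
        (Scan.scan a b X Y O W (2 ^ suc J) B (bound (rank J E))
          (λ v popular → let small′ = shrunk-size v W popular small ; i≤ = ℕ.<⇒≤ i≤E in
            count (suc J) i _ i≤ small′ (shift {∣X∣} X≤) (weaken {∣Y∣} Y≤) ,
            count (suc J) i _ i≤ small′ (weaken {∣X∣} X≤) (shift {∣Y∣} Y≤) ,
            count (suc J) i _ i≤ small′ (weaken {∣X∣} X≤) (weaken {∣Y∣} Y≤))
          (λ D unpopular → count J E _ ≤-refl (halved D unpopular)
            (≤-trans (ℕ.+-monoʳ-≤ _ (≤-trans dominated-rank step)) X≤)
            (≤-trans (ℕ.+-monoʳ-≤ _ (≤-trans dominated-rank step)) Y≤))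
          (allFin n) (λ v → inj₁ (∈-allFin v)))
      where
      B = bound (rank (suc J) i)
      ∣X∣ = length (a ∷ X)
      ∣Y∣ = length (b ∷ Y)
      step : rank (suc J) i ≤ rank (suc J) (suc i)
      step = ℕ.+-monoʳ-≤ (suc J * suc E) (ℕ.n≤1+n i)
      dominated-rank : rank J E ≤ rank (suc J) i
      dominated-rank = ≤-trans (≤-trans (≤-reflexive (ℕ.+-comm (J * suc E) E)) (ℕ.n≤1+n _)) (ℕ.m≤m+n _ i)
      weaken : ∀ {x} → x + rank (suc J) (suc i) ≤ Λ → x + rank (suc J) i ≤ Λ
      weaken = ≤-trans (ℕ.+-monoʳ-≤ _ step)
      shift : ∀ {x} → x + rank (suc J) (suc i) ≤ Λ → suc x + rank (suc J) i ≤ Λ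
      shift {x} l = ≤-trans (≤-reflexive (sym (trans (cong (x +_) (ℕ.+-suc (suc J * suc E) i)) (ℕ.+-suc x _)))) l
      halved : ∀ (D : Vec V (suc d)) → VecAll.All (λ v → E * popularity v W < 2 ^ suc J) D →
               E * length (filter (nearby? D) W) < 2 ^ J * E
      halved D unpopular = begin-strict
        E * length (filter (nearby? D) W)          <⟨ ℕ.m<m+n _ (s≤s z≤n) ⟩
        E * length (filter (nearby? D) W) + suc d  ≤⟨ nearby-size D W unpopular ⟩
        suc d * (2 * 2 ^ J)                        ≡⟨ sym (ℕ.*-assoc (suc d) 2 (2 ^ J)) ⟩
        suc d * 2 * 2 ^ J                          ≡⟨ cong (_* 2 ^ J) (ℕ.*-comm (suc d) 2) ⟩
        E * 2 ^ J                                  ≡⟨ ℕ.*-comm E (2 ^ J) ⟩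
        2 ^ J * E                                  ∎
        where open ℕ.≤-Reasoning

  count-separators : ∀ J → n < 2 ^ J → let ρ = rank J E in
    AtMost (IsMinimalSeparator G) (n * (n * bound (suc ρ) ρ))
  count-separators J n<2^J = atMost-mono start ≤-refl
    -- Each list starts with one vertex and gains at most one per level, hence the length bound
    -- `suc ρ`.
    (atMost-∃ λ a → atMost-∃ λ b → count (suc ρ) J E {a} {b} (allFin n) ≤-refl small ≤-refl ≤-refl)
    where
    ρ = rank J E
    small : E * length (allFin n) < 2 ^ J * E
    small = subst (_< 2 ^ J * E) (trans (ℕ.*-comm n E) (cong (E *_) (sym (length-tabulate {n = n} id))))
                  (ℕ.*-monoˡ-< E n<2^J)
    start : ∀ S → IsMinimalSeparator G S → ∃₂ λ a b → State a b [] [] [] [] (allFin n) S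
    start S minsep with L , R , sep ← separation G minsep =
      let ((a , a∈L) , _) = Separation.L-conn sep ; ((b , b∈R) , _) = Separation.R-conn sep in
      a , b , record { sep = sep ; Z⊆S = [] ; X⊆L = a∈L ∷ [] ; Y⊆R = b∈R ∷ [] ; O-out = []
                     ; cover = λ s _ → inj₂ (inj₂ (inj₂ (inj₂ (∈-allFin s)))) }

-- The exponent of the final bound

n<2^1+⌊log₂n⌋ : ∀ n → n < 2 ^ suc ⌊log₂ n ⌋
n<2^1+⌊log₂n⌋ n = ℕ.≰⇒> λ l →
  ℕ.1+n≰n (≤-trans (≤-reflexive (sym (⌊log₂[2^n]⌋≡n (suc ⌊log₂ n ⌋)))) (⌊log₂⌋-mono-≤ l))

module Exponent (k d : ℕ) where

  private
    E = 2 * suc d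
    -- Since `suc l` is at most `2 * l` for positive `l`, the rank is at most this multiple of `l`.
    rankCoefficient = 2 * suc E + E

  exponent : ℕ
  exponent = 2 + (suc d + 2) * rankCoefficient + (suc rankCoefficient * k + suc rankCoefficient * k)

  bound-≤ : ∀ n l → 2 ≤ n → 1 ≤ l → let ρ = suc l * suc E + E in
    n * (n * ((n ^ suc d + n * 3) ^ ρ * (n ^ (suc ρ * k) * (n ^ (suc ρ * k) * 1)))) ≤ n ^ (exponent * l)
  bound-≤ n@(suc n-1) l 2≤n 1≤l = begin
    n * (n * (growth ^ ρ * (n ^ (suc ρ * k) * (n ^ (suc ρ * k) * 1))))
      ≤⟨ ℕ.*-monoʳ-≤ n (ℕ.*-monoʳ-≤ n (ℕ.*-mono-≤ (ℕ.^-monoˡ-≤ ρ growth≤)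
           (≤-reflexive (cong (n ^ (suc ρ * k) *_) (ℕ.*-identityʳ _))))) ⟩
    n * (n * ((n ^ (suc d + 2)) ^ ρ * (n ^ (suc ρ * k) * n ^ (suc ρ * k))))
      ≡⟨ cong (λ x → n * (n * x)) (cong₂ _*_ (ℕ.^-*-assoc n (suc d + 2) ρ) (sym (ℕ.^-distribˡ-+-* n (suc ρ * k) _))) ⟩
    n * (n * (n ^ ((suc d + 2) * ρ) * n ^ (suc ρ * k + suc ρ * k)))
      ≡⟨ cong (λ x → n * (n * x)) (sym (ℕ.^-distribˡ-+-* n ((suc d + 2) * ρ) _)) ⟩
    n ^ (2 + ((suc d + 2) * ρ + (suc ρ * k + suc ρ * k)))
      ≤⟨ ℕ.^-monoʳ-≤ n exponent≤ ⟩
    n ^ (exponent * l) ∎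
    where
    open ℕ.≤-Reasoning
    ρ = suc l * suc E + E
    growth = n ^ suc d + n * 3
    growth≤ : growth ≤ n ^ (suc d + 2)
    growth≤ = begin
      n ^ suc d + n * 3                 ≤⟨ ℕ.+-monoʳ-≤ (n ^ suc d) (ℕ.*-monoˡ-≤ 3 (ℕ.m≤m*n n (n ^ d) {{ℕ.m^n≢0 n d}})) ⟩
      n ^ suc d + n ^ suc d * 3         ≡⟨ sym (ℕ.*-suc (n ^ suc d) 3) ⟩
      -- The constant is absorbed by `n ^ 2`, as `n` is at least 2.
      n ^ suc d * 4                     ≤⟨ ℕ.*-monoʳ-≤ (n ^ suc d) (ℕ.^-monoˡ-≤ 2 2≤n) ⟩
      n ^ suc d * n ^ 2                 ≡⟨ sym (ℕ.^-distribˡ-+-* n (suc d) 2) ⟩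
      n ^ (suc d + 2)                   ∎
    scale : ∀ x → x ≤ x * l
    scale x = ≤-trans (≤-reflexive (sym (ℕ.*-identityʳ x))) (ℕ.*-monoʳ-≤ x 1≤l)
    ρ≤ : ρ ≤ rankCoefficient * l
    ρ≤ = begin
      suc l * suc E + E           ≤⟨ ℕ.+-mono-≤ (ℕ.*-monoˡ-≤ (suc E) (ℕ.+-mono-≤ 1≤l (≤-reflexive (sym (ℕ.+-identityʳ l))))) (scale E) ⟩
      2 * l * suc E + E * l       ≡⟨ cong (_+ E * l) (trans (ℕ.*-assoc 2 l (suc E)) (trans (cong (2 *_) (ℕ.*-comm l (suc E))) (sym (ℕ.*-assoc 2 (suc E) l)))) ⟩
      2 * suc E * l + E * l       ≡⟨ sym (ℕ.*-distribʳ-+ l (2 * suc E) E) ⟩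
      rankCoefficient * l         ∎
    copies≤ : suc ρ * k ≤ suc rankCoefficient * k * l
    copies≤ = begin
      suc ρ * k                   ≤⟨ ℕ.*-monoˡ-≤ k (ℕ.+-mono-≤ 1≤l ρ≤) ⟩
      suc rankCoefficient * l * k ≡⟨ trans (ℕ.*-assoc (suc rankCoefficient) l k) (trans (cong (suc rankCoefficient *_) (ℕ.*-comm l k)) (sym (ℕ.*-assoc (suc rankCoefficient) k l))) ⟩
      suc rankCoefficient * k * l ∎
    exponent≤ : 2 + ((suc d + 2) * ρ + (suc ρ * k + suc ρ * k)) ≤ exponent * l
    exponent≤ = begin
      2 + ((suc d + 2) * ρ + (suc ρ * k + suc ρ * k))
        ≤⟨ ℕ.+-mono-≤ (scale 2) (ℕ.+-mono-≤ (ℕ.*-monoʳ-≤ (suc d + 2) ρ≤) (ℕ.+-mono-≤ copies≤ copies≤)) ⟩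
      2 * l + ((suc d + 2) * (rankCoefficient * l) + (suc rankCoefficient * k * l + suc rankCoefficient * k * l))
        ≡⟨ cong (2 * l +_) (cong₂ _+_ (sym (ℕ.*-assoc (suc d + 2) rankCoefficient l))
             (sym (ℕ.*-distribʳ-+ l (suc rankCoefficient * k) _))) ⟩
      2 * l + ((suc d + 2) * rankCoefficient * l + (suc rankCoefficient * k + suc rankCoefficient * k) * l)
        ≡⟨ sym (ℕ.+-assoc (2 * l) ((suc d + 2) * rankCoefficient * l) _) ⟩
      2 * l + (suc d + 2) * rankCoefficient * l + (suc rankCoefficient * k + suc rankCoefficient * k) * l
        ≡⟨ cong (_+ (suc rankCoefficient * k + suc rankCoefficient * k) * l) (sym (ℕ.*-distribʳ-+ l 2 ((suc d + 2) * rankCoefficient))) ⟩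
      (2 + (suc d + 2) * rankCoefficient) * l + (suc rankCoefficient * k + suc rankCoefficient * k) * l
        ≡⟨ sym (ℕ.*-distribʳ-+ l (2 + (suc d + 2) * rankCoefficient) _) ⟩
      exponent * l ∎

no-separators : (G : Graph 1) {S : Subset 1} → ¬ IsMinimalSeparator G S
no-separators G ((zero , s∈S) , L , _ , _ , (((zero , v∈L) , _) , L⊆ , _) , _) = x∈∁p⇒x∉p (L⊆ v∈L) s∈S

theorem1 : (k : ℕ) → StronglyQuasiTame (CreatureAndLadderFree k)
theorem1 k = exponent , λ where
    zero {{}}
    -- Here the logarithm vanishes and `bound-≤` does not apply; but a nonempty separator would
    -- leave no vertex for a component.
    (suc zero) G _ → atMost-mono (λ S minsep → no-separators G minsep) z≤n (atMost-none λ _ ())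
    n@(suc (suc _)) G (free , ¬ladder) →
      let l = ⌊log₂ n ⌋ in
      atMost-mono (λ S minsep → minsep)
        (bound-≤ n l (s≤s (s≤s z≤n)) (⌊log₂⌋-mono-≤ {2} {n} (s≤s (s≤s z≤n))))
        (Count.count-separators G free d (λ L-conn R-conn → few-dominators G free ¬ladder L-conn R-conn)
          (suc l) (n<2^1+⌊log₂n⌋ n))
  where
  d : ℕ
  d = pred (Constants.dominators k)
  open Exponent k d
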